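{- Let $k\ge 3$ and let $n_1,\dots,n_r\ge 2$ be integers such that at least six of the $n_i$ are odd. For each $1\le i\le r$ let $\mathcal{F}^1_i,\dots,\mathcal{F}^k_i$ be pairwise almost orthogonal symmetric chain decompositions of $Q_{n_i}$, and suppose that the collection $\{\mathcal{F}^j_i\}_{j=1}^k$ is good whenever $n_i$ is even. Then there exist $k$ pairwise almost orthogonal symmetric chain decompositions $\mathcal{H}^1,\dots,\mathcal{H}^k$ of $Q_{n_1+\cdots+n_r}$ such that for each $j$, every chain of $\mathcal{H}^j$ is contained in a cuboid $A_1\times\cdots\times A_r$ with $A_i\in\mathcal{F}^j_i$ for all $i$.
   Context: $Q_n$ denotes the Boolean lattice of subsets of $[n]=\{1,\dots,n\}$ under inclusion. We identify $Q_{n_1}\times\cdots\times Q_{n_r}$ (product order) with $Q_{n_1+\cdots+n_r}$ by splitting $[n_1+\cdots+n_r]$ into consecutive blocks of sizes $n_1,\dots,n_r$. A symmetric chain in $Q_n$ consists of exactly one subset of each size $j,j+1,\dots,n-j$ for some $j$; a symmetric chain decomposition (SCD) is a partition of $Q_n$ into symmetric chains. Two SCDs $\mathcal{F},\mathcal{G}$ of $Q_n$ are almost orthogonal if for all chains $A\in\mathcal{F}$, $B\in\mathcal{G}$, $|A\cap B|\le1$, except when $A$ and $B$ both contain $\varnothing$ and $[n]$, in which case $|A\cap B|=2$. A collection $\{\mathcal{F}^j\}$ of pairwise almost orthogonal SCDs of $Q_n$ with $n$ even is good if the $1$-element chains occurring in the different $\mathcal{F}^j$ are pairwise distinct (no $1$-element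 chain belongs to two different $\mathcal{F}^j$). -}

module Defs where

open import Data.Nat using (ℕ; zero; suc; _+_; _*_; _∸_; _≤_; _%_)
open import Data.Bool using (Bool)
import Data.Bool as Bool
open import Data.Fin using (Fin)
open import Data.Fin.Subset using (Subset; _⊆_; ∣_∣; ⊥; ⊤)
open import Data.Vec using (Vec; take; drop)
import Data.Vec.Properties as VecP
open import Data.List using (List; []; _∷_; length; map; filter; concat; applyUpTo; lookup)
open import Data.Nat.ListAction using (sum)
open import Data.List.Membership.Propositional using (_∈_)
import Data.List.Membership.DecPropositional as DecMem
open import Data.List.Relation.Unary.Linked using (Linked)
open import Data.List.Relation.Unary.Unique.Propositional using (Unique)
open import Data.Product using (Σ; _×_; ∃)
open import Relation.Binary.PropositionalEquality using (_≡_; _≢_)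
open import Relation.Binary.Definitions using (DecidableEquality)
open import Relation.Nullary using (¬_)

-- Q_n : subsets of [n] = {1..n}, represented by characteristic vectors Subset n.
_≟ₛ_ : ∀ {n} → DecidableEquality (Subset n)
_≟ₛ_ = VecP.≡-dec Bool._≟_

open module M {n : ℕ} = DecMem (_≟ₛ_ {n}) using (_∈?_)

-- A chain is represented as the list of its elements, listed in increasing order.
Chain : ℕ → Set
Chain n = List (Subset n)

IsSymmetricChain : (n : ℕ) → Chain n → Set
IsSymmetricChain n C =
  Σ ℕ λ j → (2 * j ≤ n)
          × (map ∣_∣ C ≡ applyUpTo (j +_) (suc (n ∸ 2 * j)))
          × Linked _⊆_ C

IsSCD : (n : ℕ) → List (Chain n) → Set
IsSCD n F =
  ((C : Chain n) → C ∈ F → IsSymmetricChain n C)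
  × ((x : Subset n) → x ∈ concat F)
  × Unique (concat F)

-- |A ∩ B| for chains (A has no repeated elements when symmetric).
interSize : ∀ {n} → Chain n → Chain n → ℕ
interSize A B = length (filter (λ x → x ∈? B) A)

HasBottomTop : ∀ {n} → Chain n → Set
HasBottomTop {n} C = (⊥ ∈ C) × (⊤ ∈ C)

AlmostOrthogonal : (n : ℕ) → List (Chain n) → List (Chain n) → Set
AlmostOrthogonal n F G =
  (A B : Chain n) → A ∈ F → B ∈ G →
    ((HasBottomTop A × HasBottomTop B) → interSize A B ≡ 2)
    × (¬ (HasBottomTop A × HasBottomTop B) → interSize A B ≤ 1)

PairwiseAlmostOrthogonal : (n k : ℕ) → (Fin k → List (Chain n)) → Set
PairwiseAlmostOrthogonal n k F =
  (j j' : Fin k) → j ≢ j' → AlmostOrthogonal n (F j) (F j')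

Good : (n k : ℕ) → (Fin k → List (Chain n)) → Set
Good n k F =
  (j j' : Fin k) → j ≢ j' → (x : Subset n) →
    (x ∷ []) ∈ F j → ¬ ((x ∷ []) ∈ F j')

-- Block projection: identify Q_{n_1+...+n_r} with Q_{n_1} × ... × Q_{n_r}
-- via consecutive blocks of sizes n_1, ..., n_r.
block : (ns : List ℕ) → Subset (sum ns) → (i : Fin (length ns)) → Subset (lookup ns i)
block (n ∷ ns) x Fin.zero    = take n x
block (n ∷ ns) x (Fin.suc i) = block ns (drop n x) i

numOdd : List ℕ → ℕ
numOdd ns = length (filter (λ m → m % 2 Data.Nat.≟ 1) ns)

{-# OPTIONS --safe #-}

{-
Call a pair of elements x < y of a cuboid A₁ × ⋯ × A_r bad if each coordinate either agrees in x and y or moves from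
∅ to the whole block.  Two chains taken from cuboids over different families can only share bad pairs.  So it is
enough to split every cuboid into symmetric chains without bad pairs, where the pair formed by the bottom and the top
of the cuboid is tolerated: if two chains share such a pair, goodness forces it to be (∅ , [n]).

A cuboid is a product of segments [a₁] × ⋯ × [a_r], at least six of the aᵢ being odd, and the bad pairs move coordinates
with aᵢ ≥ 2 from 0 to aᵢ.  Exchanging the ends of the two outermost hooks of [a] × [b], a, b ≥ 2, leaves one chain
with a bad pair, formed by its ends, and a smaller rectangle.  Hence every product X of segments of length at least two
splits into chains whose only bad pairs are formed by their ends, and [p] × X has a decomposition without bad pairs
if p ≥ 2 and the ends of [p] do not count as a bad pair.  With d ≥ 4 this also settles [d] × X, up to its bottom and
top.  Let u be the number of aᵢ = 1.  If u ≥ 5, split [1]⁵ into chains and ladders, which behave like such [p].  If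
1 ≤ u ≤ 4, there are two odd a, b ≥ 3, and [1] × [a] × [b] is split in the same way.  If u = 0, two odd a, b ≥ 3
give [a] × [b] = a chain of length a + b, a chain without bad pairs, and [a-2] × [b-2] without bad pairs; the last one
is long enough unless a = b = 3, when it is [1]² and the case u = 2 applies.
-}
module Submission where

open import Defs
open import Data.Nat using (ℕ; _≤_; _%_)
open import Data.Nat.ListAction using (sum)
open import Data.Fin using (Fin)
open import Data.List using (List; length; lookup)
open import Data.List.Membership.Propositional using (_∈_)
open import Data.Product using (Σ; _×_)
open import Relation.Binary.PropositionalEquality using (_≡_)

import Algebra.Solver.CommutativeMonoid as CMSolver
import Data.Bool as Bool
open import Data.Empty using (⊥; ⊥-elim)
import Data.Fin as Fin
open import Data.Fin.Subset using (Subset; _⊆_; ∣_∣; inside; outside) renaming (⊥ to ∅; ⊤ to ⊤ˢ)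
open import Data.Fin.Subset.Properties using (drop-∷-⊆; ⊆-refl; ⊆-trans; ⊆-antisym; ⊥⊆; ⊆⊤; ∣⊥∣≡0; ∣⊤∣≡n)
open import Data.List using ([]; _∷_; _++_; [_]; map; concat; concatMap; cartesianProduct; filter; applyUpTo; replicate)
open import Data.List.Properties using (map-id; map-++; map-∘; ++-assoc; ++-identityʳ; concat-++; concatMap-++; map-cong-local; filter-accept; filter-reject; ∷-injectiveˡ; ∷-injectiveʳ; cartesianProductWith-distribʳ-++; cartesianProductWith-zeroʳ)
import Data.List.Membership.DecPropositional as DecMem
open import Data.List.Membership.Propositional.Properties using (∈-map⁺; ∈-map⁻; ∈-filter⁺; ∈-filter⁻; ∈-concat⁺′; ∈-++⁺ˡ; ∈-++⁺ʳ; ∈-++⁻; ∈-cartesianProduct⁺; ∈-cartesianProduct⁻)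
open import Data.List.Relation.Binary.Permutation.Propositional using (_↭_; ↭-refl; ↭-reflexive; ↭-sym; ↭-trans; prep; swap; ↭⇒↭ₛ)
open import Data.List.Relation.Binary.Permutation.Propositional.Properties using (shift; ∈-resp-↭; map⁺; ++⁺; ++⁺ˡ; ++-comm; shifts; ++-commutativeMonoid)
import Data.List.Relation.Binary.Permutation.Setoid.Properties as PermSetoid
open import Data.List.Relation.Unary.All as All using (All; []; _∷_; all?)
import Data.List.Relation.Unary.All.Properties as All
open import Data.List.Relation.Unary.AllPairs using (AllPairs; []; _∷_)
open import Data.List.Relation.Unary.Any using (here; there)
open import Data.List.Relation.Unary.Linked using (Linked; []; [-]; _∷_; linked?)
open import Data.List.Relation.Unary.Linked.Properties using (Linked⇒AllPairs)
open import Data.List.Relation.Unary.Unique.Propositional using (Unique)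
import Data.List.Relation.Unary.Unique.Propositional.Properties as Unique
open import Data.Maybe using (Maybe; just; nothing; is-just; to-witness-T)
open import Data.Nat using (zero; suc; _+_; _*_; _∸_; _<_; z≤n; s≤s; z<s)
open import Data.Nat.ListAction.Properties using (sum-↭)
open import Data.Nat.Properties
open import Data.Nat.Tactic.RingSolver using (solve-∀)
open import Data.Product using (∃-syntax; _,_; proj₁; proj₂) renaming (map to map×)
import Data.Product as ×
open import Data.Product.Properties using (≡-dec)
open import Data.Sum using (_⊎_; inj₁; inj₂; [_,_]′)
open import Data.Unit using (⊤; tt)
open import Data.Vec using ([]; _∷_)
import Data.Vec as Vec
import Data.Vec.Properties as VecP
open import Function using (_∘_; id)
open import Relation.Binary.Definitions using (DecidableEquality)
open import Relation.Binary.PropositionalEquality using (_≢_; refl; sym; trans; cong; cong₂; subst; subst₂; setoid)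
open import Relation.Nullary using (¬_; Dec; yes; no)
open import Relation.Nullary.Decidable using (True; toWitness; _×-dec_; _⊎-dec_; _→-dec_)

-- Spaces, morphisms and symmetric chain decompositions

-- Everything turns on two-element chains. The product of such a chain with a segment whose ends are
-- bad has no decomposition without bad pairs, so the two must never meet alone. In products of
-- longer segments parity prevents this: the number of steps of a symmetric chain has the parity of
-- the total rank, so while the total is even no chain has exactly one step. Odd sides are therefore
-- multiplied on in pairs, and an unpaired one comes last. Inside [1]⁵ and [1] × [3] × [3]
-- two-element chains are forced by the rank sizes; each is tied there to a longer chain by a few
-- extra covers. The number six is 5 + 1. If some side is 1, two odd sides of at least 3 suffice
-- beside it; otherwise at most one odd side differs from 1, and six odd sides leave five equal to
-- 1. If no side is 1, four odd sides are enough: two sides 3 may be used up in producing [1]²,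
-- which then calls for two further odd sides.

-- Ranked graded orders given by their covers.  E x y says that x = y or that (x , y) is bad, i.e. that no chain
-- should contain both.
record Space : Set₁ where
  no-eta-equality
  infix 4 _⋖_
  field
    Pt    : Set
    rk    : Pt → ℕ
    _⋖_   : Pt → Pt → Set
    E     : Pt → Pt → Set
    ⋖⇒rk  : ∀ {x y} → x ⋖ y → rk y ≡ suc (rk x)

open Space

infixr 5 _⊗_
_⊗_ : Space → Space → Space
Pt   (S ⊗ T) = Pt S × Pt T
rk   (S ⊗ T) (x , y) = rk S x + rk T y
_⋖_  (S ⊗ T) (x , y) (x′ , y′) = (_⋖_ S x x′ × y ≡ y′) ⊎ (x ≡ x′ × _⋖_ T y y′)
E    (S ⊗ T) (x , y) (x′ , y′) = E S x x′ × E T y y′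
⋖⇒rk (S ⊗ T) {x , y} (inj₁ (p , refl)) = cong (_+ rk T y) (⋖⇒rk S p)
⋖⇒rk (S ⊗ T) {x , y} (inj₂ (refl , p)) = trans (cong (rk S x +_) (⋖⇒rk T p)) (+-suc _ _)

-- A chain 0 ⋖ 1 ⋖ 2 ⋖ ... whose only bad pair is (0 , e); there is none when e = 0.
Seg : ℕ → Space
Pt   (Seg e) = ℕ
rk   (Seg e) i = i
_⋖_  (Seg e) i j = j ≡ suc i
E    (Seg e) i j = i ≡ j ⊎ (i ≡ 0 × j ≡ e)
⋖⇒rk (Seg e) p = p

private variable
  S T U V : Space
  N M : ℕ
  τ τ′ : ℕ → ℕ

rng : ℕ → ℕ → List ℕ
rng s zero    = []
rng s (suc n) = s ∷ rng (suc s) n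

rng-++ : ∀ s m n → rng s (m + n) ≡ rng s m ++ rng (s + m) n
rng-++ s zero    n = cong (λ t → rng t n) (sym (+-identityʳ s))
rng-++ s (suc m) n rewrite +-suc s m = cong (s ∷_) (rng-++ (suc s) m n)

rng-suc : ∀ s n → map suc (rng s n) ≡ rng (suc s) n
rng-suc s zero = refl
rng-suc s (suc n) = cong (suc s ∷_) (rng-suc (suc s) n)

rng-shift : ∀ k s n → map (k +_) (rng s n) ≡ rng (k + s) n
rng-shift k s zero = refl
rng-shift k s (suc n) = cong (k + s ∷_) (trans (rng-shift k (suc s) n) (cong (λ t → rng t n) (+-suc k s)))

∈-rng⁻ : ∀ {i s n} → i ∈ rng s n → s ≤ i × i < s + n
∈-rng⁻ {s = s} {suc n} (here refl) = ≤-refl , m<m+n s (s≤s z≤n)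
∈-rng⁻ {i} {s} {suc n} (there p) with ∈-rng⁻ p
... | l , u = <⇒≤ l , subst (i <_) (sym (+-suc s n)) u

rng-∷ʳ : ∀ s n → rng s (suc n) ≡ rng s n ++ [ s + n ]
rng-∷ʳ s n = trans (cong (rng s) (+-comm 1 n)) (rng-++ s n 1)

prod : ∀ {A B : Set} → List A → List B → List (A × B)
prod = cartesianProduct

prod-++ˡ : ∀ {A B : Set} (xs ys : List A) {zs : List B} → prod (xs ++ ys) zs ≡ prod xs zs ++ prod ys zs
prod-++ˡ xs ys {zs} = cartesianProductWith-distribʳ-++ _,_ xs ys zs

interchange : ∀ {A : Set} (a b c d : List A) → (a ++ b) ++ (c ++ d) ↭ (a ++ c) ++ (b ++ d)
interchange a b c d =
  ↭-trans (↭-reflexive (++-assoc a b (c ++ d)))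
  (↭-trans (++⁺ˡ a (shifts b c))
  (↭-reflexive (sym (++-assoc a c (b ++ d)))))

prod-++ʳ : ∀ {A B : Set} (xs : List A) (ys zs : List B) → prod xs (ys ++ zs) ↭ prod xs ys ++ prod xs zs
prod-++ʳ [] ys zs = ↭-refl
prod-++ʳ (x ∷ xs) ys zs =
  ↭-trans (++⁺ (↭-reflexive (map-++ (x ,_) ys zs)) (prod-++ʳ xs ys zs))
          (interchange (map (x ,_) ys) (map (x ,_) zs) (prod xs ys) (prod xs zs))

prod-↭ʳ : ∀ {A B : Set} (xs : List A) {ys zs : List B} → ys ↭ zs → prod xs ys ↭ prod xs zs
prod-↭ʳ [] p = ↭-refl
prod-↭ʳ (x ∷ xs) p = ++⁺ (map⁺ (x ,_) p) (prod-↭ʳ xs p)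

prod-↭ˡ : ∀ {A B : Set} {xs ys : List A} (zs : List B) → xs ↭ ys → prod xs zs ↭ prod ys zs
prod-↭ˡ zs _↭_.refl = ↭-refl
prod-↭ˡ zs (prep x p) = ++⁺ˡ (map (x ,_) zs) (prod-↭ˡ zs p)
prod-↭ˡ zs (swap x y p) =
  ↭-trans (shifts (map (x ,_) zs) (map (y ,_) zs))
          (++⁺ˡ (map (y ,_) zs) (++⁺ˡ (map (x ,_) zs) (prod-↭ˡ zs p)))
prod-↭ˡ zs (_↭_.trans p q) = ↭-trans (prod-↭ˡ zs p) (prod-↭ˡ zs q)

prod-map : ∀ {A B A′ B′ : Set} (f : A → A′) (g : B → B′) xs ys →
  prod (map f xs) (map g ys) ≡ map (map× f g) (prod xs ys)
prod-map f g [] ys = refl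
prod-map f g (x ∷ xs) ys = trans
  (cong₂ _++_ (trans (sym (map-∘ ys)) (map-∘ ys)) (prod-map f g xs ys))
  (sym (map-++ (map× f g) (map (x ,_) ys) (prod xs ys)))

-- `E-refl` reflects `E`, in the direction opposite to the covers: a bad pair in the image must come
-- from one in the source, so decompositions without bad pairs push forward. Asking for this only on
-- `L` allows a source with fewer marked ends when the ends of a segment are missing from the image.
record Mor (S T : Space) (L : List (Pt S)) (f : Pt S → Pt T) (k : ℕ) : Set where
  field
    rk-shift : ∀ {x} → x ∈ L → rk T (f x) ≡ k + rk S x
    ⋖-pres   : ∀ {x y} → x ∈ L → y ∈ L → _⋖_ S x y → _⋖_ T (f x) (f y)
    E-refl   : ∀ {x y} → x ∈ L → y ∈ L → E T (f x) (f y) → E S x y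

open Mor

mor-∘ : ∀ {L f g k l} → Mor T U (map f L) g l → Mor S T L f k → Mor S U L (g ∘ f) (l + k)
rk-shift (mor-∘ {f = f} {k = k} {l = l} G F) x = trans (rk-shift G (∈-map⁺ f x)) (trans (cong (l +_) (rk-shift F x)) (sym (+-assoc l k _)))
⋖-pres (mor-∘ {f = f} G F) x y = ⋖-pres G (∈-map⁺ f x) (∈-map⁺ f y) ∘ ⋖-pres F x y
E-refl (mor-∘ {f = f} G F) x y = E-refl F x y ∘ E-refl G (∈-map⁺ f x) (∈-map⁺ f y)

mor-id : ∀ {L} → Mor S S L id 0
rk-shift mor-id _ = refl
⋖-pres mor-id _ _ p = p
E-refl mor-id _ _ e = e

mor-⊗ : ∀ {L K f g k l} → Mor S T L f k → Mor U V K g l → Mor (S ⊗ U) (T ⊗ V) (prod L K) (map× f g) (k + l)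
rk-shift (mor-⊗ {S = S} {U = U} {L = L} {K} {k = k} {l} F G) {x , y} p with ∈-cartesianProduct⁻ L K p
... | a , b = trans (cong₂ _+_ (rk-shift F a) (rk-shift G b)) (lem k (rk S x) l (rk U y))
  where lem : ∀ a b c d → (a + b) + (c + d) ≡ (a + c) + (b + d)
        lem = solve-∀
⋖-pres (mor-⊗ {L = L} {K} {g = g} F G) p q (inj₁ (c , e)) =
  inj₁ (⋖-pres F (proj₁ (∈-cartesianProduct⁻ L K p)) (proj₁ (∈-cartesianProduct⁻ L K q)) c , cong g e)
⋖-pres (mor-⊗ {L = L} {K} {f = f} F G) p q (inj₂ (e , c)) =
  inj₂ (cong f e , ⋖-pres G (proj₂ (∈-cartesianProduct⁻ L K p)) (proj₂ (∈-cartesianProduct⁻ L K q)) c)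
E-refl (mor-⊗ {L = L} {K} F G) p q (e , e′) =
  E-refl F (proj₁ (∈-cartesianProduct⁻ L K p)) (proj₁ (∈-cartesianProduct⁻ L K q)) e ,
  E-refl G (proj₂ (∈-cartesianProduct⁻ L K p)) (proj₂ (∈-cartesianProduct⁻ L K q)) e′

mor-⊆ : ∀ {L K f k} → (∀ {x} → x ∈ K → x ∈ L) → Mor S T L f k → Mor S T K f k
rk-shift (mor-⊆ i F) = rk-shift F ∘ i
⋖-pres (mor-⊆ i F) p q = ⋖-pres F (i p) (i q)
E-refl (mor-⊆ i F) p q = E-refl F (i p) (i q)

full : ℕ → List ℕ
full a = rng 0 (suc a)

-- A symmetric chain of rank sum N whose only possible bad pair is (bottom, top) when τ len = len,
-- and which has no bad pair at all when τ len = 0.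
record Chn (τ : ℕ → ℕ) (T : Space) (N : ℕ) : Set where
  field
    len     : ℕ
    at      : ℕ → Pt T
    base    : ℕ
    embed   : Mor (Seg (τ len)) T (full len) at base
    centred : base + base + len ≡ N

open Chn

els : ∀ {τ} → Chn τ T N → List (Pt T)
els c = map (at c) (full (len c))

-- A permutation of `L` says at once that the chains cover `L` and do not overlap, and lets
-- decompositions of parts be glued without side conditions.
record SCD (τ : ℕ → ℕ) (T : Space) (N : ℕ) (L : List (Pt T)) : Set where
  constructor dec
  field
    cs   : List (Chn τ T N)
    perm : concatMap els cs ↭ L

free : ℕ → ℕ
free _ = 0

-- Only segments with at least three elements can be full chains of a Q_n with n ≥ 2; the others are unmarked.
top : ℕ → ℕ
top 0 = 0
top 1 = 0
top a = a

dec-resp : ∀ {L K} → L ↭ K → SCD τ T N L → SCD τ T N K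
dec-resp p (dec cs q) = dec cs (↭-trans q p)

dec-[] : SCD τ T N []
dec-[] = dec [] ↭-refl

dec-++ : ∀ {L K} → SCD τ T N L → SCD τ T N K → SCD τ T N (L ++ K)
dec-++ (dec cs p) (dec ds q) = dec (cs ++ ds) (↭-trans (↭-reflexive (concatMap-++ els cs ds)) (++⁺ p q))

chn-map : ∀ {L g k N′} → Mor S T L g k → k + k + N ≡ N′ → (c : Chn τ S N) → (∀ {x} → x ∈ els c → x ∈ L) → Chn τ T N′
len  (chn-map G e c i) = len c
at   (chn-map {g = g} G e c i) = g ∘ at c
base (chn-map {k = k} G e c i) = k + base c
embed  (chn-map G e c i) = mor-∘ (mor-⊆ i G) (embed c)
centred (chn-map {k = k} G e c i) = trans (lem k (base c) (len c)) (trans (cong (k + k +_) (centred c)) e)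
  where lem : ∀ k b l → (k + b) + (k + b) + l ≡ k + k + (b + b + l)
        lem = solve-∀

dec-map : ∀ {L g k N′} → Mor S T L g k → k + k + N ≡ N′ → SCD τ S N L → SCD τ T N′ (map g L)
dec-map {S = S} {T} {N} {τ} {L} {g} {k} {N′} G e (dec cs p) = dec (go cs (∈-resp-↭ p)) (↭-trans (↭-reflexive (go≡ cs (∈-resp-↭ p))) (map⁺ g p))
  where
  go : (cs : List (Chn τ S N)) → (∀ {x} → x ∈ concatMap els cs → x ∈ L) → List (Chn τ T N′)
  go [] i = []
  go (c ∷ cs) i = chn-map G e c (i ∘ ∈-++⁺ˡ) ∷ go cs (i ∘ ∈-++⁺ʳ (els c))
  go≡ : ∀ cs (i : ∀ {x} → x ∈ concatMap els cs → x ∈ L) → concatMap els (go cs i) ≡ map g (concatMap els cs)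
  go≡ [] i = refl
  go≡ (c ∷ cs) i = trans (cong₂ _++_ (map-∘ (full (len c))) (go≡ cs (i ∘ ∈-++⁺ʳ (els c)))) (sym (map-++ g (els c) _))

dec-seg : ∀ a → SCD τ (Seg (τ a)) a (full a)
dec-seg {τ} a = dec [ c ] (↭-reflexive (trans (++-identityʳ _) (map-id _)))
  where
  c : Chn τ (Seg (τ a)) a
  c = record { len = a ; at = id ; base = 0 ; embed = mor-id ; centred = refl }

dec-N : ∀ {L} → N ≡ M → SCD τ T N L → SCD τ T M L
dec-N refl d = d

-- A chain behaves like the segment of its own length, marked according to `τ`, so it is enough to
-- decompose products with segments. The equation handed to `h` retains that `q` has the parity of
-- `N`, which later excludes `q = 1`.
bindʳ : ∀ {B L} → SCD τ T N L →
  (∀ q k → k + k + q ≡ N → SCD τ′ (S ⊗ Seg (τ q)) (M + q) (prod B (full q))) →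
  SCD τ′ (S ⊗ T) (M + N) (prod B L)
bindʳ {τ} {T} {N} {τ′} {S} {M} {B} (dec cs p) h = dec-resp (prod-↭ʳ B p) (go cs)
  where
  lem : ∀ k M q → k + k + (M + q) ≡ M + (k + k + q)
  lem = solve-∀
  one : (c : Chn τ T N) → SCD τ′ (S ⊗ T) (M + N) (prod B (els c))
  one c = dec-resp (↭-reflexive (trans (sym (prod-map id (at c) B (full (len c)))) (cong (λ z → prod z (els c)) (map-id B))))
    (dec-map (mor-⊗ {L = B} {K = full (len c)} mor-id (embed c)) (trans (lem (base c) M (len c)) (cong (M +_) (centred c))) (h (len c) (base c) (centred c)))
  go : ∀ cs → SCD τ′ (S ⊗ T) (M + N) (prod B (concatMap els cs))
  go [] = dec-resp (↭-reflexive (sym (cartesianProductWith-zeroʳ _,_ B))) dec-[]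
  go (c ∷ cs) = dec-resp (↭-sym (prod-++ʳ B (els c) _)) (dec-++ (one c) (go cs))

bindˡ : ∀ {B L} → SCD τ T N L →
  (∀ q k → k + k + q ≡ N → SCD τ′ (Seg (τ q) ⊗ S) (q + M) (prod (full q) B)) →
  SCD τ′ (T ⊗ S) (N + M) (prod L B)
bindˡ {τ} {T} {N} {τ′} {S} {M} {B} (dec cs p) h = dec-resp (prod-↭ˡ B p) (go cs)
  where
  lem : ∀ k M q → k + 0 + (k + 0) + (q + M) ≡ k + k + q + M
  lem = solve-∀
  one : (c : Chn τ T N) → SCD τ′ (T ⊗ S) (N + M) (prod (els c) B)
  one c = dec-resp (↭-reflexive (trans (sym (prod-map (at c) id (full (len c)) B)) (cong (λ z → prod (els c) z) (map-id B))))
    (dec-map (mor-⊗ {L = full (len c)} {K = B} (embed c) mor-id) (trans (lem (base c) M (len c)) (cong (_+ M) (centred c))) (h (len c) (base c) (centred c)))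
  go : ∀ cs → SCD τ′ (T ⊗ S) (N + M) (prod (concatMap els cs) B)
  go [] = dec-[]
  go (c ∷ cs) = dec-resp (↭-reflexive (sym (prod-++ˡ (els c) _))) (dec-++ (one c) (go cs))

-- Paths, hooks and rectangles

Free : (S : Space) → List (Pt S) → Set
Free S L = ∀ {x y} → x ∈ L → y ∈ L → E S x y → x ≡ y

data Path (S : Space) : Pt S → Pt S → List (Pt S) → Set where
  one  : ∀ {x} → Path S x x (x ∷ [])
  cons : ∀ {x y z L} → _⋖_ S x y → Path S y z L → Path S x z (x ∷ L)

retarget : ∀ {s t t′ L} → t ≡ t′ → Path S s t L → Path S s t′ L
retarget refl p = p

relist : ∀ {s t L K} → L ≡ K → Path S s t L → Path S s t K
relist refl p = p

path-++ : ∀ {s t u v L K} → Path S s t L → _⋖_ S t u → Path S u v K → Path S s v (L ++ K)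
path-++ one c q = cons c q
path-++ (cons d p) c q = cons d (path-++ p c q)

plen : ∀ {s t L} → Path S s t L → ℕ
plen one = 0
plen (cons _ p) = suc (plen p)

pfun : ∀ {s t L} → Path S s t L → ℕ → Pt S
pfun (one {x}) _ = x
pfun (cons {x} _ p) zero = x
pfun (cons _ p) (suc i) = pfun p i

pfun-0 : ∀ {s t L} (p : Path S s t L) → pfun p 0 ≡ s
pfun-0 one = refl
pfun-0 (cons _ p) = refl

pfun-end : ∀ {s t L} (p : Path S s t L) → pfun p (plen p) ≡ t
pfun-end one = refl
pfun-end (cons _ p) = pfun-end p

map-rng-suc : ∀ {A : Set} (f : ℕ → A) s n → map f (rng (suc s) n) ≡ map (f ∘ suc) (rng s n)
map-rng-suc f s n = trans (cong (map f) (sym (rng-suc s n))) (sym (map-∘ (rng s n)))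

pfun-els : ∀ {s t L} (p : Path S s t L) → map (pfun p) (full (plen p)) ≡ L
pfun-els one = refl
pfun-els (cons {x} _ p) = cong (x ∷_) (trans (map-rng-suc (pfun (cons _ p)) 0 (suc (plen p))) (pfun-els p))

pfun-⋖ : ∀ {s t L} (p : Path S s t L) {i} → i < plen p → _⋖_ S (pfun p i) (pfun p (suc i))
pfun-⋖ {S = S} (cons c p) {zero} _ = subst (_⋖_ S _) (sym (pfun-0 p)) c
pfun-⋖ (cons c p) {suc i} (s≤s q) = pfun-⋖ p q

pfun-rk : ∀ {s t L} (p : Path S s t L) {i} → i ≤ plen p → rk S (pfun p i) ≡ rk S s + i
pfun-rk one z≤n = sym (+-identityʳ _)
pfun-rk (cons c p) {zero} _ = sym (+-identityʳ _)
pfun-rk {S = S} (cons c p) {suc i} (s≤s q) = trans (pfun-rk p q) (trans (cong (_+ i) (⋖⇒rk S c)) (sym (+-suc _ i)))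

path-rk : ∀ {s t L} (p : Path S s t L) → rk S t ≡ rk S s + plen p
path-rk {S = S} p = trans (cong (rk S) (sym (pfun-end p))) (pfun-rk p ≤-refl)

full⇒≤ : ∀ {i a} → i ∈ full a → i ≤ a
full⇒≤ p = ≤-pred (proj₂ (∈-rng⁻ p))

Weak : (S : Space) → Pt S → Pt S → List (Pt S) → Set
Weak S s t L = ∀ {x y} → x ∈ L → y ∈ L → E S x y → x ≡ y ⊎ (x ≡ s × y ≡ t)

-- Along a path the rank determines the position, so equal points have equal indices. A bad pair
-- formed by the two ends is allowed when the segment is marked at its full length, `e ≡ n`.
pathMor : ∀ {s t L n e} (p : Path S s t L) → n ≡ plen p →
  (∀ {x y} → x ∈ L → y ∈ L → E S x y → x ≡ y ⊎ (x ≡ s × y ≡ t × e ≡ n)) →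
  Mor (Seg e) S (full n) (pfun p) (rk S s)
rk-shift (pathMor p refl h) i = pfun-rk p (full⇒≤ i)
⋖-pres (pathMor p refl h) i j refl = pfun-⋖ p (full⇒≤ j)
E-refl (pathMor {S = S} {s} p refl h) {i} {j} i∈ j∈ e = go (h (mem i∈) (mem j∈) e)
  where
  mem : ∀ {i} → i ∈ full (plen p) → pfun p i ∈ _
  mem i∈ = subst (pfun p _ ∈_) (pfun-els p) (∈-map⁺ (pfun p) i∈)
  inj : ∀ {i j} → i ≤ plen p → j ≤ plen p → pfun p i ≡ pfun p j → i ≡ j
  inj a b q = +-cancelˡ-≡ (rk S s) _ _ (trans (sym (pfun-rk p a)) (trans (cong (rk S) q) (pfun-rk p b)))
  go : _ → _
  go (inj₁ q) = inj₁ (inj (full⇒≤ i∈) (full⇒≤ j∈) q)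
  go (inj₂ (q , r , e)) = inj₂ (inj (full⇒≤ i∈) z≤n (trans q (sym (pfun-0 p))) ,
                               trans (inj (full⇒≤ j∈) ≤-refl (trans r (sym (pfun-end p)))) (sym e))

pathMor-top : ∀ {s t L} (p : Path S s t L) → Weak S s t L → 2 ≤ plen p →
  Mor (Seg (top (plen p))) S (full (plen p)) (pfun p) (rk S s)
pathMor-top p w l = pathMor p refl (λ x y e → go (w x y e))
  where
  tp : ∀ {n} → 2 ≤ n → top n ≡ n
  tp (s≤s (s≤s _)) = refl
  go : ∀ {A B C : Set} → A ⊎ (B × C) → A ⊎ (B × C × _)
  go (inj₁ a) = inj₁ a
  go (inj₂ (b , c)) = inj₂ (b , c , tp l)

module _ {s t L} (p : Path S s t L) (eq : rk S s + rk S t ≡ N) where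
  private
    arith : rk S s + rk S s + plen p ≡ N
    arith = trans (+-assoc (rk S s) _ _) (trans (cong (rk S s +_) (sym (path-rk p))) eq)

  decPath : Free S L → SCD τ S N L
  decPath f = dec [ c ] (↭-reflexive (trans (++-identityʳ _) (pfun-els p)))
    where
    c : Chn _ S N
    c = record { at = pfun p ; embed = pathMor p refl (λ x y e → inj₁ (f x y e)) ; centred = arith }

  decPath-top : Weak S s t L → rk S s + 2 ≤ rk S t → SCD top S N L
  decPath-top w l = dec [ c ] (↭-reflexive (trans (++-identityʳ _) (pfun-els p)))
    where
    c : Chn top S N
    c = record { at = pfun p ; embed = pathMor-top p w (+-cancelˡ-≤ (rk S s) _ _ (≤-trans l (≤-reflexive (path-rk p)))) ; centred = arith }

segPath : ∀ {e} s n → Path (Seg e) s (s + n) (rng s (suc n))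
segPath s zero = retarget (sym (+-identityʳ s)) one
segPath s (suc n) = cons refl (retarget (sym (+-suc s n)) (segPath (suc s) n))

rowPath : ∀ {s t L} y → Path S s t L → Path (S ⊗ T) (s , y) (t , y) (prod L [ y ])
rowPath y one = one
rowPath y (cons c p) = cons (inj₁ (c , refl)) (rowPath y p)

colPath : ∀ {s t L} x → Path T s t L → Path (S ⊗ T) (x , s) (x , t) (prod [ x ] L)
colPath x one = one
colPath x (cons c p) = cons (inj₂ (refl , c)) (colPath x p)

hook : (s n t m : ℕ) → List (ℕ × ℕ)
hook s n t m = prod (rng s (suc n)) [ t ] ++ prod [ s + n ] (rng (suc t) m)

hookPath : ∀ {e e′} s n t m → Path (Seg e ⊗ Seg e′) (s , t) (s + n , t + m) (hook s n t m)
hookPath s n t zero =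
  retarget (cong (s + n ,_) (sym (+-identityʳ t))) (relist (sym (++-identityʳ (prod (rng s (suc n)) [ t ]))) (rowPath t (segPath s n)))
hookPath s n t (suc m) =
  retarget (cong (s + n ,_) (sym (+-suc t m)))
    (path-++ (rowPath t (segPath s n)) (inj₂ (refl , refl)) (colPath (s + n) (segPath (suc t) m)))

∈-hook : ∀ {i j} s n t m → (i , j) ∈ hook s n t m →
  (s ≤ i × i ≤ s + n × j ≡ t) ⊎ (i ≡ s + n × suc t ≤ j × j ≤ t + m)
∈-hook {i} s n t m p with ∈-++⁻ (prod (rng s (suc n)) [ t ]) p
... | inj₁ q with ∈-cartesianProduct⁻ (rng s (suc n)) [ t ] q
...   | a , here b = inj₁ (proj₁ (∈-rng⁻ a) , ≤-pred (subst (i <_) (+-suc s n) (proj₂ (∈-rng⁻ a))) , b)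
∈-hook s n t m p | inj₂ q with ∈-cartesianProduct⁻ [ s + n ] (rng (suc t) m) q
...   | here a , b = inj₂ (a , proj₁ (∈-rng⁻ b) , ≤-pred (proj₂ (∈-rng⁻ b)))

peel : ∀ s n t m → prod (rng s (suc n)) (rng t (suc m)) ↭ hook s n t m ++ prod (rng s n) (rng (suc t) m)
peel s n t m =
  ↭-trans (prod-++ʳ R [ t ] K)
  (↭-trans (++⁺ˡ (prod R [ t ]) (↭-trans
      (↭-reflexive (trans (cong (λ r → prod r K) (rng-∷ʳ s n)) (prod-++ˡ (rng s n) [ s + n ])))
      (++-comm (prod (rng s n) K) _)))
    (↭-reflexive (sym (++-assoc (prod R [ t ]) (prod [ s + n ] K) _))))
  where
  R = rng s (suc n)
  K = rng (suc t) m

E-flat : ∀ {i j} → E (Seg 0) i j → i ≡ j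
E-flat (inj₁ p) = p
E-flat (inj₂ (refl , refl)) = refl

-- The classical nested hooks, each consisting of the bottom row and the last column. Removing one
-- raises `t` by one and lowers both counts by one, so the sum in the hypothesis is constant; it
-- makes the end ranks of every hook add up to `N`. The 2 arises because `n` and `m` count elements,
-- not steps.
dec-hooks : ∀ s n t m → s + s + (t + t) + (n + m) ≡ 2 + N →
  SCD τ (Seg 0 ⊗ Seg 0) N (prod (rng s n) (rng t m))
dec-hooks s zero t m e = dec-[]
dec-hooks s (suc n) t zero e = dec-resp (↭-reflexive (sym (cartesianProductWith-zeroʳ _,_ (rng s (suc n))))) dec-[]
dec-hooks {N} s (suc n) t (suc m) e = dec-resp (↭-sym (peel s n t m))
  (dec-++ (decPath (hookPath s n t m) (+-cancelˡ-≡ 2 _ _ (trans (l1 s n t m) e))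
            (λ _ _ (p , q) → cong₂ _,_ (E-flat p) (E-flat q)))
          (dec-hooks s n (suc t) m (trans (l2 s n t m) e)))
  where
  l1 : ∀ s n t m → 2 + (s + t + (s + n + (t + m))) ≡ s + s + (t + t) + (suc n + suc m)
  l1 = solve-∀
  l2 : ∀ s n t m → s + s + (suc t + suc t) + (n + m) ≡ s + s + (t + t) + (suc n + suc m)
  l2 = solve-∀

dec-grid : ∀ a b → SCD τ (Seg 0 ⊗ Seg 0) (a + b) (prod (full a) (full b))
dec-grid a b = dec-hooks 0 (suc a) 0 (suc b) (cong suc (+-suc a b))

dec-× : ∀ {L K} → SCD free S N L → SCD free T M K → SCD τ (S ⊗ T) (N + M) (prod L K)
dec-× d d′ = bindˡ d (λ q _ _ → bindʳ {B = full q} d′ (λ q′ _ _ → dec-grid q q′))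

chn-weaken : Chn free S N → Chn τ S N
chn-weaken c = record { len = Chn.len c ; at = Chn.at c ; base = Chn.base c ; centred = Chn.centred c ; embed = record
  { rk-shift = rk-shift (Chn.embed c) ; ⋖-pres = ⋖-pres (Chn.embed c)
  ; E-refl = λ x y e → inj₁ (E-flat (E-refl (Chn.embed c) x y e)) } }

dec-weaken : ∀ {L} → SCD free S N L → SCD τ S N L
dec-weaken (dec cs p) = dec (map chn-weaken cs) (↭-trans (↭-reflexive (go cs)) p)
  where
  go : ∀ cs → concatMap els (map chn-weaken cs) ≡ concatMap els cs
  go [] = refl
  go (c ∷ cs) = cong (els c ++_) (go cs)

-- Two nested hooks with their endpoints exchanged.
module Swap (a b : ℕ) where
  inner : List (ℕ × ℕ)
  inner = hook 0 (suc a) 1 (suc b)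

  D₀ D₁ R : List (ℕ × ℕ)
  D₀ = [ 0 , 0 ] ++ inner ++ [ 2 + a , 2 + b ]
  D₁ = hook 1 (suc a) 0 (suc b)
  R  = prod (rng 0 (suc a)) (rng 2 (suc b))

  path₀ : ∀ {e e′} → Path (Seg e ⊗ Seg e′) (0 , 0) (2 + a , 2 + b) D₀
  path₀ = cons (inj₂ (refl , refl)) (path-++ (hookPath 0 (suc a) 1 (suc b)) (inj₁ (refl , refl)) one)

  path₁ : ∀ {e e′} → Path (Seg e ⊗ Seg e′) (1 , 0) (2 + a , 1 + b) D₁
  path₁ = hookPath 1 (suc a) 0 (suc b)

  swap↭ : prod (full (2 + a)) (full (2 + b)) ↭ D₀ ++ D₁ ++ R
  swap↭ = ↭-trans (peel 0 (2 + a) 0 (2 + b))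
    (↭-trans (++⁺ (↭-reflexive outer) (peel 0 (suc a) 1 (suc b)))
    (prep (0 , 0) (↭-trans (↭-reflexive (++-assoc D₁ [ 2 + a , 2 + b ] (inner ++ R)))
      (↭-trans (shuffle D₁ [ 2 + a , 2 + b ] inner R) (↭-reflexive (sym (++-assoc inner [ 2 + a , 2 + b ] (D₁ ++ R))))))))
    where
    outer : hook 0 (2 + a) 0 (2 + b) ≡ (0 , 0) ∷ D₁ ++ [ 2 + a , 2 + b ]
    outer = cong ((0 , 0) ∷_) (trans
      (cong (prod (rng 1 (2 + a)) [ 0 ] ++_) (trans (cong (prod [ 2 + a ]) (rng-∷ʳ 1 (suc b)))
        (trans (++-identityʳ _) (trans (map-++ (2 + a ,_) (rng 1 (suc b)) [ 2 + b ])
          (cong (_++ [ 2 + a , 2 + b ]) (sym (++-identityʳ (map (2 + a ,_) (rng 1 (suc b))))))))))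
      (sym (++-assoc (prod (rng 1 (2 + a)) [ 0 ]) (prod [ 2 + a ] (rng 1 (suc b))) [ 2 + a , 2 + b ])))
    shuffle : ∀ {A : Set} (x y z w : List A) → x ++ y ++ z ++ w ↭ z ++ y ++ x ++ w
    shuffle x y z w = ↭-trans (++⁺ˡ x (shifts y z)) (↭-trans (shifts x z) (++⁺ˡ z (shifts x y)))

  -- `D₀` meets row 0 only in its first point and column `2 + a` only in its last. A bad pair within
  -- one column would start at (0 , 0), but `D₀` leaves column 0 at height 1; a bad pair within one
  -- row would end at the top, but `D₀` has no point of column 0 in that row.
  weak₀ : Weak (Seg (2 + a) ⊗ Seg (2 + b)) (0 , 0) (2 + a , 2 + b) D₀
  weak₀ {i , j} {i′ , j′} x∈ y∈ (p , q) = go p q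
    where
    bounds : ∀ {i j} → (i , j) ∈ D₀ → (j ≡ 0 → i ≡ 0) × (i ≡ 2 + a → j ≡ 2 + b) × (i ≡ 0 → j ≤ 1) × (j ≡ 2 + b → 1 ≤ i)
    bounds (here refl) = (λ _ → refl) , (λ ()) , (λ _ → z≤n) , (λ ())
    bounds (there p) with ∈-++⁻ inner p
    ... | inj₂ (here refl) = (λ ()) , (λ _ → refl) , (λ ()) , (λ _ → s≤s z≤n)
    ... | inj₁ p with ∈-hook 0 (suc a) 1 (suc b) p
    ...   | inj₁ (_ , u , refl) = (λ ()) , (λ { refl → ⊥-elim (1+n≰n u) }) , (λ _ → ≤-refl) , (λ ())
    ...   | inj₂ (refl , s≤s _ , _) = (λ ()) , (λ ()) , (λ ()) , (λ _ → s≤s z≤n)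
    go : _ → _ → _
    go (inj₁ refl) (inj₁ refl) = inj₁ refl
    go (inj₁ refl) (inj₂ (refl , refl)) with proj₁ (bounds x∈) refl
    ... | refl = ⊥-elim (1+n≰n (proj₂ (proj₂ (proj₂ (bounds y∈))) refl))
    go (inj₂ (refl , refl)) (inj₁ refl) with proj₁ (proj₂ (bounds y∈)) refl | proj₁ (proj₂ (proj₂ (bounds x∈))) refl
    ... | refl | s≤s ()
    go (inj₂ (refl , refl)) (inj₂ (refl , refl)) = inj₂ (refl , refl)

  -- `D₁` avoids column 0 and row `2 + b`, so the first coordinate cannot start at its bottom and
  -- the second cannot end at its top.
  free₁ : Free (Seg (2 + a) ⊗ Seg (2 + b)) D₁
  free₁ {i , j} {i′ , j′} x∈ y∈ (p , q) = go p q
    where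
    bounds : ∀ {i j} → (i , j) ∈ D₁ → i ≢ 0 × j ≢ 2 + b
    bounds p with ∈-hook 1 (suc a) 0 (suc b) p
    ... | inj₁ (s≤s _ , _ , refl) = (λ ()) , (λ ())
    ... | inj₂ (refl , _ , u) = (λ ()) , (λ { refl → 1+n≰n u })
    go : _ → _ → _
    go (inj₂ (refl , _)) _ = ⊥-elim (proj₁ (bounds x∈) refl)
    go _ (inj₂ (_ , refl)) = ⊥-elim (proj₂ (bounds y∈) refl)
    go (inj₁ refl) (inj₁ refl) = refl

  -- The remaining rectangle avoids column `2 + a` and row 0, so it contains no bad pair and both
  -- sides may be taken unmarked.
  rest : Mor (Seg 0 ⊗ Seg 0) (Seg (2 + a) ⊗ Seg (2 + b)) (prod (full a) (full b)) (map× id (2 +_)) 2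
  rk-shift rest {i , j} _ = lem i j
    where lem : ∀ i j → i + (2 + j) ≡ 2 + (i + j)
          lem = solve-∀
  ⋖-pres rest _ _ (inj₁ (p , refl)) = inj₁ (p , refl)
  ⋖-pres rest _ _ (inj₂ (p , refl)) = inj₂ (p , cong suc refl)
  E-refl rest {i , j} {i′ , j′} _ y∈ (p , q) = go₁ p , go₂ q
    where
    i′≤a : i′ ≤ a
    i′≤a = full⇒≤ (proj₁ (∈-cartesianProduct⁻ (full a) (full b) y∈))
    go₁ : _ → _
    go₁ (inj₁ e) = inj₁ e
    go₁ (inj₂ (_ , refl)) = ⊥-elim (1+n≰n (≤-trans (n≤1+n _) i′≤a))
    go₂ : _ → _
    go₂ (inj₁ refl) = inj₁ refl

-- Blocks and ladders

-- Blocks can be multiplied by any segment whose ends form a bad pair.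
record Block (S : Space) (N : ℕ) (L : List (Pt S)) : Set where
  constructor mkBlock
  field
    with-seg : ∀ q → SCD free (S ⊗ Seg (top q)) (N + q) (prod L (full q))

open Block

block-resp : ∀ {L K} → L ↭ K → Block S N L → Block S N K
block-resp p (mkBlock b) = mkBlock λ q → dec-resp (prod-↭ˡ (full q) p) (b q)

block-++ : ∀ {L K} → Block S N L → Block S N K → Block S N (L ++ K)
block-++ {L = L} {K} (mkBlock b) (mkBlock c) = mkBlock λ q → dec-resp (↭-reflexive (sym (prod-++ˡ L K))) (dec-++ (b q) (c q))

block-[] : Block S N []
block-[] = mkBlock λ q → dec-[]

block-map : ∀ {L g k N′} → Mor S T L g k → k + k + N ≡ N′ → Block S N L → Block T N′ (map g L)
block-map {S} {T} {N} {L} {g} {k} G e (mkBlock b) = mkBlock λ q →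
  dec-resp (↭-reflexive (trans (sym (prod-map g id L (full q))) (cong (prod (map g L)) (map-id (full q)))))
    (dec-map (mor-⊗ {L = L} {K = full q} G mor-id) (trans (lem k N q) (cong (_+ q) e)) (b q))
  where
  lem : ∀ k N q → k + 0 + (k + 0) + (N + q) ≡ k + k + N + q
  lem = solve-∀

-- `top` marks no segment of length 0 or 1, so there the plain product works.
block-from : ∀ {L} → SCD free S N L →
  (∀ b → SCD free (S ⊗ Seg (2 + b)) (N + (2 + b)) (prod L (full (2 + b)))) → Block S N L
block-from d h = mkBlock λ
  { 0 → dec-× d (dec-seg 0)
  ; 1 → dec-× d (dec-seg 1)
  ; (suc (suc b)) → h b }

-- With an unmarked first coordinate the exception for the outer chain disappears.
module SwapFree (a b : ℕ) where
  open Swap a b using (D₀; D₁; weak₀; free₁; rest)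

  private
    weaken : ∀ {x y} → E (Seg 0 ⊗ Seg (2 + b)) x y → E (Seg (2 + a) ⊗ Seg (2 + b)) x y
    weaken (e , f) = inj₁ (E-flat e) , f

    0≢a : E (Seg 0) 0 (2 + a) → ⊥
    0≢a (inj₁ ())
    0≢a (inj₂ (_ , ()))

  unmarked₀ : Free (Seg 0 ⊗ Seg (2 + b)) D₀
  unmarked₀ x y e = [ id , (λ { (refl , refl) → ⊥-elim (0≢a (proj₁ e)) }) ]′ (weak₀ x y (weaken e))

  unmarked₁ : Free (Seg 0 ⊗ Seg (2 + b)) D₁
  unmarked₁ x y e = free₁ x y (weaken e)

  unmarked : Mor (Seg 0 ⊗ Seg 0) (Seg 0 ⊗ Seg (2 + b)) (prod (full a) (full b)) (map× id (2 +_)) 2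
  rk-shift unmarked p = rk-shift rest p
  ⋖-pres unmarked p q c = ⋖-pres rest p q c
  E-refl unmarked p q (e , f) = e , proj₂ (E-refl rest p q (inj₁ (E-flat e) , f))

  rk₁ : 1 + 0 + (2 + a + (1 + b)) ≡ 2 + a + (2 + b)
  rk₁ = lem a b
    where lem : ∀ a b → 1 + 0 + (2 + a + (1 + b)) ≡ 2 + a + (2 + b)
          lem = solve-∀

  rkᵣ : 2 + 2 + (a + b) ≡ 2 + a + (2 + b)
  rkᵣ = lem a b
    where lem : ∀ a b → 2 + 2 + (a + b) ≡ 2 + a + (2 + b)
          lem = solve-∀

  rest≡ : map (map× id (2 +_)) (prod (full a) (full b)) ≡ Swap.R a b
  rest≡ = trans (sym (prod-map id (2 +_) (full a) (full b))) (cong₂ prod (map-id (full a)) (rng-shift 2 0 (suc b)))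

block-seg : ∀ a → Block (Seg 0) (2 + a) (full (2 + a))
block-seg a = block-from (dec-seg (2 + a)) λ b → let open Swap a b; open SwapFree a b in
  dec-resp (↭-sym swap↭)
    (dec-++ (decPath path₀ refl unmarked₀)
    (dec-++ (decPath path₁ rk₁ unmarked₁)
            (dec-resp (↭-reflexive rest≡) (dec-map unmarked rkᵣ (dec-grid a b)))))

-- A path without bad pairs is the image of an unmarked segment; two steps are what the exchange of
-- hooks requires.
block-path : ∀ {s t L} → Path S s t L → Free S L → rk S s + 2 ≤ rk S t → rk S s + rk S t ≡ N → Block S N L
block-path {S} {s = s} {t} {L} p f l e = go (plen p) refl (+-cancelˡ-≤ (rk S s) _ _ (≤-trans l (≤-reflexive (path-rk p))))
  where
  go : ∀ n → n ≡ plen p → 2 ≤ n → Block S _ L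
  go (suc (suc n)) eq (s≤s (s≤s _)) = block-resp (↭-reflexive (trans (cong (λ m → map (pfun p) (full m)) eq) (pfun-els p)))
    (block-map (pathMor {e = 0} p eq (λ x y e → inj₁ (f x y e)))
      (trans (trans (cong (rk S s + rk S s +_) eq) (trans (+-assoc (rk S s) _ _) (cong (rk S s +_) (sym (path-rk p))))) e)
      (block-seg n))

-- The purpose of blocks: a chain whose only bad pair is formed by its ends is a marked segment, so
-- a block absorbs any decomposition into such chains.
block-weak : ∀ {L K} → Block S N L → SCD top T M K → SCD free (S ⊗ T) (N + M) (prod L K)
block-weak {L = L} b d = bindʳ {B = L} d (λ q _ _ → with-seg b q)

-- Legs (x , t .. t + n) at a point x, joined by covers between consecutive points at constant height.
-- No leg spans the whole segment 0 .. q.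
data Stair (S : Space) (q : ℕ) : Pt S → ℕ → Pt S → ℕ → List (Pt S) → List (Pt S × ℕ) → Set where
  leg  : ∀ {x t} n → n < q → Stair S q x t x (t + n) [ x ] (prod [ x ] (rng t (suc n)))
  step : ∀ {x t y z u ps L} n → n < q → _⋖_ S x y → Stair S q y (t + n) z u ps L →
         Stair S q x t z u (x ∷ ps) (prod [ x ] (rng t (suc n)) ++ L)

leg-∈ : ∀ {A : Set} {x y : A} {i t} n → (y , i) ∈ prod [ x ] (rng t (suc n)) → y ≡ x × t ≤ i × i ≤ t + n
leg-∈ {A} {x} {y} {i} {t} n p with ∈-cartesianProduct⁻ [ x ] (rng t (suc n)) p
... | here a , b = a , proj₁ (∈-rng⁻ b) , ≤-pred (subst (i <_) (+-suc t n) (proj₂ (∈-rng⁻ b)))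

module _ {S : Space} {q : ℕ} where

  stair-path : ∀ {x t y u ps L} → Stair S q x t y u ps L → Path (S ⊗ Seg q) (x , t) (y , u) L
  stair-path (leg {x} {t} n _) = colPath x (segPath t n)
  stair-path (step {x} {t} n _ c s) = path-++ (colPath x (segPath t n)) (inj₁ (c , refl)) (stair-path s)

  stair-∈ : ∀ {x t y u ps L z i} → Stair S q x t y u ps L → (z , i) ∈ L → z ∈ ps × rk S x ≤ rk S z
  stair-∈ (leg n _) p with leg-∈ n p
  ... | refl , _ = here refl , ≤-refl
  stair-∈ (step {x} {t} n _ c s) p with ∈-++⁻ (prod [ x ] (rng t (suc n))) p
  ... | inj₁ p′ with leg-∈ n p′
  ...   | refl , _ = here refl , ≤-refl
  stair-∈ (step {x} {t} n _ c s) p | inj₂ p′ with stair-∈ s p′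
  ... | a , b = there a , ≤-trans (n≤1+n _) (≤-trans (≤-reflexive (sym (⋖⇒rk S c))) b)

  leg-free : ∀ {x t n} → n < q → Free (S ⊗ Seg q) (prod [ x ] (rng t (suc n)))
  leg-free {n = n} l {_ , i} {_ , j} p r (_ , e) with leg-∈ n p | leg-∈ n r
  ... | refl , a , b | refl , c , d with e
  ...   | inj₁ refl = refl
  leg-free {n = n} l p r _ | refl , z≤n , b | refl , c , d | inj₂ (refl , refl) = ⊥-elim (<⇒≱ l d)

  -- The projection of a bad pair to `S` lies in the free list `ps` and is therefore a single point.
  -- Ranks increase from leg to leg, so the pair lies in one leg, and no leg spans the segment.
  stair-free : ∀ {x t y u ps L} → Free S ps → Stair S q x t y u ps L → Free (S ⊗ Seg q) L
  stair-free f (leg n l) = leg-free l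
  stair-free f (step {x} {t} n l c s) {p} {r} p∈ r∈ e with ∈-++⁻ (prod [ x ] (rng t (suc n))) p∈ | ∈-++⁻ (prod [ x ] (rng t (suc n))) r∈
  ... | inj₁ a | inj₁ b = leg-free l a b e
  ... | inj₂ a | inj₂ b = stair-free (λ u v → f (there u) (there v)) s a b e
  ... | inj₁ a | inj₂ b with leg-∈ n a | stair-∈ s b
  ...   | refl , _ | m , k with f (here refl) (there m) (proj₁ e)
  ...     | refl = ⊥-elim (1+n≰n (≤-trans (≤-reflexive (sym (⋖⇒rk S c))) k))
  stair-free f (step {x} {t} n l c s) p∈ r∈ e | inj₂ a | inj₁ b with leg-∈ n b | stair-∈ s a
  ...   | refl , _ | m , k with f (there m) (here refl) (proj₁ e)
  ...     | refl = ⊥-elim (1+n≰n (≤-trans (≤-reflexive (sym (⋖⇒rk S c))) k))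

  dec-stair : ∀ {x t y u ps L} → Free S ps → Stair S q x t y u ps L → rk S x + t + (rk S y + u) ≡ N →
    SCD free (S ⊗ Seg q) N L
  dec-stair f s e = decPath (stair-path s) e (stair-free f s)

  dec-leg : ∀ x t n → n ≤ q → rk S x + rk S x + (t + t) + n ≡ suc N → SCD free (S ⊗ Seg q) N (prod [ x ] (rng t n))
  dec-leg x t zero _ _ = dec-[]
  dec-leg {N} x t (suc n) l e = decPath (colPath x (segPath t n))
    (suc-injective (trans (lem (rk S x) t n) e)) (leg-free l)
    where
    lem : ∀ r t n → suc (r + t + (r + (t + n))) ≡ r + r + (t + t) + suc n
    lem = solve-∀

-- Concatenation is commutative up to permutation. A grid is cut into pieces that are grouped by
-- chains on one side and by columns on the other, and the solver matches the groupings. `CM.id`,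
-- where it occurs, is the empty tail of `concatMap`.
module CM {A : Set} = CMSolver (++-commutativeMonoid {A = A})

open CM using (_⊕_; prove)

v : ∀ {A : Set} {n} m {m<n : True (suc m ≤? n)} → CM.Expr {A} n
v m {m<n} = CM.var (Fin.#_ m {m<n = m<n})

cols : ∀ {A : Set} → List A → List ℕ → List (A × ℕ)
cols ps K = concatMap (λ x → prod [ x ] K) ps

cols≡prod : ∀ {A : Set} (ps : List A) K → cols ps K ≡ prod ps K
cols≡prod [] K = refl
cols≡prod (x ∷ ps) K = trans (cong (prod [ x ] K ++_) (cols≡prod ps K)) (sym (prod-++ˡ [ x ] ps))

same : ∀ {A : Set} (x : A) → x ≡ x
same x = refl

infixr 5 _⧺_
_⧺_ : ∀ {A : Set} {xs xs′ ys ys′ : List A} → xs ≡ xs′ → ys ≡ ys′ → xs ++ ys ≡ xs′ ++ ys′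
_⧺_ = cong₂ _++_

cut : ∀ {A : Set} (x : A) s m n {k} → k ≡ m + n → prod [ x ] (rng s k) ≡ prod [ x ] (rng s m) ++ prod [ x ] (rng (s + m) n)
cut x s m n refl = trans (++-identityʳ _) (trans (cong (map (x ,_)) (rng-++ s m n))
  (trans (map-++ (x ,_) (rng s m) _) (sym (++-identityʳ (map (x ,_) (rng s m))) ⧺ sym (++-identityʳ (map (x ,_) (rng (s + m) n))))))

cut₃ : ∀ {A : Set} (x : A) s l m n {k} → k ≡ l + (m + n) →
  prod [ x ] (rng s k) ≡ prod [ x ] (rng s l) ++ prod [ x ] (rng (s + l) m) ++ prod [ x ] (rng (s + l + m) n)
cut₃ x s l m n e = trans (cut x s l (m + n) e) (same (prod [ x ] (rng s l)) ⧺ cut x (s + l) m n refl)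

module _ (S : Space) {N : ℕ} (n r : ℕ) (centre : r + (n + r) ≡ N) where
  -- Reduces the centring of a chain to numerals: `i` and `j` are heights above the bottom of the
  -- ladder, whose end ranks are `r` and `n + r`.
  ranks : ∀ {x y t u q} i j → rk S x ≡ i + r → rk S y ≡ j + r → i + t + (j + u) ≡ n + q →
    rk S x + t + (rk S y + u) ≡ N + q
  ranks {t = t} {u} {q} i j e f h rewrite e | f | sym centre = trans (l₁ i t j u r) (trans (cong (_+ (r + r)) h) (l₂ n q r))
    where
    l₁ : ∀ i t j u r → i + r + t + (j + r + u) ≡ i + t + (j + u) + (r + r)
    l₁ = solve-∀
    l₂ : ∀ n q r → n + q + (r + r) ≡ r + (n + r) + q
    l₂ = solve-∀

hop : ∀ {q x t y z u ps L} → 0 < q → _⋖_ S x y → Stair S q y t z u ps L → Stair S q x t z u (x ∷ ps) (prod [ x ] (rng t 1) ++ L)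
hop {S = S} {q = q} {t = t} {y} {z} {u} {ps} {L} l c s = step 0 l c (subst (λ t′ → Stair S q y t′ z u ps L) (sym (+-identityʳ t)) s)

stop : ∀ {q x t} → 0 < q → Stair S q x t x t [ x ] (prod [ x ] (rng t 1))
stop {S = S} {q = q} {x} {t} l = subst (λ u → Stair S q x t x u [ x ] (prod [ x ] (rng t 1))) (+-identityʳ t) (leg 0 l)

-- The product of a two-element chain with a marked segment has no free decomposition, so two-element chains
-- have to be treated together with a longer chain to which they are attached.
record Ladder₃ (S : Space) (N : ℕ) (a b c d b′ c′ : Pt S) : Set where
  field
    a⋖b : _⋖_ S a b
    b⋖c : _⋖_ S b c
    c⋖d : _⋖_ S c d
    a⋖b′ : _⋖_ S a b′
    b′⋖c′ : _⋖_ S b′ c′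
    c′⋖d : _⋖_ S c′ d
    long : Free S (a ∷ b ∷ c ∷ d ∷ [])
    low  : Free S (a ∷ b′ ∷ [])
    mid  : Free S (b′ ∷ c′ ∷ [])
    high : Free S (c′ ∷ d ∷ [])
    centre  : rk S a + (3 + rk S a) ≡ N

module _ {S N a b c d b′ c′} (l : Ladder₃ S N a b c d b′ c′) where
  open Ladder₃ l

  private
    ra : rk S a ≡ 0 + rk S a
    ra = refl
    rb : rk S b ≡ 1 + rk S a
    rb = ⋖⇒rk S a⋖b
    rc : rk S c ≡ 2 + rk S a
    rc = trans (⋖⇒rk S b⋖c) (cong suc rb)
    rd : rk S d ≡ 3 + rk S a
    rd = trans (⋖⇒rk S c⋖d) (cong suc rc)
    rb′ : rk S b′ ≡ 1 + rk S a
    rb′ = ⋖⇒rk S a⋖b′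
    rc′ : rk S c′ ≡ 2 + rk S a
    rc′ = trans (⋖⇒rk S b′⋖c′) (cong suc rb′)

    pts : List (Pt S)
    pts = a ∷ b ∷ c ∷ d ∷ b′ ∷ c′ ∷ []

    module _ (p : ℕ) where
      q = 2 + p
      -- One line per chain. The attaching covers make the difference: the top of the column of `b′`
      -- ends a chain that rises in `a`, and the bottom of the column of `c′` starts one that rises
      -- in `d`, so neither column has to be spanned. The last line is what is left over `b′`.
      columns :
        (prod [ a ] (rng 0 1) ++ prod [ b ] (rng 0 1) ++ prod [ c ] (rng 0 (2 + p)) ++ prod [ d ] (rng (1 + p) 2)) ++
        (prod [ a ] (rng 1 1) ++ prod [ b ] (rng 1 (2 + p)) ++ prod [ c ] (rng (2 + p) 1)) ++
        (prod [ a ] (rng 2 (1 + p)) ++ prod [ b′ ] (rng (2 + p) 1)) ++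
        (prod [ b′ ] (rng 0 2) ++ prod [ c′ ] (rng 1 (2 + p))) ++
        (prod [ c′ ] (rng 0 1) ++ prod [ d ] (rng 0 (1 + p))) ++
        prod [ b′ ] (rng 2 p)
        ↭ cols pts (full q)
      columns = ↭-trans
        (prove 14
          ((v 0 ⊕ v 3 ⊕ v 5 ⊕ v 8) ⊕ (v 1 ⊕ v 4 ⊕ v 6) ⊕ (v 2 ⊕ v 11) ⊕ (v 9 ⊕ v 13) ⊕ (v 12 ⊕ v 7) ⊕ v 10)
          ((v 0 ⊕ v 1 ⊕ v 2) ⊕ (v 3 ⊕ v 4) ⊕ (v 5 ⊕ v 6) ⊕ (v 7 ⊕ v 8) ⊕ (v 9 ⊕ v 10 ⊕ v 11) ⊕ (v 12 ⊕ v 13) ⊕ CM.id)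
          (prod [ a ] (rng 0 1) ∷ prod [ a ] (rng 1 1) ∷ prod [ a ] (rng 2 (1 + p)) ∷
           prod [ b ] (rng 0 1) ∷ prod [ b ] (rng 1 (2 + p)) ∷
           prod [ c ] (rng 0 (2 + p)) ∷ prod [ c ] (rng (2 + p) 1) ∷
           prod [ d ] (rng 0 (1 + p)) ∷ prod [ d ] (rng (1 + p) 2) ∷
           prod [ b′ ] (rng 0 2) ∷ prod [ b′ ] (rng 2 p) ∷ prod [ b′ ] (rng (2 + p) 1) ∷
           prod [ c′ ] (rng 0 1) ∷ prod [ c′ ] (rng 1 (2 + p)) ∷ []))
        (↭-reflexive (sym (same (prod [ a ] (full q)) ⧺ same (prod [ b ] (full q)) ⧺ cut c 0 (2 + p) 1 (+-comm 1 (2 + p))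
          ⧺ cut d 0 (1 + p) 2 (cong suc (+-comm 2 p)) ⧺ cut₃ b′ 0 2 p 1 (cong (2 +_) (+-comm 1 p)) ⧺ same (prod [ c′ ] (full q) ++ []))))

  block-ladder₃ : Block S N pts
  block-ladder₃ = block-from
    (dec-++ (decPath (cons a⋖b (cons b⋖c (cons c⋖d one))) (trans (cong (rk S a +_) rd) centre) long)
            (decPath (cons b′⋖c′ one) (trans (cong₂ _+_ rb′ rc′) (trans (lem (rk S a)) centre)) mid))
    λ p → dec-resp (↭-trans (columns p) (↭-reflexive (cols≡prod pts (full (2 + p)))))
      (dec-++ (dec-stair long (hop z<s a⋖b (hop z<s b⋖c (step (1 + p) ≤-refl c⋖d (leg 1 (s≤s (s≤s z≤n))))))
                (ranks S 3 (rk S a) centre 0 3 ra rd (cong (4 +_) (+-comm p 1))))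
      (dec-++ (dec-stair (λ x y → long (init x) (init y)) (hop z<s a⋖b (step (1 + p) ≤-refl b⋖c (stop z<s)))
                (ranks S 3 (rk S a) centre 0 2 ra rc refl))
      (dec-++ (dec-stair low (step p (s≤s (n≤1+n p)) a⋖b′ (stop z<s)) (ranks S 3 (rk S a) centre 0 1 ra rb′ refl))
      (dec-++ (dec-stair mid (step 1 (s≤s (s≤s z≤n)) b′⋖c′ (leg (1 + p) ≤-refl)) (ranks S 3 (rk S a) centre 1 2 rb′ rc′ refl))
      (dec-++ (dec-stair high (hop z<s c′⋖d (leg p (s≤s (n≤1+n p)))) (ranks S 3 (rk S a) centre 2 3 rc′ rd refl))
              (dec-leg b′ 2 p (≤-trans (n≤1+n p) (n≤1+n (suc p))) (left p)))))))
    where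
    lem : ∀ r → 1 + r + (2 + r) ≡ r + (3 + r)
    lem = solve-∀
    init : ∀ {x} → x ∈ a ∷ b ∷ c ∷ [] → x ∈ a ∷ b ∷ c ∷ d ∷ []
    init = ∈-++⁺ˡ
    left : ∀ p → rk S b′ + rk S b′ + 4 + p ≡ suc (N + (2 + p))
    left p rewrite rb′ | sym centre = lem′ (rk S a) p
      where
      lem′ : ∀ r p → 1 + r + (1 + r) + 4 + p ≡ suc (r + (3 + r) + (2 + p))
      lem′ = solve-∀

-- `b ⋖ c` is a two-element chain at the heights of `a₂ ⋖ a₃`. It is tied to the long chain below by
-- `a₁ ⋖ b` and above in two ways: `c ⋖ a₄` serves segments of length at least 3, `b ⋖ a₃` the
-- segment of length 2.
record Ladder₅ (S : Space) (N : ℕ) (a₀ a₁ a₂ a₃ a₄ a₅ b c : Pt S) : Set where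
  field
    a₀⋖a₁ : _⋖_ S a₀ a₁
    a₁⋖a₂ : _⋖_ S a₁ a₂
    a₂⋖a₃ : _⋖_ S a₂ a₃
    a₃⋖a₄ : _⋖_ S a₃ a₄
    a₄⋖a₅ : _⋖_ S a₄ a₅
    a₁⋖b  : _⋖_ S a₁ b
    b⋖c   : _⋖_ S b c
    c⋖a₄  : _⋖_ S c a₄
    b⋖a₃  : _⋖_ S b a₃
    long  : Free S (a₀ ∷ a₁ ∷ a₂ ∷ a₃ ∷ a₄ ∷ a₅ ∷ [])
    low   : Free S (a₁ ∷ b ∷ c ∷ [])
    high  : Free S (b ∷ c ∷ a₄ ∷ [])
    side  : Free S (b ∷ a₃ ∷ a₄ ∷ a₅ ∷ [])
    centre   : rk S a₀ + (5 + rk S a₀) ≡ N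

module _ {S N a₀ a₁ a₂ a₃ a₄ a₅ b c} (l : Ladder₅ S N a₀ a₁ a₂ a₃ a₄ a₅ b c) where
  open Ladder₅ l

  private
    R : ℕ
    R = rk S a₀
    r₁ : rk S a₁ ≡ 1 + R
    r₁ = ⋖⇒rk S a₀⋖a₁
    r₂ : rk S a₂ ≡ 2 + R
    r₂ = trans (⋖⇒rk S a₁⋖a₂) (cong suc r₁)
    r₃ : rk S a₃ ≡ 3 + R
    r₃ = trans (⋖⇒rk S a₂⋖a₃) (cong suc r₂)
    r₄ : rk S a₄ ≡ 4 + R
    r₄ = trans (⋖⇒rk S a₃⋖a₄) (cong suc r₃)
    r₅ : rk S a₅ ≡ 5 + R
    r₅ = trans (⋖⇒rk S a₄⋖a₅) (cong suc r₄)
    rb : rk S b ≡ 2 + R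
    rb = trans (⋖⇒rk S a₁⋖b) (cong suc r₁)
    rc : rk S c ≡ 3 + R
    rc = trans (⋖⇒rk S b⋖c) (cong suc rb)

    pts : List (Pt S)
    pts = a₀ ∷ a₁ ∷ a₂ ∷ a₃ ∷ a₄ ∷ a₅ ∷ b ∷ c ∷ []

    -- The general pattern has pieces of `q - 3` elements, so `q = 2` gets a pattern of its own.
    columns₂ :
      (prod [ a₀ ] (rng 1 2) ++ prod [ a₁ ] (rng 2 1) ++ prod [ a₂ ] (rng 2 1) ++ prod [ a₃ ] (rng 2 1) ++ prod [ a₄ ] (rng 2 1)) ++
      (prod [ a₁ ] (rng 1 1) ++ prod [ b ] (rng 1 2) ++ prod [ c ] (rng 2 1)) ++
      prod [ c ] (rng 0 2) ++
      (prod [ a₀ ] (rng 0 1) ++ prod [ a₁ ] (rng 0 1) ++ prod [ a₂ ] (rng 0 2) ++ prod [ a₃ ] (rng 1 1) ++ prod [ a₄ ] (rng 1 1) ++ prod [ a₅ ] (rng 1 2)) ++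
      (prod [ b ] (rng 0 1) ++ prod [ a₃ ] (rng 0 1) ++ prod [ a₄ ] (rng 0 1) ++ prod [ a₅ ] (rng 0 1))
      ↭ cols pts (full 2)
    columns₂ = prove 19
      ((v 1 ⊕ v 4 ⊕ v 6 ⊕ v 9 ⊕ v 12) ⊕ (v 3 ⊕ v 16 ⊕ v 18) ⊕ v 17 ⊕ (v 0 ⊕ v 2 ⊕ v 5 ⊕ v 8 ⊕ v 11 ⊕ v 14) ⊕ (v 15 ⊕ v 7 ⊕ v 10 ⊕ v 13))
      ((v 0 ⊕ v 1) ⊕ (v 2 ⊕ v 3 ⊕ v 4) ⊕ (v 5 ⊕ v 6) ⊕ (v 7 ⊕ v 8 ⊕ v 9) ⊕ (v 10 ⊕ v 11 ⊕ v 12) ⊕ (v 13 ⊕ v 14) ⊕ (v 15 ⊕ v 16) ⊕ (v 17 ⊕ v 18) ⊕ CM.id)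
      (prod [ a₀ ] (rng 0 1) ∷ prod [ a₀ ] (rng 1 2) ∷
       prod [ a₁ ] (rng 0 1) ∷ prod [ a₁ ] (rng 1 1) ∷ prod [ a₁ ] (rng 2 1) ∷
       prod [ a₂ ] (rng 0 2) ∷ prod [ a₂ ] (rng 2 1) ∷
       prod [ a₃ ] (rng 0 1) ∷ prod [ a₃ ] (rng 1 1) ∷ prod [ a₃ ] (rng 2 1) ∷
       prod [ a₄ ] (rng 0 1) ∷ prod [ a₄ ] (rng 1 1) ∷ prod [ a₄ ] (rng 2 1) ∷
       prod [ a₅ ] (rng 0 1) ∷ prod [ a₅ ] (rng 1 2) ∷
       prod [ b ] (rng 0 1) ∷ prod [ b ] (rng 1 2) ∷
       prod [ c ] (rng 0 2) ∷ prod [ c ] (rng 2 1) ∷ [])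

    module _ (p : ℕ) where
      q = 3 + p

      columns :
        (prod [ a₀ ] (rng 0 1) ++ prod [ a₁ ] (rng 0 1) ++ prod [ a₂ ] (rng 0 2) ++ prod [ a₃ ] (rng 1 1) ++ prod [ a₄ ] (rng 1 (1 + p)) ++ prod [ a₅ ] (rng (1 + p) 3)) ++
        (prod [ a₀ ] (rng 1 (3 + p)) ++ prod [ a₁ ] (rng (3 + p) 1) ++ prod [ a₂ ] (rng (3 + p) 1) ++ prod [ a₃ ] (rng (3 + p) 1) ++ prod [ a₄ ] (rng (3 + p) 1)) ++
        (prod [ a₁ ] (rng 1 1) ++ prod [ b ] (rng 1 (3 + p)) ++ prod [ c ] (rng (3 + p) 1)) ++
        (prod [ b ] (rng 0 1) ++ prod [ c ] (rng 0 (3 + p)) ++ prod [ a₄ ] (rng (2 + p) 1)) ++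
        (prod [ a₁ ] (rng 2 (1 + p)) ++ prod [ a₂ ] (rng (2 + p) 1) ++ prod [ a₃ ] (rng (2 + p) 1)) ++
        (prod [ a₃ ] (rng 0 1) ++ prod [ a₄ ] (rng 0 1) ++ prod [ a₅ ] (rng 0 (1 + p))) ++
        (prod [ a₂ ] (rng 2 p) ++ prod [ a₃ ] (rng 2 p))
        ↭ cols pts (full q)
      columns = ↭-trans
        (prove 25
          ((v 0 ⊕ v 2 ⊕ v 6 ⊕ v 11 ⊕ v 16 ⊕ v 20) ⊕ (v 1 ⊕ v 5 ⊕ v 9 ⊕ v 14 ⊕ v 18) ⊕ (v 3 ⊕ v 22 ⊕ v 24) ⊕
           (v 21 ⊕ v 23 ⊕ v 17) ⊕ (v 4 ⊕ v 8 ⊕ v 13) ⊕ (v 10 ⊕ v 15 ⊕ v 19) ⊕ (v 7 ⊕ v 12))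
          ((v 0 ⊕ v 1) ⊕ ((v 2 ⊕ v 3 ⊕ v 4) ⊕ v 5) ⊕ (v 6 ⊕ v 7 ⊕ v 8 ⊕ v 9) ⊕ ((v 10 ⊕ v 11) ⊕ v 12 ⊕ v 13 ⊕ v 14) ⊕
           ((v 15 ⊕ v 16) ⊕ v 17 ⊕ v 18) ⊕ (v 19 ⊕ v 20) ⊕ (v 21 ⊕ v 22) ⊕ (v 23 ⊕ v 24) ⊕ CM.id)
          (prod [ a₀ ] (rng 0 1) ∷ prod [ a₀ ] (rng 1 (3 + p)) ∷
           prod [ a₁ ] (rng 0 1) ∷ prod [ a₁ ] (rng 1 1) ∷ prod [ a₁ ] (rng 2 (1 + p)) ∷ prod [ a₁ ] (rng (3 + p) 1) ∷
           prod [ a₂ ] (rng 0 2) ∷ prod [ a₂ ] (rng 2 p) ∷ prod [ a₂ ] (rng (2 + p) 1) ∷ prod [ a₂ ] (rng (3 + p) 1) ∷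
           prod [ a₃ ] (rng 0 1) ∷ prod [ a₃ ] (rng 1 1) ∷ prod [ a₃ ] (rng 2 p) ∷ prod [ a₃ ] (rng (2 + p) 1) ∷ prod [ a₃ ] (rng (3 + p) 1) ∷
           prod [ a₄ ] (rng 0 1) ∷ prod [ a₄ ] (rng 1 (1 + p)) ∷ prod [ a₄ ] (rng (2 + p) 1) ∷ prod [ a₄ ] (rng (3 + p) 1) ∷
           prod [ a₅ ] (rng 0 (1 + p)) ∷ prod [ a₅ ] (rng (1 + p) 3) ∷
           prod [ b ] (rng 0 1) ∷ prod [ b ] (rng 1 (3 + p)) ∷
           prod [ c ] (rng 0 (3 + p)) ∷ prod [ c ] (rng (3 + p) 1) ∷ []))
        (↭-reflexive (sym (same (prod [ a₀ ] (full q)) ⧺ cut a₁ 0 (3 + p) 1 e₁ ⧺ cut₃ a₂ 0 2 p 2 e₂ ⧺ cut₃ a₃ 0 2 p 2 e₂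
          ⧺ cut a₄ 0 (2 + p) 2 e₂ ⧺ cut a₅ 0 (1 + p) 3 (cong suc (+-comm 3 p)) ⧺ same (prod [ b ] (full q)) ⧺ cut c 0 (3 + p) 1 e₁ ⧺ same [])))
        where
        e₁ : 4 + p ≡ 3 + p + 1
        e₁ = cong (3 +_) (+-comm 1 p)
        e₂ : 4 + p ≡ 2 + (p + 2)
        e₂ = cong (2 +_) (+-comm 2 p)

    _∘ᶠ_ : ∀ {L K} → Free S L → (∀ {x} → x ∈ K → x ∈ L) → Free S K
    (f ∘ᶠ i) x y = f (i x) (i y)

    -- What remains of the columns of a₂ and a₃ is a rectangle of width two.
    dec-rest : ∀ p → SCD free (S ⊗ Seg (3 + p)) (N + (3 + p)) (prod [ a₂ ] (rng 2 p) ++ prod [ a₃ ] (rng 2 p))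
    dec-rest zero = dec-[]
    dec-rest (suc p) = dec-resp (↭-trans (shuffle (prod [ a₂ ] (rng 2 (suc p))) (prod [ a₃ ] (rng (2 + p) 1)) (prod [ a₃ ] (rng 2 p)))
        (++⁺ˡ (prod [ a₂ ] (rng 2 (suc p))) (↭-reflexive (sym (cut a₃ 2 p 1 (+-comm 1 p))))))
      (dec-++ (dec-stair (long ∘ᶠ λ x → there (there (∈-++⁺ˡ x))) (step p (s≤s (≤-trans (n≤1+n p) (≤-trans (n≤1+n _) (n≤1+n _)))) a₂⋖a₃ (stop z<s))
                (ranks S 5 R centre 2 3 r₂ r₃ refl))
              (dec-leg a₃ 2 p (≤-trans (n≤1+n p) (≤-trans (n≤1+n _) (≤-trans (n≤1+n _) (n≤1+n _)))) left))
      where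
      shuffle : ∀ {A : Set} (x y z : List A) → (x ++ y) ++ z ↭ x ++ (z ++ y)
      shuffle x y z = ↭-trans (↭-reflexive (++-assoc x y z)) (++⁺ˡ x (++-comm y z))
      left : rk S a₃ + rk S a₃ + 4 + p ≡ suc (N + (3 + suc p))
      left rewrite r₃ | sym centre = lem R p
        where
        lem : ∀ r p → 3 + r + (3 + r) + 4 + p ≡ suc (r + (5 + r) + (3 + suc p))
        lem = solve-∀

  block-ladder₅ : Block S N pts
  block-ladder₅ = block-from
    (dec-++ (decPath (cons a₀⋖a₁ (cons a₁⋖a₂ (cons a₂⋖a₃ (cons a₃⋖a₄ (cons a₄⋖a₅ one))))) (trans (cong (R +_) r₅) centre) long)
            (decPath (cons b⋖c one) (trans (cong₂ _+_ rb rc) (trans (lem R) centre)) (high ∘ᶠ ∈-++⁺ˡ)))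
    go
    where
    lem : ∀ r → 2 + r + (3 + r) ≡ r + (5 + r)
    lem = solve-∀
    p≤2+p : ∀ p → p ≤ 2 + p
    p≤2+p p = ≤-trans (n≤1+n p) (n≤1+n _)
    go : ∀ p → SCD free (S ⊗ Seg (2 + p)) (N + (2 + p)) (prod pts (full (2 + p)))
    go zero = dec-resp (↭-trans columns₂ (↭-reflexive (cols≡prod pts (full 2))))
      (dec-++ (dec-stair (long ∘ᶠ ∈-++⁺ˡ) (step 1 1<2 a₀⋖a₁ (hop z<s a₁⋖a₂ (hop z<s a₂⋖a₃ (hop z<s a₃⋖a₄ (stop z<s)))))
                (ranks S 5 R centre 0 4 refl r₄ refl))
      (dec-++ (dec-stair low (hop z<s a₁⋖b (step 1 1<2 b⋖c (stop z<s))) (ranks S 5 R centre 1 3 r₁ rc refl))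
      (dec-++ (dec-stair (low ∘ᶠ λ x → there (there x)) (leg 1 1<2) (ranks S 5 R centre 3 3 rc rc refl))
      (dec-++ (dec-stair long (hop z<s a₀⋖a₁ (hop z<s a₁⋖a₂ (step 1 1<2 a₂⋖a₃ (hop z<s a₃⋖a₄ (hop z<s a₄⋖a₅ (leg 1 1<2))))))
                (ranks S 5 R centre 0 5 refl r₅ refl))
              (dec-stair side (hop z<s b⋖a₃ (hop z<s a₃⋖a₄ (hop z<s a₄⋖a₅ (stop z<s)))) (ranks S 5 R centre 2 5 rb r₅ refl))))))
      where
      1<2 : 1 < 2
      1<2 = s≤s (s≤s z≤n)
    go (suc p) = dec-resp (↭-trans (columns p) (↭-reflexive (cols≡prod pts (full (3 + p)))))
      (dec-++ (dec-stair long (hop z<s a₀⋖a₁ (hop z<s a₁⋖a₂ (step 1 (s≤s (s≤s z≤n)) a₂⋖a₃ (hop z<s a₃⋖a₄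
                  (step p (s≤s (p≤2+p p)) a₄⋖a₅ (leg 2 (s≤s (s≤s (s≤s z≤n)))))))))
                (ranks S 5 R centre 0 5 refl r₅ (cong (6 +_) (+-comm p 2))))
      (dec-++ (dec-stair (long ∘ᶠ ∈-++⁺ˡ) (step (2 + p) ≤-refl a₀⋖a₁ (hop z<s a₁⋖a₂ (hop z<s a₂⋖a₃ (hop z<s a₃⋖a₄ (stop z<s)))))
                (ranks S 5 R centre 0 4 refl r₄ refl))
      (dec-++ (dec-stair low (hop z<s a₁⋖b (step (2 + p) ≤-refl b⋖c (stop z<s))) (ranks S 5 R centre 1 3 r₁ rc refl))
      (dec-++ (dec-stair high (hop z<s b⋖c (step (2 + p) ≤-refl c⋖a₄ (stop z<s))) (ranks S 5 R centre 2 4 rb r₄ refl))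
      (dec-++ (dec-stair (long ∘ᶠ λ x → there (∈-++⁺ˡ x)) (step p (s≤s (p≤2+p p)) a₁⋖a₂ (hop z<s a₂⋖a₃ (stop z<s)))
                (ranks S 5 R centre 1 3 r₁ r₃ refl))
      (dec-++ (dec-stair (long ∘ᶠ λ x → there (there (there x))) (hop z<s a₃⋖a₄ (hop z<s a₄⋖a₅ (leg p (s≤s (p≤2+p p)))))
                (ranks S 5 R centre 3 5 r₃ r₅ refl))
              (dec-rest p)))))))

-- Grids and tables checked by evaluation

Unit : Space
Pt   Unit = ⊤
rk   Unit _ = 0
_⋖_  Unit _ _ = ⊥
E    Unit _ _ = ⊤
⋖⇒rk Unit ()

Grid : List ℕ → Space
Grid [] = Unit
Grid (a ∷ as) = Seg (top a) ⊗ Grid as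

grid : (as : List ℕ) → List (Pt (Grid as))
grid [] = [ tt ]
grid (a ∷ as) = prod (full a) (grid as)

pt≟ : ∀ as → DecidableEquality (Pt (Grid as))
pt≟ [] tt tt = yes refl
pt≟ (a ∷ as) = ≡-dec _≟_ (pt≟ as)

cover? : ∀ as x y → Dec (_⋖_ (Grid as) x y)
cover? [] x y = no λ ()
cover? (a ∷ as) (x , xs) (y , ys) =
  ((y ≟ suc x) ×-dec pt≟ as xs ys) ⊎-dec ((x ≟ y) ×-dec cover? as xs ys)

E? : ∀ as x y → Dec (E (Grid as) x y)
E? [] x y = yes tt
E? (a ∷ as) (x , xs) (y , ys) = ((x ≟ y) ⊎-dec ((x ≟ 0) ×-dec (y ≟ top a))) ×-dec E? as xs ys

Free′ : ∀ as → List (Pt (Grid as)) → Set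
Free′ as L = All (λ x → All (λ y → E (Grid as) x y → x ≡ y) L) L

free? : ∀ as L → Dec (Free′ as L)
free? as L = all? (λ x → all? (λ y → E? as x y →-dec pt≟ as x y) L) L

free! : ∀ as L → {True (free? as L)} → Free (Grid as) L
free! as L {t} x y e = All.lookup (All.lookup (toWitness t) x) y e

extract : ∀ {A : Set} → DecidableEquality A → (x : A) (ys : List A) → Maybe (∃[ zs ] ys ↭ x ∷ zs)
extract _≈_ x [] = nothing
extract _≈_ x (y ∷ ys) with x ≈ y
... | yes refl = just (ys , ↭-refl)
... | no _ with extract _≈_ x ys
...   | nothing = nothing
...   | just (zs , p) = just (y ∷ zs , ↭-trans (prep y p) (swap y x ↭-refl))

perm? : ∀ {A : Set} → DecidableEquality A → (xs ys : List A) → Maybe (xs ↭ ys)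
perm? _≈_ [] [] = just ↭-refl
perm? _≈_ [] (_ ∷ _) = nothing
perm? _≈_ (x ∷ xs) ys with extract _≈_ x ys
... | nothing = nothing
... | just (zs , p) with perm? _≈_ xs zs
...   | nothing = nothing
...   | just q = just (↭-trans (prep x q) (↭-sym p))

final : ∀ {A : Set} → A → List A → A
final x [] = x
final x (y ∷ ys) = final y ys

linked⇒path : ∀ {x ys} → Linked (_⋖_ S) (x ∷ ys) → Path S x (final x ys) (x ∷ ys)
linked⇒path [-] = one
linked⇒path (c ∷ l) = cons c (linked⇒path l)

-- All side conditions are decidable and settled by evaluation, so an entry of a table consists of
-- its points only.
block! : ∀ as x ys {N} → {True (linked? (cover? as) (x ∷ ys))} → {True (free? as (x ∷ ys))} →
  {True (rk (Grid as) x + 2 ≤? rk (Grid as) (final x ys))} → {True (rk (Grid as) x + rk (Grid as) (final x ys) ≟ N)} → Block (Grid as) N (x ∷ ys)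
block! as x ys {N} {l} {f} {n} {e} = block-path (linked⇒path (toWitness l)) (free! as (x ∷ ys) {f}) (toWitness n) (toWitness e)

ladder₃! : ∀ as a b c d b′ c′ {N} →
  {True (linked? (cover? as) (a ∷ b ∷ c ∷ d ∷ []))} → {True (linked? (cover? as) (a ∷ b′ ∷ c′ ∷ d ∷ []))} →
  {True (free? as (a ∷ b ∷ c ∷ d ∷ []))} → {True (free? as (a ∷ b′ ∷ []))} → {True (free? as (b′ ∷ c′ ∷ []))} → {True (free? as (c′ ∷ d ∷ []))} →
  {True (rk (Grid as) a + (3 + rk (Grid as) a) ≟ N)} → Block (Grid as) N (a ∷ b ∷ c ∷ d ∷ b′ ∷ c′ ∷ [])
ladder₃! as a b c d b′ c′ {N} {p} {q} {f} {g} {h} {i} {e} with toWitness {a? = linked? (cover? as) (a ∷ b ∷ c ∷ d ∷ [])} p | toWitness {a? = linked? (cover? as) (a ∷ b′ ∷ c′ ∷ d ∷ [])} q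
... | c₁ ∷ c₂ ∷ c₃ ∷ [-] | c₄ ∷ c₅ ∷ c₆ ∷ [-] = block-ladder₃ record
  { a⋖b = c₁ ; b⋖c = c₂ ; c⋖d = c₃ ; a⋖b′ = c₄ ; b′⋖c′ = c₅ ; c′⋖d = c₆
  ; long = free! as (a ∷ b ∷ c ∷ d ∷ []) {f} ; low = free! as (a ∷ b′ ∷ []) {g} ; mid = free! as (b′ ∷ c′ ∷ []) {h}
  ; high = free! as (c′ ∷ d ∷ []) {i} ; centre = toWitness e }

ladder₅! : ∀ as a₀ a₁ a₂ a₃ a₄ a₅ b c {N} →
  {True (linked? (cover? as) (a₀ ∷ a₁ ∷ a₂ ∷ a₃ ∷ a₄ ∷ a₅ ∷ []))} → {True (linked? (cover? as) (a₁ ∷ b ∷ c ∷ a₄ ∷ []))} → {True (cover? as b a₃)} →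
  {True (free? as (a₀ ∷ a₁ ∷ a₂ ∷ a₃ ∷ a₄ ∷ a₅ ∷ []))} → {True (free? as (a₁ ∷ b ∷ c ∷ []))} → {True (free? as (b ∷ c ∷ a₄ ∷ []))} → {True (free? as (b ∷ a₃ ∷ a₄ ∷ a₅ ∷ []))} →
  {True (rk (Grid as) a₀ + (5 + rk (Grid as) a₀) ≟ N)} → Block (Grid as) N (a₀ ∷ a₁ ∷ a₂ ∷ a₃ ∷ a₄ ∷ a₅ ∷ b ∷ c ∷ [])
ladder₅! as a₀ a₁ a₂ a₃ a₄ a₅ b c {N} {p} {q} {s} {f} {g} {h} {i} {e} with toWitness {a? = linked? (cover? as) (a₀ ∷ a₁ ∷ a₂ ∷ a₃ ∷ a₄ ∷ a₅ ∷ [])} p | toWitness {a? = linked? (cover? as) (a₁ ∷ b ∷ c ∷ a₄ ∷ [])} q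
... | c₁ ∷ c₂ ∷ c₃ ∷ c₄ ∷ c₅ ∷ [-] | c₆ ∷ c₇ ∷ c₈ ∷ [-] = block-ladder₅ record
  { a₀⋖a₁ = c₁ ; a₁⋖a₂ = c₂ ; a₂⋖a₃ = c₃ ; a₃⋖a₄ = c₄ ; a₄⋖a₅ = c₅ ; a₁⋖b = c₆ ; b⋖c = c₇ ; c⋖a₄ = c₈ ; b⋖a₃ = toWitness s
  ; long = free! as (a₀ ∷ a₁ ∷ a₂ ∷ a₃ ∷ a₄ ∷ a₅ ∷ []) {f} ; low = free! as (a₁ ∷ b ∷ c ∷ []) {g}
  ; high = free! as (b ∷ c ∷ a₄ ∷ []) {h} ; side = free! as (b ∷ a₃ ∷ a₄ ∷ a₅ ∷ []) {i} ; centre = toWitness e }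

tabulated : ∀ as {L} → Block (Grid as) N L → {Bool.T (is-just (perm? (pt≟ as) L (grid as)))} → Block (Grid as) N (grid as)
tabulated as {L} b {t} = block-resp (to-witness-T (perm? (pt≟ as) L (grid as)) t) b

-- The two tables below were found by computer search.
as₁₁₁₁₁ : List ℕ
as₁₁₁₁₁ = 1 ∷ 1 ∷ 1 ∷ 1 ∷ 1 ∷ []

-- The rank sizes 1, 5, 10, 10, 5, 1 force one chain of six elements, four of four and five of two.
-- Each of the five longer chains carries exactly one two-element chain. In [1]³ there would be two
-- of these for a single longer chain.
block-11111 : Block (Grid as₁₁₁₁₁) 5 (grid as₁₁₁₁₁)
block-11111 = tabulated as₁₁₁₁₁
  (block-++ (ladder₃! as₁₁₁₁₁ (0 , 0 , 0 , 0 , 1 , tt) (1 , 0 , 0 , 0 , 1 , tt) (1 , 1 , 0 , 0 , 1 , tt) (1 , 1 , 1 , 0 , 1 , tt) (0 , 1 , 0 , 0 , 1 , tt) (0 , 1 , 1 , 0 , 1 , tt))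
  (block-++ (ladder₃! as₁₁₁₁₁ (0 , 0 , 1 , 0 , 0 , tt) (1 , 0 , 1 , 0 , 0 , tt) (1 , 0 , 1 , 1 , 0 , tt) (1 , 0 , 1 , 1 , 1 , tt) (0 , 0 , 1 , 0 , 1 , tt) (1 , 0 , 1 , 0 , 1 , tt))
  (block-++ (ladder₃! as₁₁₁₁₁ (1 , 0 , 0 , 0 , 0 , tt) (1 , 1 , 0 , 0 , 0 , tt) (1 , 1 , 0 , 1 , 0 , tt) (1 , 1 , 0 , 1 , 1 , tt) (1 , 0 , 0 , 1 , 0 , tt) (1 , 0 , 0 , 1 , 1 , tt))
  (block-++ (ladder₃! as₁₁₁₁₁ (0 , 1 , 0 , 0 , 0 , tt) (0 , 1 , 1 , 0 , 0 , tt) (1 , 1 , 1 , 0 , 0 , tt) (1 , 1 , 1 , 1 , 0 , tt) (0 , 1 , 0 , 1 , 0 , tt) (0 , 1 , 1 , 1 , 0 , tt))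
  (ladder₅! as₁₁₁₁₁ (0 , 0 , 0 , 0 , 0 , tt) (0 , 0 , 0 , 1 , 0 , tt) (0 , 0 , 1 , 1 , 0 , tt) (0 , 0 , 1 , 1 , 1 , tt) (0 , 1 , 1 , 1 , 1 , tt) (1 , 1 , 1 , 1 , 1 , tt) (0 , 0 , 0 , 1 , 1 , tt) (0 , 1 , 0 , 1 , 1 , tt))))))

as₁₃₃ : List ℕ
as₁₃₃ = 1 ∷ 3 ∷ 3 ∷ []

-- The rank sizes 1, 3, 5, 7, 7, 5, 3, 1 force chains of 8, 6, 6, 4, 4, 2 and 2 elements. The
-- shortest two hang on a chain of six and a chain of four; the other three are blocks by
-- themselves.
block-133 : Block (Grid as₁₃₃) 7 (grid as₁₃₃)
block-133 = tabulated as₁₃₃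
  (block-++ (block! as₁₃₃ (0 , 0 , 1 , tt) ((0 , 1 , 1 , tt) ∷ (0 , 1 , 2 , tt) ∷ (0 , 2 , 2 , tt) ∷ (0 , 3 , 2 , tt) ∷ (0 , 3 , 3 , tt) ∷ []))
  (block-++ (block! as₁₃₃ (0 , 0 , 2 , tt) ((0 , 0 , 3 , tt) ∷ (0 , 1 , 3 , tt) ∷ (0 , 2 , 3 , tt) ∷ []))
  (block-++ (ladder₅! as₁₃₃ (1 , 0 , 0 , tt) (1 , 0 , 1 , tt) (1 , 1 , 1 , tt) (1 , 1 , 2 , tt) (1 , 1 , 3 , tt) (1 , 2 , 3 , tt) (1 , 0 , 2 , tt) (1 , 0 , 3 , tt))
  (block-++ (block! as₁₃₃ (0 , 0 , 0 , tt) ((0 , 1 , 0 , tt) ∷ (1 , 1 , 0 , tt) ∷ (1 , 2 , 0 , tt) ∷ (1 , 2 , 1 , tt) ∷ (1 , 2 , 2 , tt) ∷ (1 , 3 , 2 , tt) ∷ (1 , 3 , 3 , tt) ∷ []))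
  (ladder₃! as₁₃₃ (0 , 2 , 0 , tt) (0 , 3 , 0 , tt) (1 , 3 , 0 , tt) (1 , 3 , 1 , tt) (0 , 2 , 1 , tt) (0 , 3 , 1 , tt))))))

-- Regrouping and permuting factors

assocʳ : ∀ {A B C : Set} → (A × B) × C → A × B × C
assocʳ ((a , b) , c) = a , b , c

mor-assoc : ∀ {L} → Mor ((S ⊗ T) ⊗ U) (S ⊗ T ⊗ U) L assocʳ 0
rk-shift (mor-assoc {S} {T} {U}) {(x , y) , z} _ = sym (+-assoc (rk S x) (rk T y) (rk U z))
⋖-pres mor-assoc _ _ (inj₁ (inj₁ (c , refl) , refl)) = inj₁ (c , refl)
⋖-pres mor-assoc _ _ (inj₁ (inj₂ (refl , c) , refl)) = inj₂ (refl , inj₁ (c , refl))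
⋖-pres mor-assoc _ _ (inj₂ (refl , c)) = inj₂ (refl , inj₂ (refl , c))
E-refl mor-assoc _ _ (e , f , g) = (e , f) , g

mor-swap : ∀ {L} → Mor (S ⊗ T) (T ⊗ S) L ×.swap 0
rk-shift (mor-swap {S} {T}) {x , y} _ = +-comm (rk T y) (rk S x)
⋖-pres mor-swap _ _ (inj₁ (c , refl)) = inj₂ (refl , c)
⋖-pres mor-swap _ _ (inj₂ (refl , c)) = inj₁ (c , refl)
E-refl mor-swap _ _ (e , f) = f , e

exchange : ∀ {A B C : Set} → (A × B) × C → (A × C) × B
exchange ((a , b) , c) = (a , c) , b

mor-exchange : ∀ {L} → Mor ((S ⊗ T) ⊗ U) ((S ⊗ U) ⊗ T) L exchange 0
rk-shift (mor-exchange {S} {T} {U}) {(x , y) , z} _ = lem (rk S x) (rk T y) (rk U z)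
  where lem : ∀ a b c → a + c + b ≡ a + b + c
        lem = solve-∀
⋖-pres mor-exchange _ _ (inj₁ (inj₁ (c , refl) , refl)) = inj₁ (inj₁ (c , refl) , refl)
⋖-pres mor-exchange _ _ (inj₁ (inj₂ (refl , c) , refl)) = inj₂ (refl , c)
⋖-pres mor-exchange _ _ (inj₂ (refl , c)) = inj₁ (inj₂ (refl , c) , refl)
E-refl mor-exchange _ _ ((e , f) , g) = (e , g) , f

prod-swap : ∀ {A B : Set} (L : List A) (K : List B) → map ×.swap (prod L K) ↭ prod K L
prod-swap [] K = ↭-reflexive (sym (cartesianProductWith-zeroʳ _,_ K))
prod-swap (x ∷ L) K = ↭-trans (↭-reflexive (map-++ ×.swap (map (x ,_) K) (prod L K)))
  (↭-trans (++⁺ (↭-reflexive (row K)) (prod-swap L K)) (↭-sym (prod-++ʳ K [ x ] L)))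
  where
  row : ∀ K → map ×.swap (map (x ,_) K) ≡ prod K [ x ]
  row [] = refl
  row (y ∷ K) = cong ((y , x) ∷_) (row K)

prod-mapˡ : ∀ {A B C : Set} (f : A → B) (L : List A) (K : List C) → prod (map f L) K ≡ map (map× f id) (prod L K)
prod-mapˡ f L K = trans (cong (prod (map f L)) (sym (map-id K))) (prod-map f id L K)

prod-assoc : ∀ {A B C : Set} (L : List A) (K : List B) (J : List C) → map assocʳ (prod (prod L K) J) ≡ prod L (prod K J)
prod-assoc [] K J = refl
prod-assoc (x ∷ L) K J = trans (cong (map assocʳ) (prod-++ˡ (map (x ,_) K) (prod L K)))
  (trans (map-++ assocʳ (prod (map (x ,_) K) J) _)
    (trans (cong (map assocʳ) (prod-mapˡ (x ,_) K J)) (sym (map-∘ (prod K J))) ⧺ prod-assoc L K J))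

prod-exchange : ∀ {A B C : Set} (L : List A) (K : List B) (J : List C) → map exchange (prod (prod L K) J) ↭ prod (prod L J) K
prod-exchange [] K J = ↭-refl
prod-exchange (x ∷ L) K J = ↭-trans
  (↭-reflexive (trans (cong (map exchange) (prod-++ˡ (map (x ,_) K) (prod L K))) (map-++ exchange (prod (map (x ,_) K) J) _)))
  (↭-trans (++⁺ row (prod-exchange L K J)) (↭-reflexive (sym (prod-++ˡ (map (x ,_) J) (prod L J)))))
  where
  row : map exchange (prod (map (x ,_) K) J) ↭ prod (map (x ,_) J) K
  row = ↭-trans (↭-reflexive (trans (cong (map exchange) (prod-mapˡ (x ,_) K J))
          (trans (sym (map-∘ (prod K J))) (map-∘ (prod K J)))))
        (↭-trans (map⁺ (map× (x ,_) id) (prod-swap K J)) (↭-reflexive (sym (prod-mapˡ (x ,_) J K))))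

-- The marked segment is brought next to the block, where the product has no bad pairs; a further
-- factor without bad pairs can then be multiplied on freely.
block-×ʳ : ∀ {L K} → Block S N L → SCD free T M K → Block (S ⊗ T) (N + M) (prod L K)
block-×ʳ {N = N} {M = M} {L = L} {K} (mkBlock b) d = mkBlock λ q →
  dec-resp (prod-exchange L (full q) K) (dec-map mor-exchange (lem N q M) (dec-× (b q) d))
  where
  lem : ∀ a b c → a + b + c ≡ a + c + b
  lem = solve-∀

assocˡ : ∀ {A B C : Set} → A × B × C → (A × B) × C
assocˡ (a , b , c) = (a , b) , c

mor-assocˡ : ∀ {L} → Mor (S ⊗ T ⊗ U) ((S ⊗ T) ⊗ U) L assocˡ 0
rk-shift (mor-assocˡ {S} {T} {U}) {x , y , z} _ = +-assoc (rk S x) (rk T y) (rk U z)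
⋖-pres mor-assocˡ _ _ (inj₁ (c , refl)) = inj₁ (inj₁ (c , refl) , refl)
⋖-pres mor-assocˡ _ _ (inj₂ (refl , inj₁ (c , refl))) = inj₁ (inj₂ (refl , c) , refl)
⋖-pres mor-assocˡ _ _ (inj₂ (refl , inj₂ (refl , c))) = inj₂ (refl , c)
E-refl mor-assocˡ _ _ ((e , f) , g) = e , f , g

prod-assocˡ : ∀ {A B C : Set} (L : List A) (K : List B) (J : List C) → map assocˡ (prod L (prod K J)) ≡ prod (prod L K) J
prod-assocˡ L K J = trans (cong (map assocˡ) (sym (prod-assoc L K J))) (trans (sym (map-∘ (prod (prod L K) J))) (map-id _))

-- The blocks [1] × [a] × [b]

-- `z` will be (0 , 0) or (a , b); `miss` thereby excludes the one bad pair that moves both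
-- coordinates, and the other fields exclude those that move only one.
record Sep (a b r r′ : ℕ) (z : ℕ × ℕ) (x : ℕ × ℕ) : Set where
  constructor sep
  field
    bot₂ : proj₂ x ≡ 0 → proj₁ x < r
    top₂ : proj₂ x ≡ b → r ≤ proj₁ x
    bot₁ : proj₁ x ≡ 0 → proj₂ x < r′
    top₁ : proj₁ x ≡ a → r′ ≤ proj₂ x
    miss : x ≢ z

-- The thresholds r and r′ keep the two ends of each coordinate in different columns and rows.
free-planar : ∀ {a b L} r r′ z → (z ≡ (0 , 0) ⊎ z ≡ (a , b)) → All (Sep a b r r′ z) L → Free (Seg a ⊗ Seg b) L
free-planar {a} {b} {L} r r′ z h all {i , j} {i′ , j′} x∈ y∈ (e , f) = go e f h
  where
  open Sep
  s = All.lookup all x∈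
  t = All.lookup all y∈
  go : _ → _ → _ → _
  go (inj₁ refl) (inj₁ refl) _ = refl
  go (inj₁ refl) (inj₂ (p , q)) _ = ⊥-elim (<⇒≱ (bot₂ s p) (top₂ t q))
  go (inj₂ (p , q)) (inj₁ refl) _ = ⊥-elim (<⇒≱ (bot₁ s p) (top₁ t q))
  go (inj₂ (refl , _)) (inj₂ (refl , _)) (inj₁ refl) = ⊥-elim (miss s refl)
  go (inj₂ (_ , refl)) (inj₂ (_ , refl)) (inj₂ refl) = ⊥-elim (miss t refl)

all-row : ∀ {P : ℕ × ℕ → Set} {s n y} → (∀ {i} → s ≤ i → i < s + n → P (i , y)) → All P (prod (rng s n) [ y ])
all-row {s = s} {n} {y} h = All.tabulate λ { {i , j} p → go (∈-cartesianProduct⁻ (rng s n) [ y ] p) }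
  where
  go : ∀ {i j} → i ∈ rng s n × j ∈ [ y ] → _
  go (a , here refl) = h (proj₁ (∈-rng⁻ a)) (proj₂ (∈-rng⁻ a))

all-col : ∀ {P : ℕ × ℕ → Set} {s n x} → (∀ {j} → s ≤ j → j < s + n → P (x , j)) → All P (prod [ x ] (rng s n))
all-col {s = s} {n} {x} h = All.tabulate λ { {i , j} p → go (∈-cartesianProduct⁻ [ x ] (rng s n) p) }
  where
  go : ∀ {i j} → i ∈ [ x ] × j ∈ rng s n → _
  go (here refl , a) = h (proj₁ (∈-rng⁻ a)) (proj₂ (∈-rng⁻ a))

rows : ∀ {B : Set} s m n {k} (K : List B) → k ≡ m + n → prod (rng s k) K ≡ prod (rng s m) K ++ prod (rng (s + m) n) K
rows s m n K refl = trans (cong (λ L → prod L K) (rng-++ s m n)) (prod-++ˡ (rng s m) (rng (s + m) n))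

-- The rectangle [6 + m] × [3 + k], in which the only bad pair of the first coordinate is (0 , 5 + m).
-- The pieces are chains of length at least two and a product, and hence blocks.
module Rectangle (m k : ℕ) where
  X : Space
  X = Seg (5 + m) ⊗ Seg (3 + k)

  -- `K₀` follows the second row and the last column but one, `K₁` the second column and the last
  -- row but one. `K₂` and `K₃` are what these two leave of the boundary, and `K₄` is the interior.
  K₀ K₁ K₂ K₃ K₄ : List (ℕ × ℕ)
  K₀ = prod [ 0 ] [ 0 ] ++ prod [ 1 ] [ 0 ] ++ prod (rng 1 (5 + m)) [ 1 ] ++ prod [ 5 + m ] (rng 2 (1 + k)) ++ prod [ 6 + m ] (rng (2 + k) 2)
  K₁ = prod [ 0 ] (rng 1 2) ++ prod [ 1 ] (rng 2 (1 + k)) ++ prod (rng 2 (3 + m)) [ 2 + k ] ++ prod [ 4 + m ] [ 3 + k ] ++ prod [ 5 + m ] [ 3 + k ]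
  K₂ = prod (rng 2 (5 + m)) [ 0 ] ++ prod [ 6 + m ] (rng 1 (1 + k))
  K₃ = prod [ 0 ] (rng 3 (1 + k)) ++ prod (rng 1 (3 + m)) [ 3 + k ]
  K₄ = prod (rng 2 (3 + m)) (rng 2 k)

  grid↭ : K₀ ++ K₁ ++ K₂ ++ K₃ ++ K₄ ↭ prod (full (6 + m)) (full (3 + k))
  grid↭ = ↭-trans (↭-reflexive left) (↭-trans
    (prove 25
      ((v 0 ⊕ v 3 ⊕ (v 4 ⊕ v 8 ⊕ v 13 ⊕ v 18) ⊕ v 19 ⊕ v 23) ⊕
       (v 1 ⊕ v 5 ⊕ (v 10 ⊕ v 15) ⊕ v 16 ⊕ v 20) ⊕
       ((v 7 ⊕ v 12 ⊕ v 17 ⊕ v 21) ⊕ v 22) ⊕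
       (v 2 ⊕ v 6 ⊕ v 11) ⊕
       (v 9 ⊕ v 14))
      ((v 0 ⊕ v 1 ⊕ v 2) ⊕ (v 3 ⊕ v 4 ⊕ v 5 ⊕ v 6) ⊕ (v 7 ⊕ v 8 ⊕ v 9 ⊕ v 10 ⊕ v 11) ⊕
       (v 12 ⊕ v 13 ⊕ v 14 ⊕ v 15 ⊕ v 16) ⊕ (v 17 ⊕ v 18 ⊕ v 19 ⊕ v 20) ⊕ (v 21 ⊕ v 22 ⊕ v 23))
      (prod [ 0 ] [ 0 ] ∷ prod [ 0 ] (rng 1 2) ∷ prod [ 0 ] (rng 3 (1 + k)) ∷
       prod [ 1 ] [ 0 ] ∷ prod [ 1 ] [ 1 ] ∷ prod [ 1 ] (rng 2 (1 + k)) ∷ prod [ 1 ] [ 3 + k ] ∷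
       prod I [ 0 ] ∷ prod I [ 1 ] ∷ prod I (rng 2 k) ∷ prod I [ 2 + k ] ∷ prod I [ 3 + k ] ∷
       prod [ 4 + m ] [ 0 ] ∷ prod [ 4 + m ] [ 1 ] ∷ prod [ 4 + m ] (rng 2 k) ∷ prod [ 4 + m ] [ 2 + k ] ∷ prod [ 4 + m ] [ 3 + k ] ∷
       prod [ 5 + m ] [ 0 ] ∷ prod [ 5 + m ] [ 1 ] ∷ prod [ 5 + m ] (rng 2 (1 + k)) ∷ prod [ 5 + m ] [ 3 + k ] ∷
       prod [ 6 + m ] [ 0 ] ∷ prod [ 6 + m ] (rng 1 (1 + k)) ∷ prod [ 6 + m ] (rng (2 + k) 2) ∷ [] ∷ []))
    (↭-sym right))
    where
    I D : List ℕ
    I = rng 2 (2 + m)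
    D = full (3 + k)
    left : K₀ ++ K₁ ++ K₂ ++ K₃ ++ K₄ ≡
      (prod [ 0 ] [ 0 ] ++ prod [ 1 ] [ 0 ] ++ (prod [ 1 ] [ 1 ] ++ prod I [ 1 ] ++ prod (rng (4 + m) 2) [ 1 ]) ++ prod [ 5 + m ] (rng 2 (1 + k)) ++ prod [ 6 + m ] (rng (2 + k) 2)) ++
      (prod [ 0 ] (rng 1 2) ++ prod [ 1 ] (rng 2 (1 + k)) ++ (prod I [ 2 + k ] ++ prod [ 4 + m ] [ 2 + k ]) ++ prod [ 4 + m ] [ 3 + k ] ++ prod [ 5 + m ] [ 3 + k ]) ++
      ((prod I [ 0 ] ++ prod (rng (4 + m) 3) [ 0 ]) ++ prod [ 6 + m ] (rng 1 (1 + k))) ++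
      (prod [ 0 ] (rng 3 (1 + k)) ++ (prod [ 1 ] [ 3 + k ] ++ prod I [ 3 + k ])) ++
      (prod I (rng 2 k) ++ prod [ 4 + m ] (rng 2 k))
    left = (same (prod [ 0 ] [ 0 ]) ⧺ same (prod [ 1 ] [ 0 ]) ⧺ (same (prod [ 1 ] [ 1 ]) ⧺ rows 2 (2 + m) 2 [ 1 ] (cong (2 +_) (+-comm 2 m))) ⧺
              same (prod [ 5 + m ] (rng 2 (1 + k)) ++ prod [ 6 + m ] (rng (2 + k) 2))) ⧺
           (same (prod [ 0 ] (rng 1 2)) ⧺ same (prod [ 1 ] (rng 2 (1 + k))) ⧺ rows 2 (2 + m) 1 [ 2 + k ] (cong (2 +_) (+-comm 1 m)) ⧺
              same (prod [ 4 + m ] [ 3 + k ] ++ prod [ 5 + m ] [ 3 + k ])) ⧺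
           (rows 2 (2 + m) 3 [ 0 ] (cong (2 +_) (+-comm 3 m)) ⧺ same (prod [ 6 + m ] (rng 1 (1 + k)))) ⧺
           (same (prod [ 0 ] (rng 3 (1 + k))) ⧺ same (prod (rng 1 (3 + m)) [ 3 + k ])) ⧺
           rows 2 (2 + m) 1 (rng 2 k) (cong (2 +_) (+-comm 1 m))
    D≡ : D ≡ [ 0 ] ++ [ 1 ] ++ rng 2 k ++ [ 2 + k ] ++ [ 3 + k ]
    D≡ = cong (λ L → 0 ∷ 1 ∷ L) (trans (cong (rng 2) (+-comm 2 k)) (rng-++ 2 k 2))
    split : ∀ L → prod L D ↭ prod L [ 0 ] ++ prod L [ 1 ] ++ prod L (rng 2 k) ++ prod L [ 2 + k ] ++ prod L [ 3 + k ]
    split L = ↭-trans (↭-reflexive (cong (prod L) D≡))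
      (↭-trans (prod-++ʳ L [ 0 ] _) (++⁺ˡ (prod L [ 0 ])
      (↭-trans (prod-++ʳ L [ 1 ] _) (++⁺ˡ (prod L [ 1 ])
      (↭-trans (prod-++ʳ L (rng 2 k) _) (++⁺ˡ (prod L (rng 2 k)) (prod-++ʳ L [ 2 + k ] [ 3 + k ])))))))
    right : prod (full (6 + m)) D ↭
      (prod [ 0 ] [ 0 ] ++ prod [ 0 ] (rng 1 2) ++ prod [ 0 ] (rng 3 (1 + k))) ++
      (prod [ 1 ] [ 0 ] ++ prod [ 1 ] [ 1 ] ++ prod [ 1 ] (rng 2 (1 + k)) ++ prod [ 1 ] [ 3 + k ]) ++
      (prod I [ 0 ] ++ prod I [ 1 ] ++ prod I (rng 2 k) ++ prod I [ 2 + k ] ++ prod I [ 3 + k ]) ++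
      (prod [ 4 + m ] [ 0 ] ++ prod [ 4 + m ] [ 1 ] ++ prod [ 4 + m ] (rng 2 k) ++ prod [ 4 + m ] [ 2 + k ] ++ prod [ 4 + m ] [ 3 + k ]) ++
      (prod [ 5 + m ] [ 0 ] ++ prod [ 5 + m ] [ 1 ] ++ prod [ 5 + m ] (rng 2 (1 + k)) ++ prod [ 5 + m ] [ 3 + k ]) ++
      (prod [ 6 + m ] [ 0 ] ++ prod [ 6 + m ] (rng 1 (1 + k)) ++ prod [ 6 + m ] (rng (2 + k) 2))
    right = ↭-trans
      (↭-reflexive (trans (prod-++ˡ [ 0 ] (rng 1 (6 + m)) {D}) (same (prod [ 0 ] D) ⧺ trans (prod-++ˡ [ 1 ] (rng 2 (5 + m)) {D}) (same (prod [ 1 ] D) ⧺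
          trans (rows 2 (2 + m) 3 D (cong (2 +_) (+-comm 3 m))) (same (prod I D) ⧺ trans (prod-++ˡ [ 4 + m ] (rng (5 + m) 2) {D})
            (same (prod [ 4 + m ] D) ⧺ prod-++ˡ [ 5 + m ] [ 6 + m ] {D}))))))
      (++⁺ (↭-refl {x = prod [ 0 ] D}) (++⁺ (↭-reflexive (cut₃ 1 0 2 (1 + k) 1 (cong (3 +_) (+-comm 1 k))))
        (++⁺ (split I) (++⁺ (split [ 4 + m ])
          (++⁺ (↭-reflexive (cut₃ (5 + m) 0 2 (1 + k) 1 (cong (3 +_) (+-comm 1 k))))
               (↭-reflexive (cut₃ (6 + m) 0 1 (1 + k) 2 (cong (2 +_) (+-comm 2 k)))))))))

  private
    pos : ∀ {i n} {A : Set} → suc n ≤ i → i ≡ 0 → A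
    pos (s≤s _) ()

    below : ∀ {i n} {A : Set} → i < n → i ≡ n → A
    below l refl = ⊥-elim (<-irrefl refl l)

    all₀ : All (Sep (5 + m) (3 + k) 2 1 (5 + m , 3 + k)) K₀
    all₀ = sep (λ _ → z<s) (λ ()) (λ _ → z<s) (λ ()) (λ ())
         ∷ sep (λ _ → s≤s z<s) (λ ()) (λ ()) (λ ()) (λ ())
         ∷ All.++⁺ (all-row {s = 1} {5 + m} λ l _ → sep (λ ()) (λ ()) (pos l) (λ _ → ≤-refl) (λ ()))
          (All.++⁺ (all-col {s = 2} {1 + k} λ {j} l u → sep (pos l) (below (u′ u)) (λ ()) (λ _ → ≤-trans (s≤s z≤n) l) (λ e → below (u′ u) (cong proj₂ e)))
          (sep (λ ()) (λ _ → s≤s (s≤s z≤n)) (λ ()) (λ _ → s≤s z≤n) (λ e → 1+n≢n (cong proj₁ e))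
         ∷ sep (λ ()) (λ _ → s≤s (s≤s z≤n)) (λ ()) (λ _ → s≤s z≤n) (λ e → 1+n≢n (cong proj₁ e)) ∷ []))
      where
      u′ : ∀ {j} → j < 2 + (1 + k) → j < 3 + k
      u′ u = u

    all₁ : All (Sep (5 + m) (3 + k) 0 3 (0 , 0)) K₁
    all₁ = sep (λ ()) (λ _ → z≤n) (λ _ → s≤s z<s) (λ ()) (λ ())
         ∷ sep (λ ()) (λ _ → z≤n) (λ _ → ≤-refl) (λ ()) (λ ())
         ∷ All.++⁺ (all-col {s = 2} {1 + k} λ l _ → sep (pos l) (λ _ → z≤n) (λ ()) (λ ()) (λ ()))
          (All.++⁺ (all-row {s = 2} {3 + m} λ l u → sep (λ ()) (λ _ → z≤n) (pos l) (below u) (λ ()))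
          (sep (λ ()) (λ _ → z≤n) (λ ()) (λ _ → s≤s (s≤s (s≤s z≤n))) (λ ())
         ∷ sep (λ ()) (λ _ → z≤n) (λ ()) (λ _ → s≤s (s≤s (s≤s z≤n))) (λ ()) ∷ []))

    all₂ : All (Sep (5 + m) (3 + k) (7 + m) 0 (0 , 0)) K₂
    all₂ = All.++⁺ (all-row {s = 2} {5 + m} λ l u → sep (λ _ → u) (λ ()) (pos l) (λ _ → z≤n) (λ e → pos l (cong proj₁ e)))
                   (all-col {s = 1} {1 + k} λ l u → sep (λ _ → ≤-refl) (below (≤-trans u (n≤1+n _))) (λ ()) (λ _ → z≤n) (λ ()))

    all₃ : All (Sep (5 + m) (3 + k) 0 (4 + k) (0 , 0)) K₃
    all₃ = All.++⁺ (all-col {s = 3} {1 + k} λ l u → sep (pos l) (λ _ → z≤n) (λ _ → u) (λ ()) (λ e → pos l (cong proj₂ e)))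
                   (all-row {s = 1} {3 + m} λ l u → sep (λ ()) (λ _ → z≤n) (pos l) (below (≤-trans u (n≤1+n _))) (λ ()))

    -- Both coordinates are at least 2, so neither can start at 0 and no pair is bad. The first side
    -- has at least two steps, which makes the product a block.
    interior : ∀ k → Block (Seg (5 + m) ⊗ Seg (3 + k)) (9 + m + k) (prod (rng 2 (3 + m)) (rng 2 k))
    interior zero = block-resp (↭-reflexive (sym (cartesianProductWith-zeroʳ _,_ (rng 2 (3 + m))))) block-[]
    interior (suc k) = block-resp
      (↭-reflexive (trans (sym (prod-map (2 +_) (2 +_) (full (2 + m)) (full k))) (cong₂ prod (rng-shift 2 0 (3 + m)) (rng-shift 2 0 (suc k)))))
      (block-map {k = 4} shifted (lem m k) (block-×ʳ (block-seg m) (dec-seg k)))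
      where
      lem : ∀ m k → 8 + (2 + m + k) ≡ 9 + m + suc k
      lem = solve-∀
      shifted : Mor (Seg 0 ⊗ Seg 0) (Seg (5 + m) ⊗ Seg (3 + suc k)) (prod (full (2 + m)) (full k)) (map× (2 +_) (2 +_)) 4
      rk-shift shifted {i , j} _ = lem′ i j
        where lem′ : ∀ i j → 2 + i + (2 + j) ≡ 4 + (i + j)
              lem′ = solve-∀
      ⋖-pres shifted _ _ (inj₁ (refl , refl)) = inj₁ (refl , refl)
      ⋖-pres shifted _ _ (inj₂ (refl , refl)) = inj₂ (refl , refl)
      E-refl shifted _ _ (inj₁ refl , inj₁ refl) = inj₁ refl , inj₁ refl

  block-rectangle : Block X (9 + m + k) (prod (full (6 + m)) (full (3 + k)))
  block-rectangle = block-resp grid↭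
    -- `K₀` contains (0 , 0) and therefore has to miss (5 + m , 3 + k); the other three chains miss
    -- (0 , 0).
    (block-++ (block-path path₀ (free-planar _ _ _ (inj₂ refl) all₀) (s≤s (s≤s z≤n)) (lem₀ m k))
    (block-++ (block-path path₁ (free-planar _ _ _ (inj₁ refl) all₁) (s≤s (s≤s (s≤s z≤n))) (lem₁ m k))
    (block-++ (block-path path₂ (free-planar _ _ _ (inj₁ refl) all₂) (s≤s (s≤s (s≤s (s≤s z≤n)))) (lem₂ m k))
    (block-++ (block-path path₃ (free-planar _ _ _ (inj₁ refl) all₃) (≤-trans (s≤s (s≤s (s≤s (s≤s (s≤s z≤n))))) (≤-reflexive (sym (lem₄ m k)))) (lem₃ m k))
              (interior k)))))
    where
    lem₀ : ∀ m k → 0 + (6 + m + (3 + k)) ≡ 9 + m + k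
    lem₀ = solve-∀
    lem₁ : ∀ m k → 0 + 1 + (5 + m + (3 + k)) ≡ 9 + m + k
    lem₁ = solve-∀
    lem₂ : ∀ m k → 2 + 0 + (6 + m + (1 + k)) ≡ 9 + m + k
    lem₂ = solve-∀
    lem₃ : ∀ m k → 0 + 3 + (3 + m + (3 + k)) ≡ 9 + m + k
    lem₃ = solve-∀
    lem₄ : ∀ m k → 3 + m + (3 + k) ≡ 6 + m + k
    lem₄ = solve-∀
    path₀ : Path X (0 , 0) (6 + m , 3 + k) K₀
    path₀ = cons (inj₁ (refl , refl)) (cons (inj₂ (refl , refl)) (path-++ (rowPath 1 (segPath 1 (4 + m))) (inj₂ (refl , refl))
      (path-++ (colPath (5 + m) (segPath 2 k)) (inj₁ (refl , refl)) (cons (inj₂ (refl , refl)) one))))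
    path₁ : Path X (0 , 1) (5 + m , 3 + k) K₁
    path₁ = cons (inj₂ (refl , refl)) (cons (inj₁ (refl , refl)) (path-++ (colPath 1 (segPath 2 k)) (inj₁ (refl , refl))
      (path-++ (rowPath (2 + k) (segPath 2 (2 + m))) (inj₂ (refl , refl)) (cons (inj₁ (refl , refl)) one))))
    path₂ : Path X (2 , 0) (6 + m , 1 + k) K₂
    path₂ = path-++ (rowPath 0 (segPath 2 (4 + m))) (inj₂ (refl , refl)) (colPath (6 + m) (segPath 1 k))
    path₃ : Path X (0 , 3) (3 + m , 3 + k) K₃
    path₃ = path-++ (colPath 0 (segPath 3 k)) (inj₁ (refl , refl)) (rowPath (3 + k) (segPath 1 (2 + m)))

-- A first side of at least 4 leaves, after the exchange of hooks, a rectangle with first side at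
-- least 2, so that all three pieces are blocks.
block-strip : ∀ a b → Block (Seg 0 ⊗ Seg (2 + b)) (4 + a + (2 + b)) (prod (full (4 + a)) (full (2 + b)))
block-strip a b = let open Swap (2 + a) b; open SwapFree (2 + a) b in block-resp (↭-sym swap↭)
  (block-++ (block-path path₀ unmarked₀ (s≤s (s≤s z≤n)) refl)
  (block-++ (block-path path₁ unmarked₁ (s≤s (s≤s (s≤s z≤n))) rk₁)
            (block-resp (↭-reflexive rest≡) (block-map unmarked rkᵣ (block-×ʳ (block-seg a) (dec-seg b))))))

-- The long chain of [1] × [a]: up the lower copy of [a], then one step to the upper copy.
ascend : ℕ → ℕ → ℕ × ℕ
ascend zero zero = 0 , 0
ascend zero (suc i) = 1 , 0
ascend (suc a) zero = 0 , 0
ascend (suc a) (suc i) = map× id suc (ascend a i)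

ascend-≤ : ∀ {a i} → i ≤ a → ascend a i ≡ (0 , i)
ascend-≤ {zero} z≤n = refl
ascend-≤ {suc a} z≤n = refl
ascend-≤ {suc a} (s≤s p) = cong (map× id suc) (ascend-≤ p)

ascend-top : ∀ a → ascend a (suc a) ≡ (1 , a)
ascend-top zero = refl
ascend-top (suc a) = cong (map× id suc) (ascend-top a)

mor-ascend : ∀ a → Mor (Seg a) (Seg 0 ⊗ Seg a) (full (suc a)) (ascend a) 0
mor-ascend a = record { rk-shift = λ p → r (side (full⇒≤ p)) ; ⋖-pres = λ { p q refl → c (side (full⇒≤ p)) (full⇒≤ q) } ; E-refl = λ p q → e (side (full⇒≤ p)) (side (full⇒≤ q)) }
  where
  side : ∀ {i} → i ≤ suc a → i ≤ a ⊎ i ≡ suc a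
  side p with m≤n⇒m<n∨m≡n p
  ... | inj₁ (s≤s q) = inj₁ q
  ... | inj₂ q = inj₂ q
  r : ∀ {i} → i ≤ a ⊎ i ≡ suc a → rk (Seg 0 ⊗ Seg a) (ascend a i) ≡ i
  r (inj₁ p) rewrite ascend-≤ p = refl
  r (inj₂ refl) rewrite ascend-top a = refl
  c : ∀ {i} → i ≤ a ⊎ i ≡ suc a → suc i ≤ suc a → _⋖_ (Seg 0 ⊗ Seg a) (ascend a i) (ascend a (suc i))
  c {i} (inj₁ p) q with side q
  ... | inj₁ q′ rewrite ascend-≤ p | ascend-≤ q′ = inj₂ (refl , refl)
  ... | inj₂ refl rewrite ascend-≤ p | ascend-top a = inj₁ (refl , refl)
  c (inj₂ refl) q = ⊥-elim (1+n≰n q)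
  e : ∀ {i j} → i ≤ a ⊎ i ≡ suc a → j ≤ a ⊎ j ≡ suc a → E (Seg 0 ⊗ Seg a) (ascend a i) (ascend a j) → E (Seg a) i j
  e (inj₁ p) (inj₁ q) h rewrite ascend-≤ p | ascend-≤ q = proj₂ h
  e (inj₁ p) (inj₂ refl) h rewrite ascend-≤ p | ascend-top a with E-flat (proj₁ h)
  ... | ()
  e (inj₂ refl) (inj₁ q) h rewrite ascend-≤ q | ascend-top a with E-flat (proj₁ h)
  ... | ()
  e (inj₂ refl) (inj₂ refl) h = inj₁ refl

-- The top of the upper copy belongs to `ascend`; without it no bad pair is left, so the source is
-- unmarked.
mor-upper : ∀ a → Mor (Seg 0) (Seg 0 ⊗ Seg a) (rng 0 a) (1 ,_) 1
rk-shift (mor-upper a) _ = refl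
⋖-pres (mor-upper a) _ _ c = inj₂ (refl , c)
E-refl (mor-upper a) _ q (_ , inj₁ e) = inj₁ e
E-refl (mor-upper a) _ q (_ , inj₂ (_ , refl)) = ⊥-elim (<-irrefl refl (proj₂ (∈-rng⁻ q)))

ascend↭ : ∀ a → map (ascend a) (full (suc a)) ++ map (1 ,_) (rng 0 a) ↭ prod (full 1) (full a)
ascend↭ a = ↭-trans (↭-reflexive (cong (_++ map (1 ,_) (rng 0 a)) up))
  (↭-trans (↭-reflexive (++-assoc (map (0 ,_) (full a)) [ 1 , a ] _)) (++⁺ˡ (map (0 ,_) (full a))
    (↭-trans (++-comm [ 1 , a ] (map (1 ,_) (rng 0 a))) (↭-reflexive
      (trans (sym (map-++ (1 ,_) (rng 0 a) [ a ])) (trans (cong (map (1 ,_)) (sym (rng-∷ʳ 0 a))) (sym (++-identityʳ _))))))))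
  where
  low : ∀ L → (∀ {i} → i ∈ L → i ≤ a) → map (ascend a) L ≡ map (0 ,_) L
  low [] h = refl
  low (x ∷ L) h = cong₂ _∷_ (ascend-≤ (h (here refl))) (low L (h ∘ there))
  up : map (ascend a) (full (suc a)) ≡ map (0 ,_) (full a) ++ [ 1 , a ]
  up = trans (cong (map (ascend a)) (rng-∷ʳ 0 (suc a))) (trans (map-++ (ascend a) (full a) [ suc a ])
    (low (full a) full⇒≤ ⧺ cong [_] (ascend-top a)))

unitʳ : ∀ {A : Set} → A → A × ⊤
unitʳ a = a , tt

mor-unitʳ : ∀ {L} → Mor S (S ⊗ Unit) L unitʳ 0
rk-shift (mor-unitʳ {S}) _ = +-identityʳ _
⋖-pres mor-unitʳ _ _ c = inj₁ (c , refl)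
E-refl mor-unitʳ _ _ = proj₁

prod-unitʳ : ∀ {A : Set} (L : List A) → map unitʳ L ≡ prod L [ tt ]
prod-unitʳ [] = refl
prod-unitʳ (x ∷ L) = cong ((x , tt) ∷_) (prod-unitʳ L)

prod-mapʳ : ∀ {A B C : Set} (f : B → C) (L : List A) (K : List B) → prod L (map f K) ≡ map (map× id f) (prod L K)
prod-mapʳ f L K = trans (cong (λ L → prod L (map f K)) (sym (map-id L))) (prod-map id f L K)

-- [1] × [a] is the chain of `ascend`, which runs one step beyond its bad pair, together with the
-- upper copy of [a] without its top. Multiplied by [b] they become the rectangle and the strip;
-- `a = 5 + m` gives the strip its length of at least 4.
block-1ab : ∀ m k → Block (Grid (1 ∷ 5 + m ∷ 3 + k ∷ [])) (9 + m + k) (grid (1 ∷ 5 + m ∷ 3 + k ∷ []))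
block-1ab m k = block-resp (↭-reflexive unit≡) (block-map (mor-⊗ {L = full 1} {K = prod (full a) (full b)} mor-id (mor-⊗ {L = full a} {K = full b} mor-id mor-unitʳ)) refl
  (block-resp (↭-reflexive (prod-assoc (full 1) (full a) (full b))) (block-map mor-assoc refl
    (block-resp (↭-trans (↭-reflexive (sym (prod-++ˡ (map (ascend a) (full (suc a))) (map (1 ,_) (rng 0 a)) {full b}))) (prod-↭ˡ (full b) (ascend↭ a)))
      (block-++ (block-resp (↭-reflexive (sym (prod-mapˡ (ascend a) (full (suc a)) (full b))))
                  (block-map (mor-⊗ {L = full (suc a)} {K = full b} (mor-ascend a) mor-id) refl (Rectangle.block-rectangle m k)))
                (block-resp (↭-reflexive (sym (prod-mapˡ (1 ,_) (rng 0 a) (full b))))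
                  (block-map (mor-⊗ {L = rng 0 a} {K = full b} (mor-upper a) mor-id) (lem m k) (block-strip m (1 + k)))))))))
  where
  a b : ℕ
  a = 5 + m
  b = 3 + k
  lem : ∀ m k → 1 + 0 + (1 + 0) + (4 + m + (3 + k)) ≡ 9 + m + k
  lem = solve-∀
  unit≡ : map (map× id (map× id unitʳ)) (prod (full 1) (prod (full a) (full b))) ≡ grid (1 ∷ a ∷ b ∷ [])
  unit≡ = trans (sym (prod-mapʳ (map× id unitʳ) (full 1) (prod (full a) (full b))))
    (cong (prod (full 1)) (trans (sym (prod-mapʳ unitʳ (full a) (full b))) (cong (prod (full a)) (prod-unitʳ (full b)))))

-- Products of arbitrarily many segments

double : ℕ → ℕ
double zero = zero
double (suc m) = 2 + double m

ev od : ℕ → ℕ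
ev m = 2 + double m
od m = 3 + double m

Even : ℕ → Set
Even n = ∃[ m ] n ≡ m + m

even-double : ∀ m → Even (double m)
even-double zero = 0 , refl
even-double (suc m) with even-double m
... | h , e = suc h , cong suc (trans (cong suc e) (sym (+-suc h h)))

even-+ : ∀ {m n} → Even m → Even n → Even (m + n)
even-+ (h , refl) (k , refl) = h + k , lem h k
  where lem : ∀ h k → h + h + (k + k) ≡ h + k + (h + k)
        lem = solve-∀

-- Here `q` is the length of a chain with lowest rank `k`, which thus has the parity of the total
-- rank `n`.
even≢1 : ∀ {n q} k → Even n → k + k + q ≡ n → q ≢ 1
even≢1 k (h , refl) e refl = go k h e
  where
  go : ∀ k h → k + k + 1 ≢ h + h
  go zero (suc h) e with trans (suc-injective e) (+-suc h h)
  ... | ()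
  go (suc k) (suc h) e = go k h (suc-injective (trans (cong (_+ 1) (sym (+-suc k k))) (trans (suc-injective e) (+-suc h h))))

dec-Unit : SCD τ Unit 0 (grid [])
dec-Unit = decPath one refl λ _ _ _ → refl

-- Length 1 is excluded because [1] × [r] with `r ≥ 2` admits no such decomposition: a chain from
-- bottom to top that spans neither copy of [r] leaves an upper part of one copy and a lower part of
-- the other, which do not form a chain.
weak-seg : ∀ q r → q ≢ 1 → r ≢ 1 → SCD top (Seg (top q) ⊗ Seg (top r)) (q + r) (prod (full q) (full r))
weak-seg 1 r h _ = ⊥-elim (h refl)
weak-seg q 1 _ h = ⊥-elim (h refl)
weak-seg zero r _ _ = dec-resp (↭-reflexive (sym (++-identityʳ _))) (dec-map left refl (dec-seg r))
  where
  left : ∀ {L} → Mor (Seg (top r)) (Seg 0 ⊗ Seg (top r)) L (0 ,_) 0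
  rk-shift left _ = refl
  ⋖-pres left _ _ c = inj₂ (refl , c)
  E-refl left _ _ = proj₂
weak-seg q@(suc (suc _)) zero _ _ = dec-resp (↭-reflexive (right≡ (full q))) (dec-map right (sym (+-identityʳ q)) (dec-seg q))
  where
  right : ∀ {L} → Mor (Seg (top q)) (Seg (top q) ⊗ Seg 0) L (_, 0) 0
  rk-shift right _ = +-identityʳ _
  ⋖-pres right _ _ c = inj₁ (c , refl)
  E-refl right _ _ = proj₁
  right≡ : ∀ L → map (_, 0) L ≡ prod L [ 0 ]
  right≡ [] = refl
  right≡ (x ∷ L) = cong ((x , 0) ∷_) (right≡ L)
weak-seg (suc (suc a)) (suc (suc b)) _ _ = let open Swap a b; open SwapFree a b using (rk₁; rkᵣ; rest≡) in dec-resp (↭-sym swap↭)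
  (dec-++ (decPath-top path₀ refl weak₀ (s≤s (s≤s z≤n)))
  (dec-++ (decPath path₁ rk₁ free₁) (dec-resp (↭-reflexive rest≡) (dec-map rest rkᵣ (dec-weaken (dec-grid {free} a b))))))

weak-× : ∀ {L K} → SCD top S N L → Even N → SCD top T M K → Even M → SCD top (S ⊗ T) (N + M) (prod L K)
weak-× d e d′ e′ = bindˡ d λ q k p → bindʳ {B = full q} d′ λ r l p′ → weak-seg q r (even≢1 k e p) (even≢1 l e′ p′)

flat : List (ℕ × ℕ) → List ℕ
flat [] = []
flat ((a , b) ∷ ps) = a ∷ b ∷ flat ps

pairs : ∀ os → (∃[ ps ] os ≡ flat ps) ⊎ (∃[ o ] ∃[ ps ] os ≡ o ∷ flat ps)
pairs [] = inj₁ ([] , refl)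
pairs (o ∷ os) with pairs os
... | inj₁ (ps , refl) = inj₂ (o , ps , refl)
... | inj₂ (o′ , ps , refl) = inj₁ ((o , o′) ∷ ps , refl)

big : List ℕ → List ℕ → List ℕ
big os es = map od os ++ map ev es

-- With the odd sides taken in pairs every partial product has even total rank, so its chains never
-- have exactly one step and the next factor can be multiplied on.
weak-even : ∀ ps es → let as = big (flat ps) es in SCD top (Grid as) (sum as) (grid as) × Even (sum as)
weak-even [] [] = dec-Unit , 0 , refl
weak-even [] (e ∷ es) with weak-even [] es
... | d , h = bindʳ {B = full (ev e)} d (λ q k p → weak-seg (ev e) q (λ ()) (even≢1 k h p)) , even-+ (even-double (suc e)) h
weak-even ((a , b) ∷ ps) es with weak-even ps es
... | d , h = dec-resp (↭-reflexive (prod-assoc (full (od a)) (full (od b)) (grid as)))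
      (dec-map mor-assoc (+-assoc (od a) (od b) (sum as)) (weak-× (weak-seg (od a) (od b) (λ ()) (λ ())) ab d h)) ,
    subst Even (+-assoc (od a) (od b) (sum as)) (even-+ ab h)
  where
  as = big (flat ps) es
  ab : Even (od a + od b)
  ab = subst Even (cong suc (sym (trans (+-suc (ev a) (ev b)) refl))) (even-+ {2} (1 , refl) (even-+ (even-double (suc a)) (even-double (suc b))))

-- An unpaired odd side is multiplied on last: it is at least 3, and the chains it meets have even
-- length.
weak : ∀ os es → let as = big os es in SCD top (Grid as) (sum as) (grid as)
weak os es with pairs os
... | inj₁ (ps , refl) = proj₁ (weak-even ps es)
... | inj₂ (o , ps , refl) with weak-even ps es
...   | d , h = bindʳ {B = full (od o)} d (λ q k p → weak-seg (od o) q (λ ()) (even≢1 k h p))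

app : ∀ as {bs} → Pt (Grid as) × Pt (Grid bs) → Pt (Grid (as ++ bs))
app [] (tt , y) = y
app (a ∷ as) ((i , x) , y) = i , app as (x , y)

mor-app : ∀ as {bs L} → Mor (Grid as ⊗ Grid bs) (Grid (as ++ bs)) L (app as) 0
mor-app as = record { rk-shift = λ _ → r as _ ; ⋖-pres = λ _ _ → c as ; E-refl = λ {x} {y} _ _ → e as {z = x} {y} }
  where
  r : ∀ as {bs} z → rk (Grid (as ++ bs)) (app as z) ≡ rk (Grid as ⊗ Grid bs) z
  r [] _ = refl
  r (a ∷ as) ((i , x) , y) = trans (cong (i +_) (r as (x , y))) (sym (+-assoc i _ _))
  c : ∀ as {bs z w} → _⋖_ (Grid as ⊗ Grid bs) z w → _⋖_ (Grid (as ++ bs)) (app as z) (app as w)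
  c [] (inj₂ (refl , p)) = p
  c (a ∷ as) (inj₁ (inj₁ (p , refl) , refl)) = inj₁ (p , refl)
  c (a ∷ as) (inj₁ (inj₂ (refl , p) , refl)) = inj₂ (refl , c as (inj₁ (p , refl)))
  c (a ∷ as) (inj₂ (refl , p)) = inj₂ (refl , c as (inj₂ (refl , p)))
  e : ∀ as {bs} {z w : Pt (Grid as ⊗ Grid bs)} → E (Grid (as ++ bs)) (app as z) (app as w) → E (Grid as ⊗ Grid bs) z w
  e [] p = tt , p
  e (a ∷ as) {bs} (p , q) = (p , proj₁ (e as {bs} q)) , proj₂ (e as {bs} q)

grid-app : ∀ as bs → map (app as) (prod (grid as) (grid bs)) ≡ grid (as ++ bs)
grid-app [] bs = trans (cong (map (app [] {bs})) (++-identityʳ (map (tt ,_) (grid bs)))) (trans (sym (map-∘ (grid bs))) (map-id (grid bs)))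
grid-app (a ∷ as) bs = trans (trans (map-∘ {g = map× id (app as)} {f = assocʳ} (prod (prod (full a) (grid as)) (grid bs)))
  (cong (map (map× id (app as))) (prod-assoc (full a) (grid as) (grid bs))))
  (trans (sym (prod-mapʳ (app as) (full a) (prod (grid as) (grid bs)))) (cong (prod (full a)) (grid-app as bs)))

block-app : ∀ as os es → Block (Grid as) N (grid as) →
  let bs = big os es in SCD free (Grid (as ++ bs)) (N + sum bs) (grid (as ++ bs))
block-app as os es b = dec-resp (↭-reflexive (grid-app as (big os es))) (dec-map (mor-app as) refl (block-weak b (weak os es)))

-- Forgiving one pair inside the space lets `SCD free` express the tolerance for the bottom and the
-- top of a cuboid too.
Except : (S : Space) → Pt S → Pt S → Space
Pt   (Except S s t) = Pt S
rk   (Except S s t) = rk S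
_⋖_  (Except S s t) = _⋖_ S
E    (Except S s t) x y = E S x y × ¬ (x ≡ s × y ≡ t)
⋖⇒rk (Except S s t) = ⋖⇒rk S

dec-except : ∀ {s t L} → SCD free S N L → SCD free (Except S s t) N L
dec-except {L = L} d = dec-resp (↭-reflexive (map-id L)) (dec-map
  record { rk-shift = λ _ → refl ; ⋖-pres = λ _ _ c → c ; E-refl = λ _ _ → proj₁ } refl d)

botPt topPt : ∀ as → Pt (Grid as)
botPt [] = tt
botPt (a ∷ as) = 0 , botPt as
topPt [] = tt
topPt (a ∷ as) = a , topPt as

Proper : List ℕ → Set
Proper as = SCD free (Except (Grid as) (botPt as) (topPt as)) (sum as) (grid as)

-- The exceptional chain of [a] × [b] becomes a new first factor; its ends are the ends of [a] × [b].
proper-swap : ∀ a b as → Proper (2 + a + (2 + b) ∷ as) →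
  SCD free ((Seg (2 + a) ⊗ Seg (2 + b)) ⊗ Grid as) (2 + a + (2 + b) + sum as) (prod (Swap.D₁ a b ++ Swap.R a b) (grid as)) →
  Proper (2 + a ∷ 2 + b ∷ as)
proper-swap a b as d₀ d₁ = dec-resp (↭-trans (↭-sym (↭-reflexive (map-++ assocʳ (prod D₀ (grid as)) (prod (D₁ ++ R) (grid as)))))
    (↭-trans (↭-reflexive (cong (map assocʳ) (sym (prod-++ˡ D₀ (D₁ ++ R) {grid as}))))
      (↭-trans (map⁺ assocʳ (prod-↭ˡ (grid as) (↭-sym swap↭))) (↭-reflexive (prod-assoc (full (2 + a)) (full (2 + b)) (grid as))))))
  (dec-++
    (dec-resp (↭-reflexive (trans (map-∘ {g = assocʳ} (prod (full n) (grid as))) (cong (map assocʳ)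
        (trans (sym (prod-mapˡ f (full n) (grid as))) (cong (λ L → prod L (grid as)) els≡)))))
      (dec-map outer (+-assoc (2 + a) (2 + b) (sum as)) d₀))
    (dec-map {k = 0} record { rk-shift = rk-shift mor-assoc′ ; ⋖-pres = ⋖-pres mor-assoc′ ; E-refl = λ p q e → E-refl mor-assoc′ p q (proj₁ e) }
      (+-assoc (2 + a) (2 + b) (sum as)) d₁))
  where
  open Swap a b
  n : ℕ
  n = 2 + a + (2 + b)
  mor-assoc′ : ∀ {L} → Mor ((Seg (2 + a) ⊗ Seg (2 + b)) ⊗ Grid as) (Seg (2 + a) ⊗ Seg (2 + b) ⊗ Grid as) L assocʳ 0
  mor-assoc′ = mor-assoc
  p₀ : Path (Seg (2 + a) ⊗ Seg (2 + b)) (0 , 0) (2 + a , 2 + b) D₀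
  p₀ = path₀
  n≡ : n ≡ plen p₀
  n≡ = path-rk p₀
  f : ℕ → ℕ × ℕ
  f = pfun p₀
  els≡ : map f (full n) ≡ D₀
  els≡ = trans (cong (λ m → map f (full m)) n≡) (pfun-els p₀)
  mor₀ : Mor (Seg n) (Seg (2 + a) ⊗ Seg (2 + b)) (full n) f 0
  mor₀ = pathMor p₀ n≡ λ x y e → [ inj₁ , (λ { (s , t) → inj₂ (s , t , refl) }) ]′ (weak₀ x y e)
  inner′ : Mor (Seg n ⊗ Grid as) (Seg (2 + a) ⊗ Seg (2 + b) ⊗ Grid as) (prod (full n) (grid as)) (assocʳ ∘ map× f id) 0
  inner′ = mor-∘ mor-assoc′ (mor-⊗ {L = full n} {K = grid as} mor₀ mor-id)
  outer : Mor (Except (Grid (n ∷ as)) (botPt (n ∷ as)) (topPt (n ∷ as)))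
    (Except (Grid (2 + a ∷ 2 + b ∷ as)) (botPt (2 + a ∷ 2 + b ∷ as)) (topPt (2 + a ∷ 2 + b ∷ as))) (prod (full n) (grid as)) (assocʳ ∘ map× f id) 0
  rk-shift outer = rk-shift inner′
  ⋖-pres outer = ⋖-pres inner′
  E-refl outer p q (e , h) = E-refl inner′ p q e , λ { (refl , refl) → h
    (cong assocʳ (cong (_, botPt as) (pfun-0 p₀)) , cong assocʳ (cong (_, topPt as) (trans (cong f n≡) (pfun-end p₀)))) }

-- The part of the rectangle outside the exceptional chain. The side `4 + a` leaves [2 + a] × [b]
-- inside the hooks, whose first factor is long enough for a block.
block-inner : ∀ a b → Block (Seg (4 + a) ⊗ Seg (2 + b)) (4 + a + (2 + b)) (Swap.D₁ (2 + a) b ++ Swap.R (2 + a) b)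
block-inner a b = block-++ (block-path path₁ free₁ (s≤s (s≤s (s≤s z≤n))) rk₁)
    (block-resp (↭-reflexive rest≡) (block-map rest rkᵣ (block-×ʳ (block-seg a) (dec-seg b))))
  where
  open Swap (2 + a) b
  open SwapFree (2 + a) b

-- Induction on the remaining factors: each is merged into the first, whose length only grows and so
-- stays at least 4. In the end a single segment is left, and its only bad pair is the forgiven one.
proper-long : ∀ a os es → Proper (4 + a ∷ big os es)
proper-long a [] [] = dec-resp (↭-reflexive (prod-unitʳ (full (4 + a)))) (dec-map
  record { rk-shift = λ _ → +-identityʳ _ ; ⋖-pres = λ _ _ c → inj₁ (c , refl)
         ; E-refl = λ { p q ((inj₁ e , _) , h) → inj₁ e ; p q ((inj₂ (refl , refl) , _) , h) → ⊥-elim (h (refl , refl)) } }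
  (sym (+-identityʳ (4 + a))) (dec-seg (4 + a)))
proper-long a (o ∷ os) es = proper-swap (2 + a) (suc (double o)) (big os es)
  (subst (λ n → Proper (4 + n ∷ big os es)) (+-comm (od o) a) (proper-long (od o + a) os es))
  (block-weak (block-inner a (suc (double o))) (weak os es))
proper-long a [] (e ∷ es) = proper-swap (2 + a) (double e) (big [] es)
  (subst (λ n → Proper (4 + n ∷ big [] es)) (+-comm (ev e) a) (proper-long (ev e + a) [] es))
  (block-weak (block-inner a (double e)) (weak [] es))

-- `rearrange-mor` holds on every list, so that `reorder` can apply it to just the points at hand.
-- The ends are tracked because the forgiven pair has to go to the forgiven pair.
record Reordering (as bs : List ℕ) : Set where
  field
    rearrange   : Pt (Grid as) → Pt (Grid bs)
    rearrange-mor   : ∀ {L} → Mor (Grid as) (Grid bs) L rearrange 0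
    rearrange-onto  : map rearrange (grid as) ↭ grid bs
    bot≡  : rearrange (botPt as) ≡ botPt bs
    top≡  : rearrange (topPt as) ≡ topPt bs

open Reordering

reorder : ∀ {as bs} → as ↭ bs → Reordering as bs
reorder {as} _↭_.refl = record { rearrange = id ; rearrange-mor = mor-id ; rearrange-onto = ↭-reflexive (map-id _) ; bot≡ = refl ; top≡ = refl }
reorder {a ∷ as} {_ ∷ bs} (prep a p) = let r = reorder p in record
  { rearrange = map× id (rearrange r)
  ; rearrange-mor = record
    { rk-shift = λ { {i , x} _ → cong (i +_) (rk-shift (rearrange-mor r {[ x ]}) (here refl)) }
    ; ⋖-pres = λ { {i , x} {j , y} _ _ (inj₁ (c , refl)) → inj₁ (c , refl)
                 ; {i , x} {j , y} _ _ (inj₂ (refl , c)) → inj₂ (refl , ⋖-pres (rearrange-mor r {x ∷ y ∷ []}) (here refl) (there (here refl)) c) }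
    ; E-refl = λ { {i , x} {j , y} _ _ (e , f) → e , E-refl (rearrange-mor r {x ∷ y ∷ []}) (here refl) (there (here refl)) f } }
  ; rearrange-onto = ↭-trans (↭-reflexive (sym (prod-mapʳ (rearrange r) (full a) (grid as)))) (prod-↭ʳ (full a) (rearrange-onto r))
  ; bot≡ = cong (0 ,_) (bot≡ r) ; top≡ = cong (a ,_) (top≡ r) }
reorder {a ∷ b ∷ as} {b ∷ a ∷ bs} (swap a b p) = let r = reorder p in record
  { rearrange = λ { (i , j , x) → j , i , rearrange r x }
  ; rearrange-mor = record
    { rk-shift = λ { {i , j , x} _ → trans (cong (λ n → j + (i + n)) (rk-shift (rearrange-mor r {[ x ]}) (here refl))) (lem i j (rk (Grid as) x)) }
    ; ⋖-pres = λ { _ _ (inj₁ (c , refl)) → inj₂ (refl , inj₁ (c , refl))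
                 ; _ _ (inj₂ (refl , inj₁ (c , refl))) → inj₁ (c , refl)
                 ; {i , j , x} {_ , _ , y} _ _ (inj₂ (refl , inj₂ (refl , c))) → inj₂ (refl , inj₂ (refl , ⋖-pres (rearrange-mor r {x ∷ y ∷ []}) (here refl) (there (here refl)) c)) }
    ; E-refl = λ { {i , j , x} {_ , _ , y} _ _ (e , f , g) → f , e , E-refl (rearrange-mor r {x ∷ y ∷ []}) (here refl) (there (here refl)) g } }
  ; rearrange-onto = onto′ (rearrange r) (rearrange-onto r)
  ; bot≡ = cong (λ x → 0 , 0 , x) (bot≡ r) ; top≡ = cong (λ x → b , a , x) (top≡ r) }
  where
  lem : ∀ i j n → j + (i + n) ≡ i + (j + n)
  lem = solve-∀
  onto′ : ∀ f → map f (grid as) ↭ grid bs → map (λ { (i , j , x) → j , i , f x }) (grid (a ∷ b ∷ as)) ↭ grid (b ∷ a ∷ bs)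
  onto′ f p = ↭-trans (↭-reflexive (trans (cong (map _) (sym (prod-assoc (full a) (full b) (grid as))))
      (trans (sym (map-∘ (prod (prod (full a) (full b)) (grid as)))) (trans (map-∘ {g = assocʳ} {f = map× ×.swap f} (prod (prod (full a) (full b)) (grid as)))
        (cong (map assocʳ) (sym (prod-map ×.swap f (prod (full a) (full b)) (grid as))))))))
    (↭-trans (map⁺ assocʳ (↭-trans (prod-↭ˡ _ (prod-swap (full a) (full b))) (prod-↭ʳ (prod (full b) (full a)) p)))
      (↭-reflexive (prod-assoc (full b) (full a) (grid bs))))
reorder (_↭_.trans p q) = let r = reorder p ; s = reorder q in record
  { rearrange = rearrange s ∘ rearrange r ; rearrange-mor = mor-∘ (rearrange-mor s) (rearrange-mor r)
  ; rearrange-onto = ↭-trans (↭-trans (↭-reflexive (map-∘ _)) (map⁺ (rearrange s) (rearrange-onto r))) (rearrange-onto s)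
  ; bot≡ = trans (cong (rearrange s) (bot≡ r)) (bot≡ s) ; top≡ = trans (cong (rearrange s) (top≡ r)) (top≡ s) }

FreeSCD : List ℕ → Set
FreeSCD as = SCD free (Grid as) (sum as) (grid as)

freeSCD-↭ : ∀ {as bs : List ℕ} → as ↭ bs → FreeSCD as → FreeSCD bs
freeSCD-↭ p d = let r = reorder p in dec-resp (rearrange-onto r) (dec-map (rearrange-mor r) (sum-↭ p) d)

proper-↭ : ∀ {as bs} → as ↭ bs → Proper as → Proper bs
proper-↭ p d = let r = reorder p in dec-resp (rearrange-onto r) (dec-map {k = 0} record
  { rk-shift = rk-shift (rearrange-mor r) ; ⋖-pres = ⋖-pres (rearrange-mor r)
  ; E-refl = λ x y (e , h) → E-refl (rearrange-mor r) x y e , λ { (refl , refl) → h (bot≡ r , top≡ r) } } (sum-↭ p) d)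

freeSCD⇒proper : ∀ as → FreeSCD as → Proper as
freeSCD⇒proper as = dec-except

freeSCD-ones : ∀ u {as} → FreeSCD as → FreeSCD (replicate u 1 ++ as)
freeSCD-ones zero d = d
freeSCD-ones (suc u) {as} d = dec-× (dec-seg 1) (freeSCD-ones u {as} d)

freeSCD-1ab : ∀ a b os es → FreeSCD (1 ∷ od a ∷ od b ∷ big os es)
freeSCD-1ab (suc a) b os es = dec-N (lem (double a) (double b) (sum (big os es)))
  (block-app (1 ∷ od (suc a) ∷ od b ∷ []) os es (block-1ab (double a) (double b)))
  where
  lem : ∀ a b s → 9 + a + b + s ≡ 1 + (5 + a + (3 + b + s))
  lem = solve-∀
freeSCD-1ab zero (suc b) os es = freeSCD-↭ {as = 1 ∷ od (suc b) ∷ od zero ∷ big os es} (prep 1 (swap _ _ ↭-refl)) (freeSCD-1ab (suc b) zero os es)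
freeSCD-1ab zero zero os es = block-app as₁₃₃ os es block-133

proper-odd : ∀ a b c d os es → Proper (od a ∷ od b ∷ big (c ∷ d ∷ os) es)
proper-odd (suc a) b c d os es = proper-long (1 + double a) (b ∷ c ∷ d ∷ os) es
proper-odd zero (suc b) c d os es = proper-↭ {as = od (suc b) ∷ od zero ∷ big (c ∷ d ∷ os) es} (swap _ _ ↭-refl) (proper-odd (suc b) zero c d os es)
-- Sides 3 and 3 leave [1]² inside the hooks, which is too short for a block; together with the odd
-- sides of `c` and `d` it falls under the case of a side 1.
proper-odd zero zero c d os es = proper-swap 1 1 xs (proper-long 2 (c ∷ d ∷ os) es)
  (dec-resp (↭-reflexive (sym (prod-++ˡ D₁ R {grid xs})))
    (dec-++ (block-weak (block-path path₁ free₁ (s≤s (s≤s (s≤s z≤n))) refl) (weak (c ∷ d ∷ os) es))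
      (dec-resp (↭-reflexive (trans (sym (prod-mapˡ (map× id (2 +_)) (prod (full 1) (full 1)) (grid xs))) (cong (λ L → prod L (grid xs)) rest≡)))
        (dec-map (mor-⊗ {L = prod (full 1) (full 1)} {K = grid xs} rest mor-id) refl
          (dec-resp (↭-reflexive (prod-assocˡ (full 1) (full 1) (grid xs))) (dec-map mor-assocˡ refl (freeSCD-ones 1 {1 ∷ xs} (freeSCD-1ab c d os es))))))))
  where
  open Swap 1 1
  open SwapFree 1 1 using (rest≡)
  xs : List ℕ
  xs = big (c ∷ d ∷ os) es

push : ∀ u xs → replicate u 1 ++ 1 ∷ xs ↭ replicate (suc u) 1 ++ xs
push u xs = shift 1 (replicate u 1) xs

five-ones : ∀ u os es → 4 ≤ u → Proper (1 ∷ replicate u 1 ++ big os es)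
five-ones (suc (suc (suc (suc u)))) os es (s≤s (s≤s (s≤s (s≤s _)))) =
  freeSCD⇒proper (1 ∷ replicate (4 + u) 1 ++ big os es) (freeSCD-↭ (shifts (replicate u 1) as₁₁₁₁₁ {big os es}) (freeSCD-ones u {as₁₁₁₁₁ ++ big os es} (block-app as₁₁₁₁₁ os es block-11111)))

proper-ones : ∀ u os es → 6 ≤ u + length os → Proper (replicate u 1 ++ big os es)
proper-ones zero (a ∷ b ∷ c ∷ d ∷ os) es _ = proper-odd a b c d os es
proper-ones zero (_ ∷ _ ∷ _ ∷ []) es (s≤s (s≤s (s≤s ())))
proper-ones zero (_ ∷ _ ∷ []) es (s≤s (s≤s ()))
proper-ones zero (_ ∷ []) es (s≤s ())
proper-ones zero [] es ()
proper-ones (suc u) (a ∷ b ∷ os) es _ = freeSCD⇒proper (replicate (suc u) 1 ++ big (a ∷ b ∷ os) es) (freeSCD-↭ (push u (big (a ∷ b ∷ os) es)) (freeSCD-ones u {1 ∷ big (a ∷ b ∷ os) es} (freeSCD-1ab a b os es)))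
proper-ones (suc u) os@[] es l = five-ones u os es (+-cancelʳ-≤ 1 _ _ (≤-trans (≤-pred l) (+-monoʳ-≤ u z≤n)))
proper-ones (suc u) os@(_ ∷ []) es l = five-ones u os es (+-cancelʳ-≤ 1 _ _ (≤-pred l))

-- Sorting the sides of a cuboid

parity : ∀ n → (∃[ m ] n ≡ double m) ⊎ (∃[ m ] n ≡ suc (double m))
parity zero = inj₁ (0 , refl)
parity (suc n) with parity n
... | inj₁ (m , refl) = inj₂ (m , refl)
... | inj₂ (m , refl) = inj₁ (suc m , refl)

double%2 : ∀ m → double m % 2 ≡ 0
double%2 zero = refl
double%2 (suc m) = double%2 m

suc-double%2 : ∀ m → suc (double m) % 2 ≡ 1
suc-double%2 zero = refl
suc-double%2 (suc m) = suc-double%2 m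

numOdd-double : ∀ m as → numOdd (double m ∷ as) ≡ numOdd as
numOdd-double m as = cong length (filter-reject (λ n → n % 2 ≟ 1) {double m} {as} λ e → 0≢1+n (trans (sym (double%2 m)) e))

numOdd-suc-double : ∀ m as → numOdd (suc (double m) ∷ as) ≡ suc (numOdd as)
numOdd-suc-double m as = cong length (filter-accept (λ n → n % 2 ≟ 1) {suc (double m)} {as} (suc-double%2 m))

sorted : ∀ as → ∃[ z ] ∃[ u ] ∃[ os ] ∃[ es ] (as ↭ replicate z 0 ++ replicate u 1 ++ big os es × numOdd as ≡ u + length os)
sorted [] = 0 , 0 , [] , [] , ↭-refl , refl
sorted (a ∷ as) with parity a | sorted as
... | inj₁ (zero , refl) | z , u , os , es , p , n = suc z , u , os , es , prep 0 p , trans (numOdd-double 0 as) n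
... | inj₁ (suc m , refl) | z , u , os , es , p , n = z , u , os , m ∷ es ,
      ↭-trans (prep _ p) (↭-trans (insert (replicate z 0)) (++⁺ˡ (replicate z 0) (↭-trans (insert (replicate u 1)) (++⁺ˡ (replicate u 1) (insert (map od os)))))) ,
      trans (numOdd-double (suc m) as) n
  where
  insert : ∀ {x} ys {zs : List ℕ} → x ∷ ys ++ zs ↭ ys ++ x ∷ zs
  insert ys = ↭-sym (shift _ ys _)
... | inj₂ (zero , refl) | z , u , os , es , p , n = z , suc u , os , es ,
      ↭-trans (prep 1 p) (↭-sym (shift 1 (replicate z 0) _)) , trans (numOdd-suc-double 0 as) (cong suc n)
... | inj₂ (suc m , refl) | z , u , os , es , p , n = z , u , m ∷ os , es ,
      ↭-trans (prep _ p) (↭-trans (↭-sym (shift _ (replicate z 0) _)) (++⁺ˡ (replicate z 0) (↭-sym (shift _ (replicate u 1) _)))) ,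
      trans (numOdd-suc-double (suc m) as) (trans (cong suc n) (sym (+-suc u (length os))))

proper-zeros : ∀ z as → Proper as → Proper (replicate z 0 ++ as)
proper-zeros zero as d = d
proper-zeros (suc z) as d = dec-resp (↭-reflexive (sym (++-identityʳ _))) (dec-map record
  { rk-shift = λ _ → refl ; ⋖-pres = λ _ _ c → inj₂ (refl , c)
  ; E-refl = λ { _ _ ((_ , e) , h) → e , λ { (refl , refl) → h (refl , refl) } } } refl (proper-zeros z as d))

proper-six-odd : ∀ as → 6 ≤ numOdd as → Proper as
proper-six-odd as l with sorted as
... | z , u , os , es , p , n = proper-↭ (↭-sym p) (proper-zeros z (replicate u 1 ++ big os es) (proper-ones u os es (≤-trans l (≤-reflexive n))))

-- From segments to cubes

∣++∣ : ∀ {m n} (x : Subset m) (y : Subset n) → ∣ x Vec.++ y ∣ ≡ ∣ x ∣ + ∣ y ∣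
∣++∣ Vec.[] y = refl
∣++∣ (inside Vec.∷ x) y = cong suc (∣++∣ x y)
∣++∣ (outside Vec.∷ x) y = ∣++∣ x y

++-⊆ : ∀ {m n} {x x′ : Subset m} {y y′ : Subset n} → x ⊆ x′ → y ⊆ y′ → x Vec.++ y ⊆ x′ Vec.++ y′
++-⊆ {x = Vec.[]} {Vec.[]} p q = q
++-⊆ {x = _ Vec.∷ _} {_ Vec.∷ _} p q Vec.here with p Vec.here
... | Vec.here = Vec.here
++-⊆ {x = _ Vec.∷ _} {_ Vec.∷ _} p q (Vec.there i) = Vec.there (++-⊆ (drop-∷-⊆ p) q i)

++-⊆⁻ : ∀ {m n} (x x′ : Subset m) {y y′ : Subset n} → x Vec.++ y ⊆ x′ Vec.++ y′ → x ⊆ x′ × y ⊆ y′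
++-⊆⁻ Vec.[] Vec.[] p = (λ ()) , p
++-⊆⁻ (s Vec.∷ x) (s′ Vec.∷ x′) p with ++-⊆⁻ x x′ (drop-∷-⊆ p)
... | a , b = head , b
  where
  head : s Vec.∷ x ⊆ s′ Vec.∷ x′
  head Vec.here with p Vec.here
  ... | Vec.here = Vec.here
  head (Vec.there i) = Vec.there (a i)

take-++ : ∀ {m n} (x : Subset m) (y : Subset n) → Vec.take m (x Vec.++ y) ≡ x
take-++ {m} x y = VecP.++-injectiveˡ _ _ (VecP.take++drop≡id m (x Vec.++ y))

drop-++ : ∀ {m n} (x : Subset m) (y : Subset n) → Vec.drop m (x Vec.++ y) ≡ y
drop-++ {m} x y = VecP.++-injectiveʳ _ _ (VecP.take++drop≡id m (x Vec.++ y))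

Cube : ℕ → Space
Pt   (Cube n) = Subset n
rk   (Cube n) = ∣_∣
_⋖_  (Cube n) x y = x ⊆ y × ∣ y ∣ ≡ suc ∣ x ∣
E    (Cube n) x y = x ≡ y ⊎ (x ≡ ∅ × y ≡ ⊤ˢ)
⋖⇒rk (Cube n) = proj₂

-- Subsets of a disjoint union of blocks; a pair is bad when it changes some blocks, each from ∅ to the full block.
Blocks : List ℕ → Space
Pt   (Blocks ns) = Subset (sum ns)
rk   (Blocks ns) = ∣_∣
_⋖_  (Blocks ns) x y = x ⊆ y × ∣ y ∣ ≡ suc ∣ x ∣
E    (Blocks ns) x y = ∀ i → E (Cube (lookup ns i)) (block ns x i) (block ns y i)
⋖⇒rk (Blocks ns) = proj₂

mor-++ : ∀ {n ns L} → Mor (Cube n ⊗ Blocks ns) (Blocks (n ∷ ns)) L (λ (x , y) → x Vec.++ y) 0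
rk-shift mor-++ {x , y} _ = ∣++∣ x y
⋖-pres mor-++ {x , y} {x′ , _} _ _ (inj₁ ((p , q) , refl)) = ++-⊆ p ⊆-refl , trans (∣++∣ x′ y) (trans (cong (_+ ∣ y ∣) q) (cong suc (sym (∣++∣ x y))))
⋖-pres mor-++ {x , y} {_ , y′} _ _ (inj₂ (refl , (p , q))) = ++-⊆ {x = x} ⊆-refl p , trans (∣++∣ x y′) (trans (cong (∣ x ∣ +_) q) (trans (+-suc ∣ x ∣ ∣ y ∣) (cong suc (sym (∣++∣ x y)))))
E-refl (mor-++ {n} {ns}) {x , y} {x′ , y′} _ _ e =
  subst₂ (E (Cube n)) (take-++ x y) (take-++ x′ y′) (e Fin.zero) ,
  λ i → subst₂ (λ u v → E (Cube (lookup ns i)) (block ns u i) (block ns v i)) (drop-++ x y) (drop-++ x′ y′) (e (Fin.suc i))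

applyUpTo≡rng : ∀ j n → applyUpTo (j +_) n ≡ rng j n
applyUpTo≡rng j n = trans (go (j +_) n) (trans (rng-shift j 0 n) (cong (λ i → rng i n) (+-identityʳ j)))
  where
  go : ∀ (f : ℕ → ℕ) n → applyUpTo f n ≡ map f (rng 0 n)
  go f zero = refl
  go f (suc n) = cong (f 0 ∷_) (trans (go (f ∘ suc) n) (sym (map-rng-suc f 0 n)))

private
  path-from : ∀ {n} j m x (C : Chain n) → map ∣_∣ (x ∷ C) ≡ rng j (suc m) → Linked _⊆_ (x ∷ C) → ∃[ t ] Σ (Path (Cube n) x t (x ∷ C)) λ p → plen p ≡ m
  path-from j zero x [] e _ = x , one , refl
  path-from j (suc m) x (y ∷ C) e (s ∷ l) with path-from (suc j) m y C (∷-injectiveʳ e) l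
  ... | t , p , q = t , cons (s , trans (∷-injectiveˡ (∷-injectiveʳ e)) (cong suc (sym (∷-injectiveˡ e)))) p , cong suc q
  path-from j zero x (y ∷ C) () _
  path-from j (suc m) x [] () _

∈-path : ∀ {s t L x} (p : Path S s t L) → x ∈ L → ∃[ i ] i ≤ plen p × x ≡ pfun p i
∈-path one (here refl) = 0 , z≤n , refl
∈-path (cons c p) (here refl) = 0 , z≤n , refl
∈-path (cons c p) (there x∈) with ∈-path p x∈
... | i , l , e = suc i , s≤s l , e

record Coordinate {n : ℕ} (C : Chain n) : Set where
  field
    size   : ℕ
    coord    : ℕ → Subset n
    floor   : ℕ
    coord-mor    : Mor (Seg (top size)) (Cube n) (full size) coord floor
    listed : map coord (full size) ≡ C
    balanced   : floor + floor + size ≡ n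

-- Here `n ≥ 2` enters: a chain through ∅ and the whole set has length `n`, so `top` marks its
-- segment. By rank, these two sets can only be its first and last elements.
coordinate : ∀ {n} → 2 ≤ n → (C : Chain n) → IsSymmetricChain n C → Coordinate C
coordinate {n} 2≤n [] (j , _ , () , _)
coordinate {n} 2≤n (x ∷ C) (j , l , r , c) with path-from j (n ∸ 2 * j) x C (trans r (applyUpTo≡rng j _)) c
... | t , p , q = record { size = plen p ; coord = pfun p ; floor = ∣ x ∣ ; coord-mor = pathMor p refl weak′ ; listed = pfun-els p
                         ; balanced = total }
  where
  rx : ∣ x ∣ ≡ j
  rx = trans (∷-injectiveˡ r) (+-identityʳ j)
  total : ∣ x ∣ + ∣ x ∣ + plen p ≡ n
  total = trans (cong₂ _+_ (trans (cong (λ k → k + k) rx) (cong (j +_) (sym (+-identityʳ j)))) q) (m+[n∸m]≡n l)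
  weak′ : ∀ {y z} → y ∈ x ∷ C → z ∈ x ∷ C → E (Cube n) y z → y ≡ z ⊎ (y ≡ x × z ≡ t × top (plen p) ≡ plen p)
  weak′ _ _ (inj₁ e) = inj₁ e
  weak′ y∈ z∈ (inj₂ (refl , refl)) with ∈-path p y∈ | ∈-path p z∈
  ... | i , i≤ , y≡ | k , k≤ , z≡ = inj₂ (trans y≡ (trans (cong (pfun p) i≡0) (pfun-0 p)) , trans z≡ (trans (cong (pfun p) k≡) (pfun-end p)) , tp (subst (2 ≤_) (sym len≡) 2≤n))
    where
    bottom : ∣ x ∣ + i ≡ 0
    bottom = trans (sym (pfun-rk p i≤)) (trans (cong ∣_∣ (sym y≡)) (∣⊥∣≡0 n))
    i≡0 : i ≡ 0
    i≡0 = m+n≡0⇒n≡0 ∣ x ∣ bottom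
    x≡0 : ∣ x ∣ ≡ 0
    x≡0 = m+n≡0⇒m≡0 ∣ x ∣ bottom
    len≡ : plen p ≡ n
    len≡ = trans (cong (λ k → k + k + plen p) (sym x≡0)) total
    k≡ : k ≡ plen p
    k≡ = trans (cong (_+ k) (sym x≡0)) (trans (sym (pfun-rk p k≤)) (trans (cong ∣_∣ (sym z≡)) (trans (∣⊤∣≡n n) (sym len≡))))
    tp : ∀ {n} → 2 ≤ n → top n ≡ n
    tp (s≤s (s≤s _)) = refl

-- Cuboids and their refinement into chains

Families : List ℕ → Set
Families ns = (i : Fin (length ns)) → List (Chain (lookup ns i))

-- `end-points` prepares the use of goodness: a coordinate that agrees at both ends of the cuboid
-- comes from a one-element chain.
record Cuboid (ns : List ℕ) (G : Families ns) : Set where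
  field
    A     : ∀ i → Chain (lookup ns i)
    A∈    : ∀ i → A i ∈ G i
    as    : List ℕ
    φ     : Pt (Grid as) → Subset (sum ns)
    shft  : ℕ
    φ-mor : Mor (Grid as) (Blocks ns) (grid as) φ shft
    total : shft + shft + sum as ≡ sum ns
    odds  : numOdd as ≡ numOdd ns
    inA   : ∀ {x} → x ∈ grid as → ∀ i → block ns (φ x) i ∈ A i
    end-points  : ∀ i → block ns (φ (botPt as)) i ≡ block ns (φ (topPt as)) i → A i ≡ [ block ns (φ (botPt as)) i ]

open Cuboid

points : ∀ {ns G} → Cuboid ns G → List (Subset (sum ns))
points c = map (φ c) (grid (as c))

glue : ∀ {m n} → Subset m × Subset n → Subset (m + n)
glue (x , y) = x Vec.++ y

double-+ : ∀ b m → b + b + double m ≡ double (b + m)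
double-+ zero m = refl
double-+ (suc b) m = cong suc (trans (cong (_+ double m) (+-suc b b)) (cong suc (double-+ b m)))

-- A symmetric chain with lowest rank `b` has `n - 2b` steps, so each side has the parity of its `n`
-- and every cuboid inherits the six odd sides.
numOdd-∷ : ∀ b a {n as ns} → b + b + a ≡ n → numOdd as ≡ numOdd ns → numOdd (a ∷ as) ≡ numOdd (n ∷ ns)
numOdd-∷ b a {as = as} {ns} refl e with parity a
... | inj₁ (m , refl) = trans (numOdd-double m as) (trans e (sym (trans (cong (λ n → numOdd (n ∷ ns)) (double-+ b m)) (numOdd-double (b + m) ns))))
... | inj₂ (m , refl) = trans (numOdd-suc-double m as) (trans (cong suc e) (sym (trans
      (cong (λ n → numOdd (n ∷ ns)) (trans (+-suc (b + b) (double m)) (cong suc (double-+ b m)))) (numOdd-suc-double (b + m) ns))))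

cuboid-∷ : ∀ {n ns} {G : Families (n ∷ ns)} {C} → C ∈ G Fin.zero → Coordinate C → Cuboid ns (G ∘ Fin.suc) → Cuboid (n ∷ ns) G
cuboid-∷ {n} {ns} {G} {C} C∈ co c = record
  { A = λ { Fin.zero → C ; (Fin.suc i) → A c i }
  ; A∈ = λ { Fin.zero → C∈ ; (Fin.suc i) → A∈ c i }
  ; as = size ∷ as c
  ; φ = glue ∘ map× coord (φ c)
  ; shft = floor + shft c
  ; φ-mor = mor-∘ mor-++ (mor-⊗ {L = full size} {K = grid (as c)} coord-mor (φ-mor c))
  ; total = trans (lem floor (shft c) size (sum (as c))) (cong₂ _+_ balanced (total c))
  ; odds = numOdd-∷ floor size balanced (odds c)
  ; inA = λ { {i , x} p Fin.zero → subst (_∈ C) (sym (take-++ (coord i) (φ c x)))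
                (subst (coord i ∈_) listed (∈-map⁺ coord (proj₁ (∈-cartesianProduct⁻ (full size) (grid (as c)) p))))
            ; {i , x} p (Fin.suc j) → subst (λ z → block ns z j ∈ A c j) (sym (drop-++ (coord i) (φ c x)))
                (inA c (proj₂ (∈-cartesianProduct⁻ (full size) (grid (as c)) p)) j) }
  ; end-points = λ { Fin.zero e → single (trans (sym (take-++ (coord 0) (φ c (botPt (as c))))) (trans e (take-++ (coord size) (φ c (topPt (as c))))))
             ; (Fin.suc j) e → trans (end-points c j (trans (cong (λ z → block ns z j) (sym (drop-++ (coord 0) (φ c (botPt (as c))))))
                 (trans e (cong (λ z → block ns z j) (drop-++ (coord size) (φ c (topPt (as c))))))))
                 (cong (λ z → [ block ns z j ]) (sym (drop-++ (coord 0) (φ c (botPt (as c))))) ) }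
  }
  where
  open Coordinate co
  lem : ∀ b s a t → b + s + (b + s) + (a + t) ≡ b + b + a + (s + s + t)
  lem = solve-∀
  size∈ : ∀ a → a ∈ full a
  size∈ a = subst (a ∈_) (sym (rng-∷ʳ 0 a)) (∈-++⁺ʳ (rng 0 a) (here refl))
  single : coord 0 ≡ coord size → C ≡ [ Vec.take n (coord 0 Vec.++ φ c (botPt (as c))) ]
  single e = trans (trans (sym listed) (cong (λ a → map coord (full a)) size≡0)) (cong [_] (sym (take-++ (coord 0) (φ c (botPt (as c))))))
    where
    size≡0 : size ≡ 0
    size≡0 = +-cancelˡ-≡ floor _ _ (trans (sym (rk-shift coord-mor (size∈ size))) (trans (cong ∣_∣ (sym e)) (rk-shift coord-mor (here refl))))

-- The whole cube in the order given by the families. Completeness and absence of repetitions are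
-- shown factor by factor and reach the refined chains through a permutation.
universe : ∀ ns → Families ns → List (Subset (sum ns))
universe [] G = [ Vec.[] ]
universe (n ∷ ns) G = map glue (prod (concat (G Fin.zero)) (universe ns (G ∘ Fin.suc)))

module _ where
  private
    points-∷ : ∀ {n ns} {G : Families (n ∷ ns)} {C} (C∈ : C ∈ G Fin.zero) (co : Coordinate C) (cs : List (Cuboid ns (G ∘ Fin.suc))) →
      concatMap points (map (cuboid-∷ {G = G} C∈ co) cs) ↭ map glue (prod C (concatMap points cs))
    points-∷ {C = C} C∈ co [] = ↭-reflexive (sym (cong (map glue) (cartesianProductWith-zeroʳ _,_ C)))
    points-∷ {G = G} {C} C∈ co (c ∷ cs) = ↭-trans (++⁺ (↭-reflexive one′) (points-∷ {G = G} C∈ co cs))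
      (↭-trans (↭-reflexive (sym (map-++ glue (prod C (points c)) _))) (map⁺ glue (↭-sym (prod-++ʳ C (points c) (concatMap points cs)))))
      where
      open Coordinate co
      one′ : map (glue ∘ map× coord (φ c)) (prod (full size) (grid (as c))) ≡ map glue (prod C (points c))
      one′ = trans (map-∘ (prod (full size) (grid (as c)))) (cong (map glue) (trans (sym (prod-map coord (φ c) (full size) (grid (as c)))) (cong (λ L → prod L (points c)) listed)))

  cuboids : ∀ ns (G : Families ns) → (∀ i → 2 ≤ lookup ns i) → (∀ i C → C ∈ G i → IsSymmetricChain (lookup ns i) C) →
    ∃[ cs ] concatMap (points {ns} {G}) cs ↭ universe ns G
  cuboids [] G _ _ = [ record
    { A = λ () ; A∈ = λ () ; as = [] ; φ = λ _ → Vec.[] ; shft = 0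
    ; φ-mor = record { rk-shift = λ _ → refl ; ⋖-pres = λ _ _ () ; E-refl = λ _ _ _ → tt }
    ; total = refl ; odds = refl ; inA = λ _ () ; end-points = λ () } ] , ↭-refl
  cuboids (n ∷ ns) G h s with cuboids ns (G ∘ Fin.suc) (h ∘ Fin.suc) (s ∘ Fin.suc)
  ... | cs , p = go (G Fin.zero) id
    where
    go : ∀ L → (∀ {C} → C ∈ L → C ∈ G Fin.zero) → ∃[ ds ] concatMap (points {n ∷ ns} {G}) ds ↭ map glue (prod (concat L) (universe ns (G ∘ Fin.suc)))
    go [] i = [] , ↭-refl
    go (C ∷ L) i with go L (i ∘ there)
    ... | ds , q = map (cuboid-∷ {G = G} C∈ co) cs ++ ds ,
        ↭-trans (↭-reflexive (concatMap-++ points (map (cuboid-∷ {G = G} C∈ co) cs) ds))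
        (↭-trans (++⁺ (↭-trans (points-∷ {G = G} C∈ co cs) (map⁺ glue (prod-↭ʳ C p))) q)
        (↭-reflexive (trans (sym (map-++ glue (prod C _) _)) (cong (map glue) (sym (prod-++ˡ C (concat L)))))))
      where
      C∈ = i (here refl)
      co = coordinate (h Fin.zero) C (s Fin.zero C C∈)

-- The second alternative of `proper` is the tolerated pair. It is phrased by blocks because it is
-- used to turn an unchanged block into a one-element chain.
record Fits (ns : List ℕ) (G : Families ns) (C : Chain (sum ns)) : Set where
  field
    symm   : IsSymmetricChain (sum ns) C
    A      : ∀ i → Chain (lookup ns i)
    A∈     : ∀ i → A i ∈ G i
    within : ∀ {x} → x ∈ C → ∀ i → block ns x i ∈ A i
    proper : ∀ {x y} → x ∈ C → y ∈ C → E (Blocks ns) x y →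
             x ≡ y ⊎ (∀ i → block ns x i ≡ block ns y i → A i ≡ [ block ns x i ])

linked-rng : ∀ {A : Set} {R : A → A → Set} (g : ℕ → A) s n → (∀ {i} → i ∈ rng s n → suc i ∈ rng s n → R (g i) (g (suc i))) → Linked R (map g (rng s n))
linked-rng g s zero h = []
linked-rng g s (suc zero) h = [-]
linked-rng g s (suc (suc n)) h = h (here refl) (there (here refl)) ∷ linked-rng g (suc s) (suc n) (λ i j → h (there i) (there j))

module _ {ns : List ℕ} {G : Families ns} (six : 6 ≤ numOdd ns) where
  private
    chains : (c : Cuboid ns G) → Proper (as c)
    chains c = proper-six-odd (as c) (subst (6 ≤_) (sym (odds c)) six)

    fits : (c : Cuboid ns G) (d : Chn free (Except (Grid (as c)) (botPt (as c)) (topPt (as c))) (sum (as c))) →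
      (∀ {x} → x ∈ els d → x ∈ grid (as c)) → Fits ns G (map (φ c) (els d))
    fits c d i = record { symm = j , j+j≤ , ranks≡ , linked ; A = A c ; A∈ = A∈ c ; within = within′ ; proper = proper′ }
      where
      g : ℕ → Subset (sum ns)
      g = φ c ∘ at d
      j = shft c + base d
      in-grid : ∀ {u} → u ∈ full (len d) → at d u ∈ grid (as c)
      in-grid u = i (∈-map⁺ (at d) u)
      g≡ : map (φ c) (els d) ≡ map g (full (len d))
      g≡ = sym (map-∘ (full (len d)))
      N≡ : 2 * j + len d ≡ sum ns
      N≡ = trans (lem (shft c) (base d) (len d)) (trans (cong (shft c + shft c +_) (centred d)) (total c))
        where lem : ∀ s b l → 2 * (s + b) + l ≡ s + s + (b + b + l)
              lem = solve-∀
      j+j≤ : 2 * j ≤ sum ns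
      j+j≤ = subst (2 * j ≤_) N≡ (m≤m+n (2 * j) (len d))
      ranks≡ : map ∣_∣ (map (φ c) (els d)) ≡ applyUpTo (j +_) (suc (sum ns ∸ 2 * j))
      ranks≡ = trans (cong (map ∣_∣) g≡) (trans (sym (map-∘ (full (len d)))) (trans
        (map-cong-local (All.tabulate λ u → trans (rk-shift (φ-mor c) (in-grid u)) (trans (cong (shft c +_) (rk-shift (embed d) u)) (sym (+-assoc (shft c) (base d) _)))))
        (trans (rng-shift j 0 (suc (len d))) (trans (cong (λ s → rng s (suc (len d))) (+-identityʳ j)) (trans (sym (applyUpTo≡rng j (suc (len d))))
          (cong (λ l → applyUpTo (j +_) (suc l)) (sym (trans (cong (_∸ 2 * j) (sym N≡)) (m+n∸m≡n (2 * j) (len d))))))))))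
      linked : Linked _⊆_ (map (φ c) (els d))
      linked = subst (Linked _⊆_) (sym g≡) (linked-rng g 0 (suc (len d)) λ u v → proj₁ (⋖-pres (φ-mor c) (in-grid u) (in-grid v) (⋖-pres (embed d) u v refl)))
      within′ : ∀ {x} → x ∈ map (φ c) (els d) → ∀ k → block ns x k ∈ A c k
      within′ x∈ k with ∈-map⁻ (φ c) x∈
      ... | p , p∈ , refl = inA c (i p∈) k
      proper′ : ∀ {x y} → x ∈ map (φ c) (els d) → y ∈ map (φ c) (els d) → E (Blocks ns) x y →
        x ≡ y ⊎ (∀ k → block ns x k ≡ block ns y k → A c k ≡ [ block ns x k ])
      proper′ x∈ y∈ e with ∈-map⁻ (φ c) x∈ | ∈-map⁻ (φ c) y∈
      -- Only for the ends of the cuboid does the decomposition promise nothing; any other pair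
      -- related by `E` pulls back to equal positions.
      ... | p , p∈ , refl | q , q∈ , refl with (pt≟ (as c) p (botPt (as c))) ×-dec (pt≟ (as c) q (topPt (as c)))
      ...   | yes (refl , refl) = inj₂ (end-points c)
      ...   | no h with ∈-map⁻ (at d) p∈ | ∈-map⁻ (at d) q∈
      ...     | u , u∈ , refl | v , v∈ , refl = inj₁ (cong g (E-flat (E-refl (embed d) u∈ v∈ (E-refl (φ-mor c) (i p∈) (i q∈) e , h))))

    chains-of : Cuboid ns G → List (Chain (sum ns))
    chains-of c = map (map (φ c) ∘ els) (SCD.cs (chains c))

    concat-chains-of : ∀ c → concat (chains-of c) ↭ points c
    concat-chains-of c = ↭-trans (↭-reflexive (go (SCD.cs (chains c)))) (map⁺ (φ c) (SCD.perm (chains c)))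
      where
      go : ∀ ds → concat (map (map (φ c) ∘ els) ds) ≡ map (φ c) (concatMap els ds)
      go [] = refl
      go (d ∷ ds) = trans (cong (map (φ c) (els d) ++_) (go ds)) (sym (map-++ (φ c) (els d) _))

    fits-of : ∀ c {C} → C ∈ chains-of c → Fits ns G C
    fits-of c C∈ with ∈-map⁻ (map (φ c) ∘ els) C∈
    ... | d , d∈ , refl = fits c d λ x∈ → ∈-resp-↭ (SCD.perm (chains c)) (∈-concat⁺′ x∈ (∈-map⁺ els d∈))

  refine : List (Cuboid ns G) → List (Chain (sum ns))
  refine = concatMap chains-of

  concat-refine : ∀ cs → concat (refine cs) ↭ concatMap points cs
  concat-refine [] = ↭-refl
  concat-refine (c ∷ cs) = ↭-trans (↭-reflexive (sym (concat-++ (chains-of c) (refine cs)))) (++⁺ (concat-chains-of c) (concat-refine cs))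

  fits-refine : ∀ cs {C} → C ∈ refine cs → Fits ns G C
  fits-refine (c ∷ cs) C∈ with ∈-++⁻ (chains-of c) C∈
  ... | inj₁ p = fits-of c p
  ... | inj₂ p = fits-refine cs p

-- Almost orthogonality

module _ {A : Set} where
  two∈ : ∀ {x y : A} {L} → x ∈ L → y ∈ L → x ≢ y → 2 ≤ length L
  two∈ (here refl) (here refl) h = ⊥-elim (h refl)
  two∈ (here refl) (there (here _)) h = s≤s (s≤s z≤n)
  two∈ (here refl) (there (there _)) h = s≤s (s≤s z≤n)
  two∈ (there (here _)) q h = s≤s (s≤s z≤n)
  two∈ (there (there _)) q h = s≤s (s≤s z≤n)

  three∈ : ∀ {x y z : A} {L} → x ∈ L → y ∈ L → z ∈ L → x ≢ y → x ≢ z → y ≢ z → 3 ≤ length L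
  three∈ (here refl) (here refl) _ h _ _ = ⊥-elim (h refl)
  three∈ (here refl) _ (here refl) _ h _ = ⊥-elim (h refl)
  three∈ _ (here refl) (here refl) _ _ h = ⊥-elim (h refl)
  three∈ (here _) (there q) (there r) _ _ h = s≤s (two∈ q r h)
  three∈ (there p) (here _) (there r) _ h _ = s≤s (two∈ p r h)
  three∈ (there p) (there q) (here _) h _ _ = s≤s (two∈ p q h)
  three∈ (there p) (there q) (there r) h k l = m≤n⇒m≤1+n (three∈ p q r h k l)

  unique≤1 : ∀ {L : List A} → Unique L → (∀ {x y} → x ∈ L → y ∈ L → x ≡ y) → length L ≤ 1
  unique≤1 {[]} _ _ = z≤n
  unique≤1 {_ ∷ []} _ _ = s≤s z≤n
  unique≤1 {_ ∷ _ ∷ _} ((h ∷ _) ∷ _) e = ⊥-elim (h (e (here refl) (there (here refl))))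

  unique≤2 : ∀ {L : List A} {a b} → Unique L → (∀ {x} → x ∈ L → x ≡ a ⊎ x ≡ b) → length L ≤ 2
  unique≤2 {[]} _ _ = z≤n
  unique≤2 {_ ∷ []} _ _ = s≤s z≤n
  unique≤2 {_ ∷ _ ∷ []} _ _ = s≤s (s≤s z≤n)
  unique≤2 {_ ∷ _ ∷ _ ∷ _} ((h ∷ k ∷ _) ∷ (l ∷ _) ∷ _) e with e (here refl) | e (there (here refl)) | e (there (there (here refl)))
  ... | inj₁ refl | inj₁ refl | _ = ⊥-elim (h refl)
  ... | inj₂ refl | inj₂ refl | _ = ⊥-elim (h refl)
  ... | inj₁ refl | inj₂ refl | inj₁ refl = ⊥-elim (k refl)
  ... | inj₁ refl | inj₂ refl | inj₂ refl = ⊥-elim (l refl)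
  ... | inj₂ refl | inj₁ refl | inj₁ refl = ⊥-elim (l refl)
  ... | inj₂ refl | inj₁ refl | inj₂ refl = ⊥-elim (k refl)

  comparable : ∀ {R : A → A → Set} {L x y} → AllPairs R L → x ∈ L → y ∈ L → x ≢ y → R x y ⊎ R y x
  comparable (_ ∷ _) (here refl) (here refl) h = ⊥-elim (h refl)
  comparable (p ∷ _) (here refl) (there q) _ = inj₁ (All.lookup p q)
  comparable (p ∷ _) (there q) (here refl) _ = inj₂ (All.lookup p q)
  comparable (_ ∷ ps) (there p) (there q) h = comparable ps p q h

∅≢⊤ : ∀ {n} → n ≢ 0 → ∅ {n} ≢ ⊤ˢ
∅≢⊤ {n} h e = h (trans (sym (∣⊤∣≡n n)) (trans (cong ∣_∣ (sym e)) (∣⊥∣≡0 n)))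

bottomTop? : ∀ {n} (C : Chain n) → Dec (HasBottomTop C)
bottomTop? C = (∅ ∈? C) ×-dec (⊤ˢ ∈? C)
  where open DecMem _≟ₛ_

meet : ∀ {n} → Chain n → Chain n → List (Subset n)
meet A B = filter (λ x → x ∈? B) A
  where open DecMem _≟ₛ_

∈-meet : ∀ {n} {A B : Chain n} {x} → x ∈ A → x ∈ B → x ∈ meet A B
∈-meet {B = B} = ∈-filter⁺ (λ x → x ∈? B)
  where open DecMem _≟ₛ_

∈-meet⁻ : ∀ {n} (A B : Chain n) {x} → x ∈ meet A B → x ∈ A × x ∈ B
∈-meet⁻ A B = ∈-filter⁻ (λ x → x ∈? B)
  where open DecMem _≟ₛ_

-- Two common elements exceed the bound 1, so both chains contain ∅ and the whole set. These already
-- account for the intersection of size 2, and inclusion decides which is which.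
orthogonal⇒bottomTop : ∀ {n F G A B} → n ≢ 0 → AlmostOrthogonal n F G → A ∈ F → B ∈ G →
  ∀ {x y} → x ∈ A → x ∈ B → y ∈ A → y ∈ B → x ⊆ y → x ≢ y → x ≡ ∅ × y ≡ ⊤ˢ
orthogonal⇒bottomTop {A = A} {B} n≢0 o A∈ B∈ {x} {y} xA xB yA yB x⊆y x≢y with bottomTop? A ×-dec bottomTop? B
... | no h = ⊥-elim (1+n≰n (≤-trans (two∈ (∈-meet xA xB) (∈-meet yA yB) x≢y) (proj₂ (o A B A∈ B∈) h)))
... | yes h = [ (λ e → e , [ (λ f → ⊥-elim (x≢y (trans e (sym f)))) , id ]′ (ends yA yB))
              , (λ e → ⊥-elim (x≢y (⊆-antisym x⊆y (subst (y ⊆_) (sym e) ⊆⊤)))) ]′ (ends xA xB)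
  where
  ends : ∀ {z} → z ∈ A → z ∈ B → z ≡ ∅ ⊎ z ≡ ⊤ˢ
  ends {z} zA zB with z ≟ₛ ∅ | z ≟ₛ ⊤ˢ
  ... | yes e | _ = inj₁ e
  ... | no _ | yes e = inj₂ e
  ... | no e | no f = ⊥-elim (1+n≰n (≤-trans
          (three∈ (∈-meet zA zB) (∈-meet (proj₁ (proj₁ h)) (proj₁ (proj₂ h))) (∈-meet (proj₂ (proj₁ h)) (proj₂ (proj₂ h))) e f (∅≢⊤ n≢0))
          (≤-reflexive (proj₁ (o A B A∈ B∈) h))))

block-ext : ∀ ns {x y} → (∀ i → block ns x i ≡ block ns y i) → x ≡ y
block-ext [] {Vec.[]} {Vec.[]} _ = refl
block-ext (n ∷ ns) {x} {y} h = trans (sym (VecP.take++drop≡id n x))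
  (trans (cong₂ Vec._++_ (h Fin.zero) (block-ext ns (h ∘ Fin.suc))) (VecP.take++drop≡id n y))

block-⊆ : ∀ ns {x y} → x ⊆ y → ∀ i → block ns x i ⊆ block ns y i
block-⊆ (n ∷ ns) {x} {y} h i = go i
  where
  parts : Vec.take n x ⊆ Vec.take n y × Vec.drop n x ⊆ Vec.drop n y
  parts = ++-⊆⁻ (Vec.take n x) (Vec.take n y) (subst₂ _⊆_ (sym (VecP.take++drop≡id n x)) (sym (VecP.take++drop≡id n y)) h)
  go : ∀ i → block (n ∷ ns) x i ⊆ block (n ∷ ns) y i
  go Fin.zero = proj₁ parts
  go (Fin.suc i) = block-⊆ ns (proj₂ parts) i

block-replicate : ∀ ns b i → block ns (Vec.replicate (sum ns) b) i ≡ Vec.replicate (lookup ns i) b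
block-replicate (n ∷ ns) b i = go i
  where
  replicate-+ : ∀ n → Vec.replicate (n + sum ns) b ≡ Vec.replicate n b Vec.++ Vec.replicate (sum ns) b
  replicate-+ zero = refl
  replicate-+ (suc n) = cong (b Vec.∷_) (replicate-+ n)
  go : ∀ i → block (n ∷ ns) (Vec.replicate (n + sum ns) b) i ≡ Vec.replicate (lookup (n ∷ ns) i) b
  go Fin.zero = trans (cong (Vec.take n) (replicate-+ n)) (take-++ _ (Vec.replicate (sum ns) b))
  go (Fin.suc i) = trans (cong (λ z → block ns (Vec.drop n z) i) (replicate-+ n))
    (trans (cong (λ z → block ns z i) (drop-++ (Vec.replicate n b) _)) (block-replicate ns b i))

-- A one-element symmetric chain sits in the middle rank. This gives access to goodness, which is
-- assumed for even `n`.
singleton-even : ∀ {n} (x : Subset n) → IsSymmetricChain n [ x ] → n % 2 ≡ 0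
singleton-even {n} x (j , l , e , _) = trans (cong (_% 2) n≡) (double%2 j)
  where
  zero-length : n ∸ 2 * j ≡ 0
  zero-length = go (n ∸ 2 * j) e
    where
    go : ∀ m → [ ∣ x ∣ ] ≡ applyUpTo (j +_) (suc m) → m ≡ 0
    go zero _ = refl
    go (suc m) ()
  n≡ : n ≡ double j
  n≡ = trans (sym (m+[n∸m]≡n l)) (trans (cong (2 * j +_) zero-length) (trans (+-identityʳ (2 * j))
    (trans (cong (j +_) (+-identityʳ j)) (trans (sym (+-identityʳ (j + j))) (trans (double-+ j 0) (cong double (+-identityʳ j)))))))

unique-↭ : ∀ {A : Set} {xs ys : List A} → xs ↭ ys → Unique xs → Unique ys
unique-↭ {A} p = Unique-resp-↭ (↭⇒↭ₛ p)
  where open PermSetoid (setoid A)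

universe-all : ∀ ns (G : Families ns) → (∀ i x → x ∈ concat (G i)) → ∀ x → x ∈ universe ns G
universe-all [] G h Vec.[] = here refl
universe-all (n ∷ ns) G h x = subst (_∈ universe (n ∷ ns) G) (VecP.take++drop≡id n x)
  (∈-map⁺ glue (∈-cartesianProduct⁺ (h Fin.zero (Vec.take n x)) (universe-all ns (G ∘ Fin.suc) (h ∘ Fin.suc) (Vec.drop n x))))

universe-unique : ∀ ns (G : Families ns) → (∀ i → Unique (concat (G i))) → Unique (universe ns G)
universe-unique [] G h = [] ∷ []
universe-unique (n ∷ ns) G h = Unique.map⁺ glue-injective (Unique.cartesianProduct⁺ (h Fin.zero) (universe-unique ns (G ∘ Fin.suc) (h ∘ Fin.suc)))
  where
  glue-injective : ∀ {p q : Subset n × Subset (sum ns)} → glue p ≡ glue q → p ≡ q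
  glue-injective {x , y} {x′ , y′} e = cong₂ _,_ (VecP.++-injectiveˡ x x′ e) (VecP.++-injectiveʳ x x′ e)

module Refinement {k : ℕ} {ns : List ℕ} (2≤n : ∀ i → 2 ≤ lookup ns i) (six : 6 ≤ numOdd ns)
  (F : (i : Fin (length ns)) → Fin k → List (Chain (lookup ns i)))
  (scd : ∀ i j → IsSCD (lookup ns i) (F i j))
  (orth : ∀ i → PairwiseAlmostOrthogonal (lookup ns i) k (F i))
  (good : ∀ i → lookup ns i % 2 ≡ 0 → Good (lookup ns i) k (F i)) where

  G : Fin k → Families ns
  G j i = F i j

  private
    blocks : ∀ j → ∃[ cs ] concatMap (points {ns} {G j}) cs ↭ universe ns (G j)
    blocks j = cuboids ns (G j) 2≤n (λ i → proj₁ (scd i j))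

    fits : ∀ j {C} → C ∈ refine six (proj₁ (blocks j)) → Fits ns (G j) C
    fits j = fits-refine six (proj₁ (blocks j))

    cover : ∀ j → universe ns (G j) ↭ concat (refine six (proj₁ (blocks j)))
    cover j = ↭-sym (↭-trans (concat-refine six (proj₁ (blocks j))) (proj₂ (blocks j)))

    sum≢0 : sum ns ≢ 0
    sum≢0 = go ns 2≤n six
      where
      go : ∀ ns → (∀ i → 2 ≤ lookup ns i) → 6 ≤ numOdd ns → sum ns ≢ 0
      go [] _ ()
      go (n ∷ ns) h _ e with h Fin.zero
      ... | l rewrite m+n≡0⇒m≡0 n e with l
      ...   | ()

    -- Two common elements differ in some blocks only, each going from ∅ to the full block there, so they are the
    -- ends of both cuboids; the other blocks would be common one-element chains.
    common : ∀ {j j′ C D} → j ≢ j′ → Fits ns (G j) C → Fits ns (G j′) D →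
      ∀ {x y} → x ∈ C → x ∈ D → y ∈ C → y ∈ D → x ⊆ y → x ≢ y → x ≡ ∅ × y ≡ ⊤ˢ
    common {j} {j′} j≢j′ f g {x} {y} xC xD yC yD x⊆y x≢y =
      block-ext ns (λ i → trans (proj₁ (ends i)) (sym (block-replicate ns outside i))) ,
      block-ext ns (λ i → trans (proj₂ (ends i)) (sym (block-replicate ns inside i)))
      where
      open Fits
      bad : E (Blocks ns) x y
      bad i with block ns x i ≟ₛ block ns y i
      ... | yes e = inj₁ e
      ... | no h = inj₂ (orthogonal⇒bottomTop (λ e → 1+n≰n (≤-trans (2≤n i) (≤-trans (≤-reflexive e) z≤n))) (orth i j j′ j≢j′) (A∈ f i) (A∈ g i)
                     (within f xC i) (within g xD i) (within f yC i) (within g yD i) (block-⊆ ns x⊆y i) h)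
      ends : ∀ i → block ns x i ≡ ∅ × block ns y i ≡ ⊤ˢ
      ends i with bad i | proper f xC yC bad | proper g xD yD bad
      ... | inj₂ e | _ | _ = e
      ... | inj₁ e | inj₁ h | _ = ⊥-elim (x≢y h)
      ... | inj₁ e | inj₂ _ | inj₁ h = ⊥-elim (x≢y h)
      ... | inj₁ e | inj₂ p | inj₂ q = ⊥-elim (good i (singleton-even z (proj₁ (scd i j) [ z ] zF)) j j′ j≢j′ z zF
              (subst (_∈ F i j′) (q i e) (A∈ g i)))
        where
        z = block ns x i
        zF : [ z ] ∈ F i j
        zF = subst (_∈ F i j) (p i e) (A∈ f i)

    common′ : ∀ {j j′ C D} → j ≢ j′ → Fits ns (G j) C → Fits ns (G j′) D →
      ∀ {x y} → x ∈ C → x ∈ D → y ∈ C → y ∈ D → x ≢ y → (x ≡ ∅ × y ≡ ⊤ˢ) ⊎ (y ≡ ∅ × x ≡ ⊤ˢ)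
    common′ j≢j′ f g xC xD yC yD x≢y with comparable (Linked⇒AllPairs ⊆-trans (proj₂ (proj₂ (proj₂ (Fits.symm f))))) xC yC x≢y
    ... | inj₁ s = inj₁ (common j≢j′ f g xC xD yC yD s x≢y)
    ... | inj₂ s = inj₂ (common j≢j′ f g yC yD xC xD s (x≢y ∘ sym))

    unique : ∀ {j C} → Fits ns (G j) C → Unique C
    unique f with Fits.symm f
    ... | i , _ , e , _ = Unique.map⁻ (subst Unique (sym e) (Unique.applyUpTo⁺₁ (i +_) _ λ l _ e′ → <⇒≢ l (+-cancelˡ-≡ i _ _ e′)))

    orthogonal : ∀ {j j′ C D} → j ≢ j′ → Fits ns (G j) C → Fits ns (G j′) D →
      ((HasBottomTop C × HasBottomTop D) → interSize C D ≡ 2) × (¬ (HasBottomTop C × HasBottomTop D) → interSize C D ≤ 1)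
    orthogonal {C = C} {D} j≢j′ f g = both , other
      where
      unique-meet : Unique (meet C D)
      unique-meet = Unique.filter⁺ _ (unique f)
      both : HasBottomTop C × HasBottomTop D → length (meet C D) ≡ 2
      both ((⊥C , ⊤C) , (⊥D , ⊤D)) = ≤-antisym (unique≤2 unique-meet ends) (two∈ (∈-meet ⊥C ⊥D) (∈-meet ⊤C ⊤D) (∅≢⊤ sum≢0))
        where
        ends : ∀ {x} → x ∈ meet C D → x ≡ ∅ ⊎ x ≡ ⊤ˢ
        ends {x} x∈ with ∈-meet⁻ C D x∈ | x ≟ₛ ∅
        ... | _ | yes e = inj₁ e
        ... | xC , xD | no h = inj₂ (proj₂ (common j≢j′ f g ⊥C ⊥D xC xD ⊥⊆ (h ∘ sym)))
      other : ¬ (HasBottomTop C × HasBottomTop D) → length (meet C D) ≤ 1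
      other h = unique≤1 unique-meet λ {x} {y} x∈ y∈ → same′ x y (∈-meet⁻ C D x∈) (∈-meet⁻ C D y∈)
        where
        same′ : ∀ x y → x ∈ C × x ∈ D → y ∈ C × y ∈ D → x ≡ y
        same′ x y (xC , xD) (yC , yD) with x ≟ₛ y
        ... | yes e = e
        ... | no x≢y with common′ j≢j′ f g xC xD yC yD x≢y
        ...   | inj₁ (refl , refl) = ⊥-elim (h ((xC , yC) , (xD , yD)))
        ...   | inj₂ (refl , refl) = ⊥-elim (h ((yC , xC) , (yD , xD)))

  decomposition : Fin k → List (Chain (sum ns))
  decomposition j = refine six (proj₁ (blocks j))

  decomposition-SCD : ∀ j → IsSCD (sum ns) (decomposition j)
  decomposition-SCD j =
    (λ C C∈ → Fits.symm (fits j C∈)) ,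
    (λ x → ∈-resp-↭ (cover j) (universe-all ns (G j) (λ i → proj₁ (proj₂ (scd i j))) x)) ,
    unique-↭ (cover j) (universe-unique ns (G j) (λ i → proj₂ (proj₂ (scd i j))))

  decomposition-orthogonal : PairwiseAlmostOrthogonal (sum ns) k decomposition
  decomposition-orthogonal j j′ j≢j′ C D C∈ D∈ = orthogonal j≢j′ (fits j C∈) (fits j′ D∈)

  decomposition-fits : ∀ j {C} → C ∈ decomposition j → Fits ns (G j) C
  decomposition-fits = fits

theorem3p4 : (k : ℕ) → 3 ≤ k → (ns : List ℕ) →
    ((i : Fin (length ns)) → 2 ≤ lookup ns i) →
    6 ≤ numOdd ns →
    (F : (i : Fin (length ns)) → Fin k → List (Chain (lookup ns i))) →
    ((i : Fin (length ns)) (j : Fin k) → IsSCD (lookup ns i) (F i j)) →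
    ((i : Fin (length ns)) → PairwiseAlmostOrthogonal (lookup ns i) k (F i)) →
    ((i : Fin (length ns)) → lookup ns i % 2 ≡ 0 → Good (lookup ns i) k (F i)) →
    Σ (Fin k → List (Chain (sum ns))) λ H →
    ((j : Fin k) → IsSCD (sum ns) (H j))
    × PairwiseAlmostOrthogonal (sum ns) k H
    × ((j : Fin k) (C : Chain (sum ns)) → C ∈ H j →
    Σ ((i : Fin (length ns)) → Chain (lookup ns i)) λ A →
    ((i : Fin (length ns)) → A i ∈ F i j)
    × ((x : _) → x ∈ C → (i : Fin (length ns)) → block ns x i ∈ A i))
theorem3p4 k _ ns 2≤n six F scd orth good =
  decomposition , decomposition-SCD , decomposition-orthogonal ,
  λ j C C∈ → let f = decomposition-fits j C∈ in Fits.A f , Fits.A∈ f , λ x x∈ → Fits.within f x∈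
  where open Refinement {ns = ns} 2≤n six F scd orth good
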